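{- Let $q$ be a prime power and $n$ a positive integer. The characteristic polynomial of the matroid dual to $PG(n-1,q)$ satisfies $$\chi_{PG(n-1,q)^*}(x)=\frac{(-1)^{\frac{q^n-1}{q-1}}}{x^n}\sum_{k=0}^n\binom{n}{k}_q(1-x)^{\frac{q^k-1}{q-1}}\prod_{i=0}^{n-k-1}(x-q^i),$$ where the empty product (for $k=n$) equals $1$.
   Context: $PG(n-1,q)$ denotes the matroid whose ground set $E$ is the set of all points of the $(n-1)$-dimensional projective space over the finite field $\mathbb{F}_q$ (i.e. the one-dimensional subspaces of $\mathbb{F}_q^n$), the rank $r(A)$ of $A\subseteq E$ being the dimension of the linear subspace of $\mathbb{F}_q^n$ spanned by $A$. The Gaussian binomial coefficient is $$\binom{n}{k}_q=\frac{(q^n-1)(q^{n-1}-1)\cdots(q^{n-k+1}-1)}{(q^k-1)(q^{k-1}-1)\cdots(q-1)}.$$ The dual $M^*=(E,r^*)$ of a matroid $M=(E,r)$ has rank function $r^*(A)=r(E-A)+|A|-r(E)$, and the characteristic polynomial of a matroid $M=(E,r)$ is $\chi_M(x)=\sum_{A\subseteq E}(-1)^{|A|}x^{r(E)-r(A)}$. -}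

module Defs where

open import Algebra.Bundles using (AbelianGroup; CommutativeRing)
open import Algebra.Structures using (IsAbelianGroup)
import Algebra.Properties.Semiring.Exp as Exp
import Algebra.Construct.Pointwise as Pointwise
open import Algebra.Module.Bundles using (LeftModule)
import Algebra.Properties.AbelianGroup as AbelianGroupProperties
import Algebra.Properties.CommutativeMonoid.Sum as Sum
import Algebra.Properties.CommutativeSemigroup as CommutativeSemigroupProperties
import Algebra.Properties.Ring as RingProperties
open import Data.Fin.Base as Fin using (Fin; zero; suc; toℕ; combine; finToFun; funToFin)
import Data.Fin.Properties as Fin
open import Data.Fin.Subset
  using (Subset; inside; outside; _∈_; _⊆_; _∪_; _∩_; ∁; ∣_∣; ⊤)
import Data.Fin.Subset.Properties as Subset
open import Data.Nat.Base as ℕ using (ℕ; zero; suc; z≤n; s≤s; NonZero; NonTrivial)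
import Data.Nat.Properties as ℕ
open import Data.Nat.Divisibility
  using (_∣_; _∣0; ∣-refl; ∣-reflexive; ∣m∣n⇒∣m+n; ∣n⇒∣m*n; *-monoʳ-∣)
open import Data.Nat.DivMod using (_/_)
open import Data.Integer.Base as ℤ using (ℤ; 0ℤ; 1ℤ)
import Data.Integer.Properties as ℤ
open import Data.Nat.Primality using (Prime; prime⇒nonTrivial)
open import Data.List.Base as List using (List; []; _∷_)
open import Data.List.Relation.Unary.All as All using (All)
open import Data.List.Membership.Propositional.Properties using (∈-lookup)
open import Data.List.Relation.Unary.AllPairs using ([]; _∷_)
open import Data.List.Relation.Unary.Any as Any using (Any; here; there)
import Data.List.Relation.Unary.Any.Properties as Any
open import Data.List.Relation.Unary.Enumerates.Setoid.Properties using (deduplicate⁺)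
open import Data.List.Relation.Unary.Unique.DecSetoid.Properties using (deduplicate-!)
open import Data.List.Relation.Unary.Unique.Setoid using (Unique)
open import Data.Product.Base using (∃; ∃₂; _×_; _,_; proj₁; proj₂)
open import Data.Sum.Base using (inj₁; inj₂)
open import Data.Vec.Base as Vec using (Vec; []; _∷_; _++_; here; there)
import Data.Vec.Properties as Vec
open import Data.Vec.Functional as Vector using (Vector)
import Data.Vec.Functional.Relation.Binary.Equality.Setoid as VectorEquality
open import Data.Vec.Relation.Unary.All as VAll using ([]; _∷_) renaming (All to VAll)
import Data.Vec.Relation.Unary.All.Properties as VAll
open import Function.Base using (_∘_; id)
open import Function.Bundles using (Inverse)
open import Function.Definitions using (Injective)
open import Level using (Level; _⊔_)
open import Relation.Binary.Bundles using (DecSetoid)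
open import Relation.Binary.Structures using (IsEquivalence)
open import Relation.Binary.Definitions using (Decidable)
open import Relation.Binary.PropositionalEquality as ≡ using (_≡_)
open import Relation.Nullary.Decidable using (Dec; yes; no; map′)
open import Relation.Nullary.Negation using (¬_; contradiction)
open import Relation.Unary using (Pred)

private
  variable
    c ℓ m ℓm p : Level

record PrimePower (q : ℕ) : Set where
  field
    {base}     : ℕ
    {exponent} : ℕ
    prime      : Prime base
    q≡p^k      : q ≡ base ℕ.^ exponent
    exponent>0 : 0 ℕ.< exponent

record FiniteField c ℓ (q : ℕ) : Set (Level.suc (c ⊔ ℓ)) where
  field
    commutativeRing : CommutativeRing c ℓ

  open CommutativeRing commutativeRing public hiding (zero)

  field
    1≉0         : ¬ 1# ≈ 0#
    inverse     : ∀ x → ¬ x ≈ 0# → ∃ λ y → x * y ≈ 1#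
    enumeration : Inverse (≡.setoid (Fin q)) setoid

module FiniteFieldProperties {q} (F : FiniteField c ℓ q) where

  open FiniteField F
  open Inverse enumeration
  open VectorEquality setoid using (_≋_; ≋-setoid)

  infix 4 _≟_

  _≟_ : Decidable _≈_
  x ≟ y = map′
    (λ eq → trans (sym (strictlyInverseˡ x)) (trans (reflexive (≡.cong to eq)) (strictlyInverseˡ y)))
    from-cong
    (from x Fin.≟ from y)

  1<q : 1 ℕ.< q
  1<q = Fin⇒1< (from 0#) (from 1#) λ eq →
    1≉0 (trans (sym (strictlyInverseˡ 1#))
        (trans (reflexive (≡.cong to (≡.sym eq))) (strictlyInverseˡ 0#)))
    where
    Fin⇒1< : ∀ {n} (i j : Fin n) → ¬ i ≡ j → 1 ℕ.< n
    Fin⇒1< {suc zero}    zero zero i≢j = contradiction ≡.refl i≢j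
    Fin⇒1< {suc (suc n)} i    j    i≢j = s≤s (s≤s z≤n)

  private
    funToFin-cong : ∀ {d n} {f g : Fin d → Fin n} → (∀ i → f i ≡ g i) → funToFin f ≡ funToFin g
    funToFin-cong {zero}  f≗g = ≡.refl
    funToFin-cong {suc d} f≗g = ≡.cong₂ combine (f≗g zero) (funToFin-cong (f≗g ∘ suc))

  toVector : ∀ d → Fin (q ℕ.^ d) → Vector Carrier d
  toVector d k i = to (finToFun {q} {d} k i)

  fromVector : ∀ {d} → Vector Carrier d → Fin (q ℕ.^ d)
  fromVector v = funToFin (from ∘ v)

  toVector-fromVector : ∀ {d} (v : Vector Carrier d) → toVector d (fromVector v) ≋ v
  toVector-fromVector v i =
    trans (reflexive (≡.cong to (Fin.finToFun-funToFin (from ∘ v) i))) (strictlyInverseˡ (v i))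

  fromVector-cong : ∀ {d} {v w : Vector Carrier d} → v ≋ w → fromVector v ≡ fromVector w
  fromVector-cong v≋w = funToFin-cong (from-cong ∘ v≋w)

  fromVector-toVector : ∀ d k → fromVector (toVector d k) ≡ k
  fromVector-toVector d k = ≡.trans
    (funToFin-cong {d} (strictlyInverseʳ ∘ finToFun {q} {d} k))
    (Fin.funToFin-finToFin {d} {q} k)

  toVector-injective : ∀ d {k l} → toVector d k ≋ toVector d l → k ≡ l
  toVector-injective d {k} {l} eq = ≡.trans (≡.sym (fromVector-toVector d k))
    (≡.trans (fromVector-cong eq) (fromVector-toVector d l))

  anyVector? : ∀ {d} {P : Pred (Vector Carrier d) p} →
               (∀ {v w} → v ≋ w → P v → P w) → (∀ v → Dec (P v)) → Dec (∃ P)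
  anyVector? resp P? = map′
    (λ (k , Pk) → toVector _ k , Pk)
    (λ (v , Pv) → fromVector v , resp (sym ∘ toVector-fromVector v) Pv)
    (Fin.any? (P? ∘ toVector _))

module LinearAlgebra {q} (F : FiniteField c ℓ q) (V : LeftModule (FiniteField.ring F) m ℓm) where

  open FiniteField F
  open LeftModule V
  open Sum +ᴹ-commutativeMonoid using (sum; sum-cong-≋; ∑-distrib-+)

  -- The smallest linear subspace containing P.
  data Span (P : Pred Carrierᴹ p) : Pred Carrierᴹ (c ⊔ m ⊔ ℓm ⊔ p) where
    generator : ∀ {v} → P v → Span P v
    zeroᴹ     : Span P 0ᴹ
    add       : ∀ {v w} → Span P v → Span P w → Span P (v +ᴹ w)
    scale     : ∀ a {v} → Span P v → Span P (a *ₗ v)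
    resp      : ∀ {v w} → v ≈ᴹ w → Span P v → Span P w

  Span-mono : ∀ {p′} {P : Pred Carrierᴹ p} {Q : Pred Carrierᴹ p′} →
              (∀ {v} → P v → Q v) → ∀ {v} → Span P v → Span Q v
  Span-mono P⊆Q (generator Pv) = generator (P⊆Q Pv)
  Span-mono P⊆Q zeroᴹ          = zeroᴹ
  Span-mono P⊆Q (add x y)      = add (Span-mono P⊆Q x) (Span-mono P⊆Q y)
  Span-mono P⊆Q (scale a x)    = scale a (Span-mono P⊆Q x)
  Span-mono P⊆Q (resp eq x)    = resp eq (Span-mono P⊆Q x)

  linComb : ∀ {d} → Vector Carrier d → Vec Carrierᴹ d → Carrierᴹ
  linComb a b = sum (λ i → a i *ₗ Vec.lookup b i)

  LinearlyIndependent : ∀ {d} → Vec Carrierᴹ d → Set _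
  LinearlyIndependent b = ∀ a → linComb a b ≈ᴹ 0ᴹ → ∀ i → a i ≈ 0#

  record LC {d} (b : Vec Carrierᴹ d) (v : Carrierᴹ) : Set (c ⊔ ℓm) where
    constructor _,_
    field
      coefficients : Vector Carrier d
      v≈           : v ≈ᴹ linComb coefficients b

  open LC

  record IsBasis {d} (b : Vec Carrierᴹ d) (S : Pred Carrierᴹ p) : Set (c ⊔ ℓ ⊔ m ⊔ ℓm ⊔ p) where
    field
      ⊆S          : VAll S b
      independent : LinearlyIndependent b
      generates   : ∀ {v} → S v → LC b v

  HasDimension : Pred Carrierᴹ p → ℕ → Set _
  HasDimension S d = ∃ λ (b : Vec Carrierᴹ d) → IsBasis b S

  private
    module VG = AbelianGroupProperties +ᴹ-abelianGroup
    module FR = RingProperties ring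

  linComb-cong : ∀ {d} {a a′ : Vector Carrier d} (b : Vec Carrierᴹ d) →
                 (∀ i → a i ≈ a′ i) → linComb a b ≈ᴹ linComb a′ b
  linComb-cong b eq = sum-cong-≋ (λ i → *ₗ-congʳ (eq i))

  linComb-+ : ∀ {d} (a a′ : Vector Carrier d) (b : Vec Carrierᴹ d) →
              linComb (λ i → a i + a′ i) b ≈ᴹ linComb a b +ᴹ linComb a′ b
  linComb-+ a a′ b = ≈ᴹ-trans
    (sum-cong-≋ (λ i → *ₗ-distribʳ (Vec.lookup b i) (a i) (a′ i)))
    (∑-distrib-+ (λ i → a i *ₗ Vec.lookup b i) (λ i → a′ i *ₗ Vec.lookup b i))

  linComb-* : ∀ {d} x (a : Vector Carrier d) (b : Vec Carrierᴹ d) →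
              linComb (λ i → x * a i) b ≈ᴹ x *ₗ linComb a b
  linComb-* x a []      = ≈ᴹ-sym (*ₗ-zeroʳ x)
  linComb-* x a (v ∷ b) = ≈ᴹ-trans
    (+ᴹ-cong (*ₗ-assoc x (a zero) v) (linComb-* x (a ∘ suc) b))
    (≈ᴹ-sym (*ₗ-distribˡ x _ _))

  linComb-0 : ∀ {d} (b : Vec Carrierᴹ d) → linComb (λ _ → 0#) b ≈ᴹ 0ᴹ
  linComb-0 []      = ≈ᴹ-refl
  linComb-0 (v ∷ b) = ≈ᴹ-trans (+ᴹ-cong (*ₗ-zeroˡ v) (linComb-0 b)) (+ᴹ-identityˡ 0ᴹ)

  -1*ₗ : ∀ v → (- 1#) *ₗ v ≈ᴹ -ᴹ v
  -1*ₗ v = VG.inverseˡ-unique _ _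
    (≈ᴹ-trans (+ᴹ-congˡ (≈ᴹ-sym (*ₗ-identityˡ v)))
    (≈ᴹ-trans (≈ᴹ-sym (*ₗ-distribʳ v (- 1#) 1#))
    (≈ᴹ-trans (*ₗ-congʳ (-‿inverseˡ 1#)) (*ₗ-zeroˡ v))))

  LC-0 : ∀ {d} (b : Vec Carrierᴹ d) → LC b 0ᴹ
  LC-0 b = (λ _ → 0#) , ≈ᴹ-sym (linComb-0 b)

  LC-+ : ∀ {d} {b : Vec Carrierᴹ d} {v w} → LC b v → LC b w → LC b (v +ᴹ w)
  LC-+ {b = b} (a , v≈) (a′ , w≈) =
    (λ i → a i + a′ i) , ≈ᴹ-trans (+ᴹ-cong v≈ w≈) (≈ᴹ-sym (linComb-+ a a′ b))

  LC-* : ∀ {d} {b : Vec Carrierᴹ d} x {v} → LC b v → LC b (x *ₗ v)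
  LC-* {b = b} x (a , v≈) =
    (λ i → x * a i) , ≈ᴹ-trans (*ₗ-congˡ v≈) (≈ᴹ-sym (linComb-* x a b))

  LC-resp : ∀ {d} {b : Vec Carrierᴹ d} {v w} → v ≈ᴹ w → LC b v → LC b w
  LC-resp v≈w (a , v≈) = a , ≈ᴹ-trans (≈ᴹ-sym v≈w) v≈

  LC-there : ∀ {d} u {b : Vec Carrierᴹ d} {v} → LC b v → LC (u ∷ b) v
  LC-there u {b} (a , v≈) = (0# Vector.∷ a) ,
    ≈ᴹ-trans v≈ (≈ᴹ-sym (≈ᴹ-trans (+ᴹ-congʳ (*ₗ-zeroˡ u)) (+ᴹ-identityˡ _)))

  LC-here : ∀ {d} u (b : Vec Carrierᴹ d) → LC (u ∷ b) u
  LC-here u b = (1# Vector.∷ λ _ → 0#) ,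
    ≈ᴹ-sym (≈ᴹ-trans (+ᴹ-cong (*ₗ-identityˡ u) (linComb-0 b)) (+ᴹ-identityʳ u))

  LC-lookup : ∀ {d} (b : Vec Carrierᴹ d) i → LC b (Vec.lookup b i)
  LC-lookup (u ∷ b) zero    = LC-here u b
  LC-lookup (u ∷ b) (suc i) = LC-there u (LC-lookup b i)

  LC-++ʳ : ∀ {d e} (k : Vec Carrierᴹ e) {b : Vec Carrierᴹ d} {v} → LC b v → LC (k ++ b) v
  LC-++ʳ []      v∈ = v∈
  LC-++ʳ (u ∷ k) v∈ = LC-there u (LC-++ʳ k v∈)

  Span⊆LC : ∀ {P : Pred Carrierᴹ p} {d} {b : Vec Carrierᴹ d} →
            (∀ {v} → P v → LC b v) → ∀ {v} → Span P v → LC b v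
  Span⊆LC P⊆ (generator Pv) = P⊆ Pv
  Span⊆LC {b = b} P⊆ zeroᴹ  = LC-0 b
  Span⊆LC P⊆ (add x y)      = LC-+ (Span⊆LC P⊆ x) (Span⊆LC P⊆ y)
  Span⊆LC P⊆ (scale a x)    = LC-* a (Span⊆LC P⊆ x)
  Span⊆LC P⊆ (resp eq x)    = LC-resp eq (Span⊆LC P⊆ x)

  linComb∈LC : ∀ {d e} {b : Vec Carrierᴹ d} {w : Vec Carrierᴹ e} →
               VAll (LC b) w → ∀ a → LC b (linComb a w)
  linComb∈LC {b = b} []          a = LC-0 b
  linComb∈LC         (v∈ ∷ w∈)   a = LC-+ (LC-* (a zero) v∈) (linComb∈LC w∈ (a ∘ suc))

  LC-trans : ∀ {d e} {b : Vec Carrierᴹ d} {w : Vec Carrierᴹ e} →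
             VAll (LC b) w → ∀ {v} → LC w v → LC b v
  LC-trans w⊆ (a , v≈) = LC-resp (≈ᴹ-sym v≈) (linComb∈LC w⊆ a)

  -- Distinct coefficient vectors give distinct combinations of w, so a
  -- choice of coefficients over b injects Fin (q ^ e) into Fin (q ^ d).
  exchange : ∀ {d e} {b : Vec Carrierᴹ d} {w : Vec Carrierᴹ e} →
             LinearlyIndependent w → VAll (LC b) w → e ℕ.≤ d
  exchange {d} {e} {b} {w} ind w⊆ =
    ℕ.≮⇒≥ λ d<e → ℕ.<⇒≱ (ℕ.^-monoʳ-< q 1<q d<e) (Fin.injective⇒≤ f-injective)
    where
    open FiniteFieldProperties F

    coeffs : Fin (q ℕ.^ e) → Vector Carrier d
    coeffs k = coefficients (linComb∈LC w⊆ (toVector e k))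

    f : Fin (q ℕ.^ e) → Fin (q ℕ.^ d)
    f k = fromVector (coeffs k)

    f-injective : Injective _≡_ _≡_ f
    f-injective {k} {l} fk≡fl = toVector-injective e λ i → FR.x∙y⁻¹≈ε⇒x≈y _ _
      (trans (+-congˡ (sym (FR.-1*x≈-x _))) (ind diff diff≈0 i))
      where
      diff : Vector Carrier e
      diff i = toVector e k i + (- 1#) * toVector e l i

      coeffs≈ : ∀ i → coeffs k i ≈ coeffs l i
      coeffs≈ i = trans (sym (toVector-fromVector (coeffs k) i))
        (trans (reflexive (≡.cong {A = Fin (q ℕ.^ d)} (λ z → toVector d z i) fk≡fl)) (toVector-fromVector (coeffs l) i))

      same : linComb (toVector e k) w ≈ᴹ linComb (toVector e l) w
      same = ≈ᴹ-trans (v≈ (linComb∈LC w⊆ (toVector e k)))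
        (≈ᴹ-trans (linComb-cong b coeffs≈) (≈ᴹ-sym (v≈ (linComb∈LC w⊆ (toVector e l)))))

      diff≈0 : linComb diff w ≈ᴹ 0ᴹ
      diff≈0 = ≈ᴹ-trans (linComb-+ (toVector e k) (λ i → (- 1#) * toVector e l i) w)
        (≈ᴹ-trans (+ᴹ-cong same (≈ᴹ-trans (linComb-* (- 1#) (toVector e l) w) (-1*ₗ _)))
                  (-ᴹ‿inverseʳ _))

  independent-[] : LinearlyIndependent []
  independent-[] a _ ()

  independent-∷ : ∀ {d} {b : Vec Carrierᴹ d} {u} →
                  LinearlyIndependent b → ¬ LC b u → LinearlyIndependent (u ∷ b)
  independent-∷ {d} {b} {u} ind u∉ a eq = go (a zero ≟ 0#)
    where
    open FiniteFieldProperties F using (_≟_)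

    go : Dec (a zero ≈ 0#) → ∀ i → a i ≈ 0#
    go (yes a₀≈0) zero    = a₀≈0
    go (yes a₀≈0) (suc i) = ind (a ∘ suc)
      (≈ᴹ-trans (≈ᴹ-sym (≈ᴹ-trans (+ᴹ-congʳ (≈ᴹ-trans (*ₗ-congʳ a₀≈0) (*ₗ-zeroˡ u))) (+ᴹ-identityˡ _))) eq) i
    go (no a₀≉0) = contradiction (LC-resp u≈ (LC-* y (LC-* (- 1#) (a ∘ suc , ≈ᴹ-refl)))) u∉
      where
      y = proj₁ (inverse (a zero) a₀≉0)

      u≈ : y *ₗ ((- 1#) *ₗ linComb (a ∘ suc) b) ≈ᴹ u
      u≈ = ≈ᴹ-trans (*ₗ-congˡ (≈ᴹ-trans (-1*ₗ _) (≈ᴹ-sym (VG.inverseˡ-unique _ _ eq))))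
        (≈ᴹ-trans (≈ᴹ-sym (*ₗ-assoc y (a zero) u))
        (≈ᴹ-trans (*ₗ-congʳ (trans (*-comm y (a zero)) (proj₂ (inverse (a zero) a₀≉0))))
                  (*ₗ-identityˡ u)))

  dimension-≤ : ∀ {d e p′} {S : Pred Carrierᴹ p} {T : Pred Carrierᴹ p′} →
                (∀ {v} → S v → T v) → HasDimension S d → HasDimension T e → d ℕ.≤ e
  dimension-≤ S⊆T (b , b-basis) (b′ , b′-basis) =
    exchange {w = b} (IsBasis.independent b-basis) (VAll.map (IsBasis.generates b′-basis ∘ S⊆T) (IsBasis.⊆S b-basis))

  dimension-unique : ∀ {d e} {S : Pred Carrierᴹ p} → HasDimension S d → HasDimension S e → d ≡ e
  dimension-unique x y = ℕ.≤-antisym (dimension-≤ id x y) (dimension-≤ id y x)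

  module _ (_≟ᴹ_ : Decidable _≈ᴹ_) where

    open FiniteFieldProperties F using (anyVector?)

    LC? : ∀ {d} (b : Vec Carrierᴹ d) v → Dec (LC b v)
    LC? b v = map′ (λ (a , v≈) → a , v≈) (λ (a , v≈) → a , v≈) (anyVector? (λ eq v≈ → ≈ᴹ-trans v≈ (linComb-cong b eq)) (λ a → v ≟ᴹ linComb a b))

    record Extension {d} (b : Vec Carrierᴹ d) {e} (vs : Vec Carrierᴹ e) (P : Pred Carrierᴹ p)
                     : Set (c ⊔ ℓ ⊔ m ⊔ ℓm ⊔ p) where
      constructor extension
      field
        {extra}     : ℕ
        new         : Vec Carrierᴹ extra
        new⊆P       : VAll P new
        independent : LinearlyIndependent (new ++ b)
        generates   : VAll (LC (new ++ b)) vs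

    extend : ∀ {d} {b : Vec Carrierᴹ d} {P : Pred Carrierᴹ p} → LinearlyIndependent b →
             ∀ {e} {vs : Vec Carrierᴹ e} → VAll P vs → Extension b vs P
    extend ind [] = extension [] [] ind []
    extend {b = b} ind {vs = v ∷ vs} (Pv ∷ Pvs) with extend {b = b} ind Pvs
    ... | extension new new⊆P ind′ gen with LC? (new ++ b) v
    ...   | yes v∈ = extension new new⊆P ind′ (v∈ ∷ gen)
    ...   | no  v∉ = extension (v ∷ new) (Pv ∷ new⊆P) (independent-∷ {b = new ++ b} ind′ v∉)
                       (LC-here v (new ++ b) ∷ VAll.map (LC-there v) gen)

record Matroid (N : ℕ) : Set where
  field
    rank            : Subset N → ℕ
    rank≤size       : ∀ A → rank A ℕ.≤ ∣ A ∣
    rank-mono       : ∀ {A B} → A ⊆ B → rank A ℕ.≤ rank B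
    rank-submodular : ∀ A B → rank (A ∪ B) ℕ.+ rank (A ∩ B) ℕ.≤ rank A ℕ.+ rank B

module SubsetProperties where

  ∣p∪q∣+∣p∩q∣≡∣p∣+∣q∣ : ∀ {n} (p q : Subset n) → ∣ p ∪ q ∣ ℕ.+ ∣ p ∩ q ∣ ≡ ∣ p ∣ ℕ.+ ∣ q ∣
  ∣p∪q∣+∣p∩q∣≡∣p∣+∣q∣ []            []            = ≡.refl
  ∣p∪q∣+∣p∩q∣≡∣p∣+∣q∣ (outside ∷ p) (outside ∷ q) = ∣p∪q∣+∣p∩q∣≡∣p∣+∣q∣ p q
  ∣p∪q∣+∣p∩q∣≡∣p∣+∣q∣ (outside ∷ p) (inside  ∷ q) =
    ≡.trans (≡.cong suc (∣p∪q∣+∣p∩q∣≡∣p∣+∣q∣ p q)) (≡.sym (ℕ.+-suc ∣ p ∣ ∣ q ∣))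
  ∣p∪q∣+∣p∩q∣≡∣p∣+∣q∣ (inside  ∷ p) (outside ∷ q) = ≡.cong suc (∣p∪q∣+∣p∩q∣≡∣p∣+∣q∣ p q)
  ∣p∪q∣+∣p∩q∣≡∣p∣+∣q∣ (inside  ∷ p) (inside  ∷ q) = ≡.cong suc
    (≡.trans (ℕ.+-suc ∣ p ∪ q ∣ ∣ p ∩ q ∣)
    (≡.trans (≡.cong suc (∣p∪q∣+∣p∩q∣≡∣p∣+∣q∣ p q)) (≡.sym (ℕ.+-suc ∣ p ∣ ∣ q ∣))))

  ∣p∩q∣+∣∁p∩q∣≡∣q∣ : ∀ {n} (p q : Subset n) → ∣ p ∩ q ∣ ℕ.+ ∣ ∁ p ∩ q ∣ ≡ ∣ q ∣
  ∣p∩q∣+∣∁p∩q∣≡∣q∣ []            []            = ≡.refl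
  ∣p∩q∣+∣∁p∩q∣≡∣q∣ (outside ∷ p) (outside ∷ q) = ∣p∩q∣+∣∁p∩q∣≡∣q∣ p q
  ∣p∩q∣+∣∁p∩q∣≡∣q∣ (outside ∷ p) (inside  ∷ q) =
    ≡.trans (ℕ.+-suc ∣ p ∩ q ∣ ∣ ∁ p ∩ q ∣) (≡.cong suc (∣p∩q∣+∣∁p∩q∣≡∣q∣ p q))
  ∣p∩q∣+∣∁p∩q∣≡∣q∣ (inside  ∷ p) (outside ∷ q) = ∣p∩q∣+∣∁p∩q∣≡∣q∣ p q
  ∣p∩q∣+∣∁p∩q∣≡∣q∣ (inside  ∷ p) (inside  ∷ q) = ≡.cong suc (∣p∩q∣+∣∁p∩q∣≡∣q∣ p q)

  ∁-∪ : ∀ {n} (p q : Subset n) → ∁ (p ∪ q) ≡ ∁ p ∩ ∁ q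
  ∁-∪ []            []      = ≡.refl
  ∁-∪ (outside ∷ p) (y ∷ q) = ≡.cong (_ ∷_) (∁-∪ p q)
  ∁-∪ (inside  ∷ p) (y ∷ q) = ≡.cong (_ ∷_) (∁-∪ p q)

  ∁-∩ : ∀ {n} (p q : Subset n) → ∁ (p ∩ q) ≡ ∁ p ∪ ∁ q
  ∁-∩ []            []      = ≡.refl
  ∁-∩ (outside ∷ p) (y ∷ q) = ≡.cong (_ ∷_) (∁-∩ p q)
  ∁-∩ (inside  ∷ p) (y ∷ q) = ≡.cong (_ ∷_) (∁-∩ p q)

  elements : ∀ {n} (p : Subset n) → Vec (Fin n) ∣ p ∣
  elements []            = []
  elements (outside ∷ p) = Vec.map suc (elements p)
  elements (inside  ∷ p) = zero ∷ Vec.map suc (elements p)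

  elements⊆p : ∀ {n} (p : Subset n) → VAll (_∈ p) (elements p)
  elements⊆p []            = []
  elements⊆p (outside ∷ p) = VAll.map⁺ (VAll.map there (elements⊆p p))
  elements⊆p (inside  ∷ p) = here ∷ VAll.map⁺ (VAll.map there (elements⊆p p))

  p⊆elements : ∀ {n} (p : Subset n) {i} → i ∈ p → ∃ λ j → Vec.lookup (elements p) j ≡ i
  p⊆elements (outside ∷ p) (there i∈p) = let j , eq = p⊆elements p i∈p in
    j , ≡.trans (Vec.lookup-map j suc (elements p)) (≡.cong suc eq)
  p⊆elements (inside  ∷ p) here        = zero , ≡.refl
  p⊆elements (inside  ∷ p) (there i∈p) = let j , eq = p⊆elements p i∈p in
    suc j , ≡.trans (Vec.lookup-map j suc (elements p)) (≡.cong suc eq)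

module MatroidProperties {N} (M : Matroid N) where

  open Matroid M
  open ℕ.≤-Reasoning

  rank-∪-≤ : ∀ A B → rank (A ∪ B) ℕ.≤ rank A ℕ.+ ∣ B ∣
  rank-∪-≤ A B = begin
    rank (A ∪ B)                     ≤⟨ ℕ.m≤m+n _ _ ⟩
    rank (A ∪ B) ℕ.+ rank (A ∩ B)    ≤⟨ rank-submodular A B ⟩
    rank A ℕ.+ rank B                ≤⟨ ℕ.+-monoʳ-≤ (rank A) (rank≤size B) ⟩
    rank A ℕ.+ ∣ B ∣                 ∎

  rank⊤≤ : ∀ A → rank ⊤ ℕ.≤ rank (∁ A) ℕ.+ ∣ A ∣
  rank⊤≤ A = begin
    rank ⊤             ≡⟨ ≡.cong rank (≡.trans (Subset.∪-comm (∁ A) A) (Subset.p∪∁p≡⊤ A)) ⟨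
    rank (∁ A ∪ A)     ≤⟨ rank-∪-≤ (∁ A) A ⟩
    rank (∁ A) ℕ.+ ∣ A ∣ ∎

-- By MatroidProperties.rank⊤≤ the subtraction never truncates.
dual : ∀ {N} → Matroid N → Matroid N
dual {N} M = record
  { rank            = λ A → ρ A ℕ.∸ rank ⊤
  ; rank≤size       = λ A → ℕ.m≤n+o⇒m∸n≤o (ρ A) (rank ⊤) (ℕ.+-monoˡ-≤ ∣ A ∣ (rank-mono (Subset.⊆-max (∁ A))))
  ; rank-mono       = λ A⊆B → ℕ.∸-monoˡ-≤ (rank ⊤) (ρ-mono A⊆B)
  ; rank-submodular = λ A B → ∸-submodular (rank⊤≤ (A ∪ B)) (rank⊤≤ (A ∩ B)) (rank⊤≤ A) (rank⊤≤ B) (ρ-submodular A B)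
  }
  where
  open Matroid M
  open MatroidProperties M
  open SubsetProperties
  open ℕ.≤-Reasoning
  open CommutativeSemigroupProperties ℕ.+-commutativeSemigroup using (interchange)

  ρ : Subset N → ℕ
  ρ A = rank (∁ A) ℕ.+ ∣ A ∣

  ρ-mono : ∀ {A B} → A ⊆ B → ρ A ℕ.≤ ρ B
  ρ-mono {A} {B} A⊆B = begin
    rank (∁ A) ℕ.+ ∣ A ∣                          ≤⟨ ℕ.+-mono-≤ (rank-mono ∁A⊆) (Subset.p⊆q⇒∣p∣≤∣q∣ A⊆A∩B) ⟩
    rank (∁ B ∪ (∁ A ∩ B)) ℕ.+ ∣ A ∩ B ∣          ≤⟨ ℕ.+-monoˡ-≤ _ (rank-∪-≤ (∁ B) (∁ A ∩ B)) ⟩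
    rank (∁ B) ℕ.+ ∣ ∁ A ∩ B ∣ ℕ.+ ∣ A ∩ B ∣      ≡⟨ ℕ.+-assoc (rank (∁ B)) _ _ ⟩
    rank (∁ B) ℕ.+ (∣ ∁ A ∩ B ∣ ℕ.+ ∣ A ∩ B ∣)    ≡⟨ ≡.cong (rank (∁ B) ℕ.+_) (ℕ.+-comm ∣ ∁ A ∩ B ∣ _) ⟩
    rank (∁ B) ℕ.+ (∣ A ∩ B ∣ ℕ.+ ∣ ∁ A ∩ B ∣)    ≡⟨ ≡.cong (rank (∁ B) ℕ.+_) (∣p∩q∣+∣∁p∩q∣≡∣q∣ A B) ⟩
    rank (∁ B) ℕ.+ ∣ B ∣                          ∎
    where
    A⊆A∩B : A ⊆ A ∩ B
    A⊆A∩B i∈A = Subset.x∈p∩q⁺ (i∈A , A⊆B i∈A)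

    ∁A⊆ : ∁ A ⊆ ∁ B ∪ (∁ A ∩ B)
    ∁A⊆ {i} i∈∁A with i Subset.∈? B
    ... | yes i∈B = Subset.x∈p∪q⁺ (inj₂ (Subset.x∈p∩q⁺ (i∈∁A , i∈B)))
    ... | no  i∉B = Subset.x∈p∪q⁺ (inj₁ (Subset.x∉p⇒x∈∁p i∉B))

  ρ-submodular : ∀ A B → ρ (A ∪ B) ℕ.+ ρ (A ∩ B) ℕ.≤ ρ A ℕ.+ ρ B
  ρ-submodular A B = begin
    (rank (∁ (A ∪ B)) ℕ.+ ∣ A ∪ B ∣) ℕ.+ (rank (∁ (A ∩ B)) ℕ.+ ∣ A ∩ B ∣)
      ≡⟨ interchange (rank (∁ (A ∪ B))) _ _ _ ⟩
    (rank (∁ (A ∪ B)) ℕ.+ rank (∁ (A ∩ B))) ℕ.+ (∣ A ∪ B ∣ ℕ.+ ∣ A ∩ B ∣)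
      ≡⟨ ≡.cong₂ ℕ._+_ (≡.cong₂ (λ X Y → rank X ℕ.+ rank Y) (∁-∪ A B) (∁-∩ A B)) (∣p∪q∣+∣p∩q∣≡∣p∣+∣q∣ A B) ⟩
    (rank (∁ A ∩ ∁ B) ℕ.+ rank (∁ A ∪ ∁ B)) ℕ.+ (∣ A ∣ ℕ.+ ∣ B ∣)
      ≡⟨ ≡.cong (ℕ._+ (∣ A ∣ ℕ.+ ∣ B ∣)) (ℕ.+-comm (rank (∁ A ∩ ∁ B)) _) ⟩
    (rank (∁ A ∪ ∁ B) ℕ.+ rank (∁ A ∩ ∁ B)) ℕ.+ (∣ A ∣ ℕ.+ ∣ B ∣)
      ≤⟨ ℕ.+-monoˡ-≤ _ (rank-submodular (∁ A) (∁ B)) ⟩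
    (rank (∁ A) ℕ.+ rank (∁ B)) ℕ.+ (∣ A ∣ ℕ.+ ∣ B ∣)
      ≡⟨ interchange (rank (∁ A)) _ _ _ ⟩
    ρ A ℕ.+ ρ B ∎

  ∸-submodular : ∀ {a b c d r} → r ℕ.≤ a → r ℕ.≤ b → r ℕ.≤ c → r ℕ.≤ d → a ℕ.+ b ℕ.≤ c ℕ.+ d →
                 (a ℕ.∸ r) ℕ.+ (b ℕ.∸ r) ℕ.≤ (c ℕ.∸ r) ℕ.+ (d ℕ.∸ r)
  ∸-submodular {a} {b} {c} {d} {r} r≤a r≤b r≤c r≤d le = ℕ.+-cancelʳ-≤ (r ℕ.+ r) _ _ (begin
    (a ℕ.∸ r) ℕ.+ (b ℕ.∸ r) ℕ.+ (r ℕ.+ r) ≡⟨ add-back r≤a r≤b ⟩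
    a ℕ.+ b                               ≤⟨ le ⟩
    c ℕ.+ d                               ≡⟨ add-back r≤c r≤d ⟨
    (c ℕ.∸ r) ℕ.+ (d ℕ.∸ r) ℕ.+ (r ℕ.+ r) ∎)
    where
    add-back : ∀ {a b} → r ℕ.≤ a → r ℕ.≤ b → (a ℕ.∸ r) ℕ.+ (b ℕ.∸ r) ℕ.+ (r ℕ.+ r) ≡ a ℕ.+ b
    add-back {a} {b} r≤a r≤b = ≡.trans (interchange (a ℕ.∸ r) _ _ _)
      (≡.cong₂ ℕ._+_ (ℕ.m∸n+n≡m r≤a) (ℕ.m∸n+n≡m r≤b))

module _ {q} (F : FiniteField c ℓ q) (V : LeftModule (FiniteField.ring F) m ℓm)
         (_≟ᴹ_ : Decidable (LeftModule._≈ᴹ_ V)) {N} (g : Vector (LeftModule.Carrierᴹ V) N) where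

  open LeftModule V
  open LinearAlgebra F V
  open SubsetProperties

  Image : Subset N → Pred Carrierᴹ _
  Image A v = ∃ λ i → i ∈ A × v ≡ g i

  Image-mono : ∀ {A B} → A ⊆ B → ∀ {v} → Image A v → Image B v
  Image-mono A⊆B (i , i∈A , eq) = i , A⊆B i∈A , eq

  private
    vectors : (A : Subset N) → Vec Carrierᴹ ∣ A ∣
    vectors A = Vec.map g (elements A)

    vectors⊆Image : ∀ A → VAll (Image A) (vectors A)
    vectors⊆Image A = VAll.map⁺ (VAll.map (λ i∈A → _ , i∈A , ≡.refl) (elements⊆p A))

    ∃-vectors : ∀ A {v} → Image A v → ∃ λ j → Vec.lookup (vectors A) j ≡ v
    ∃-vectors A (i , i∈A , v≡gi) = let j , eq = p⊆elements A i∈A in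
      j , ≡.trans (Vec.lookup-map j g (elements A)) (≡.trans (≡.cong g eq) (≡.sym v≡gi))

    Image⊆LC : ∀ A {d} {b : Vec Carrierᴹ d} → VAll (LC b) (vectors A) → ∀ {v} → Image A v → LC b v
    Image⊆LC A {b = b} vs∈ v∈ = let j , eq = ∃-vectors A v∈ in ≡.subst (LC b) eq (VAll.lookup⁺ vs∈ j)

    extendToBasis : ∀ A {d} {b : Vec Carrierᴹ d} → VAll (Span (Image A)) b → LinearlyIndependent b →
                    ∃₂ λ e (k : Vec Carrierᴹ e) → IsBasis (k ++ b) (Span (Image A))
    extendToBasis A {b = b} b⊆ ind = _ , new , record
      { ⊆S          = VAll.++⁺ new⊆P b⊆
      ; independent = independent
      ; generates   = Span⊆LC (Image⊆LC A generates)
      }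
      where
      open Extension (extend _≟ᴹ_ {b = b} ind (VAll.map (generator {P = Image A}) (vectors⊆Image A)))

  dimension : ∀ A → ∃ (HasDimension (Span (Image A)))
  dimension A = let _ , new , basis = extendToBasis A [] independent-[] in _ , new ++ [] , basis

  vectorMatroid : Matroid N
  vectorMatroid = record
    { rank            = rank
    ; rank≤size       = λ A → let b , basis = proj₂ (dimension A) in
        exchange {b = vectors A} {w = b} (IsBasis.independent basis)
          (VAll.map (Span⊆LC (Image⊆vectors A)) (IsBasis.⊆S basis))
    ; rank-mono       = λ {A} {B} A⊆B →
        dimension-≤ (Span-mono (Image-mono A⊆B)) (proj₂ (dimension A)) (proj₂ (dimension B))
    ; rank-submodular = submodular
    }
    where
    rank : Subset N → ℕ
    rank A = proj₁ (dimension A)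

    Image⊆vectors : ∀ A {v} → Image A v → LC (vectors A) v
    Image⊆vectors A v∈ = let j , eq = ∃-vectors A v∈ in ≡.subst (LC _) eq (LC-lookup (vectors A) j)

    submodular : ∀ A B → rank (A ∪ B) ℕ.+ rank (A ∩ B) ℕ.≤ rank A ℕ.+ rank B
    submodular A B = begin
      rank (A ∪ B) ℕ.+ i                ≤⟨ ℕ.+-monoˡ-≤ i rank-∪≤ ⟩
      (k ℕ.+ (j ℕ.+ i)) ℕ.+ i           ≡⟨ ≡.cong (ℕ._+ i) (ℕ.+-comm k (j ℕ.+ i)) ⟩
      ((j ℕ.+ i) ℕ.+ k) ℕ.+ i           ≡⟨ ℕ.+-assoc (j ℕ.+ i) k i ⟩
      (j ℕ.+ i) ℕ.+ (k ℕ.+ i)           ≡⟨ ≡.cong₂ ℕ._+_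
                                              (dimension-unique (J ++ I , JI-basis) (proj₂ (dimension A)))
                                              (dimension-unique (K ++ I , KI-basis) (proj₂ (dimension B))) ⟩
      rank A ℕ.+ rank B                 ∎
      where
      open ℕ.≤-Reasoning

      i       = proj₁ (dimension (A ∩ B))
      I       = proj₁ (proj₂ (dimension (A ∩ B)))
      I-basis = proj₂ (proj₂ (dimension (A ∩ B)))

      extendTo : ∀ C → A ∩ B ⊆ C → _
      extendTo C ∩⊆C = extendToBasis C
        (VAll.map (Span-mono (Image-mono ∩⊆C)) (IsBasis.⊆S I-basis)) (IsBasis.independent I-basis)

      toA = extendTo A (Subset.p∩q⊆p A B)
      toB = extendTo B (Subset.p∩q⊆q A B)

      j        = proj₁ toA
      J        = proj₁ (proj₂ toA)
      JI-basis = proj₂ (proj₂ toA)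
      k        = proj₁ toB
      K        = proj₁ (proj₂ toB)
      KI-basis = proj₂ (proj₂ toB)

      K++I⊆ : ∀ {e} (K : Vec Carrierᴹ e) → VAll (LC (K ++ (J ++ I))) (K ++ I)
      K++I⊆ []      = VAll.lookup⁻ λ x → LC-++ʳ J (LC-lookup I x)
      K++I⊆ (u ∷ K) = LC-here u (K ++ (J ++ I)) ∷ VAll.map (LC-there u) (K++I⊆ K)

      ∪⊆ : ∀ {v} → Image (A ∪ B) v → LC (K ++ (J ++ I)) v
      ∪⊆ (x , x∈ , eq) with Subset.x∈p∪q⁻ A B x∈
      ... | inj₁ x∈A = LC-++ʳ K (IsBasis.generates JI-basis (generator (x , x∈A , eq)))
      ... | inj₂ x∈B = LC-trans (K++I⊆ K) (IsBasis.generates KI-basis (generator (x , x∈B , eq)))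

      rank-∪≤ : rank (A ∪ B) ℕ.≤ k ℕ.+ (j ℕ.+ i)
      rank-∪≤ = let b , basis = proj₂ (dimension (A ∪ B)) in
        exchange {b = K ++ (J ++ I)} {w = b} (IsBasis.independent basis)
          (VAll.map (Span⊆LC ∪⊆) (IsBasis.⊆S basis))

module ProjectiveSpace {q} (F : FiniteField c ℓ q) (n : ℕ) where

  open FiniteField F
  open FiniteFieldProperties F

  vectorSpace : LeftModule ring c ℓ
  vectorSpace = record
    { Carrierᴹ     = Vector Carrier n
    ; _≈ᴹ_         = λ v w → ∀ i → v i ≈ w i
    ; _+ᴹ_         = λ v w i → v i + w i
    ; _*ₗ_         = λ a v i → a * v i
    ; 0ᴹ           = λ _ → 0#
    ; -ᴹ_          = λ v i → - v i
    ; isLeftModule = record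
      { isLeftSemimodule = record
        { +ᴹ-isCommutativeMonoid = Pointwise.isCommutativeMonoid (Fin n) +-isCommutativeMonoid
        ; isPreleftSemimodule    = record
          { *ₗ-cong      = λ a≈b v≈w i → *-cong a≈b (v≈w i)
          ; *ₗ-zeroˡ     = λ v i → zeroˡ (v i)
          ; *ₗ-distribʳ  = λ v a b i → distribʳ (v i) a b
          ; *ₗ-identityˡ = λ v i → *-identityˡ (v i)
          ; *ₗ-assoc     = λ a b v i → *-assoc a b (v i)
          ; *ₗ-zeroʳ     = λ a i → zeroʳ a
          ; *ₗ-distribˡ  = λ a v w i → distribˡ a (v i) (w i)
          }
        }
      ; -ᴹ‿cong    = λ v≈w i → -‿cong (v≈w i)
      ; -ᴹ‿inverse = (λ v i → -‿inverseˡ (v i)) , (λ v i → -‿inverseʳ (v i))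
      }
    }

  open LeftModule vectorSpace

  _≟ᴹ_ : Decidable _≈ᴹ_
  v ≟ᴹ w = Fin.all? (λ i → v i ≟ w i)

  record Point : Set (c ⊔ ℓ) where
    constructor point
    field
      vector  : Vector Carrier n
      nonzero : ¬ vector ≈ᴹ 0ᴹ

  open Point

  -- Both vectors being nonzero, the scalar is nonzero too.
  record _∼_ (u v : Point) : Set (c ⊔ ℓ) where
    constructor _,_
    field
      scalar       : Carrier
      proportional : vector u ≈ᴹ scalar *ₗ vector v

  ∼-sym : ∀ {u v} → u ∼ v → v ∼ u
  ∼-sym {u} {v} (a , u≈av) = y , ≈ᴹ-sym
    (≈ᴹ-trans (*ₗ-congˡ u≈av) (≈ᴹ-trans (≈ᴹ-sym (*ₗ-assoc y a (vector v)))
    (≈ᴹ-trans (*ₗ-congʳ (trans (*-comm y a) (proj₂ a⁻¹))) (*ₗ-identityˡ (vector v)))))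
    where
    a⁻¹ = inverse a λ a≈0 →
      nonzero u (≈ᴹ-trans u≈av (≈ᴹ-trans (*ₗ-congʳ a≈0) (*ₗ-zeroˡ (vector v))))
    y = proj₁ a⁻¹

  pointDecSetoid : DecSetoid (c ⊔ ℓ) (c ⊔ ℓ)
  pointDecSetoid = record
    { Carrier          = Point
    ; _≈_              = _∼_
    ; isDecEquivalence = record
      { isEquivalence = record
        { refl  = λ {u} → 1# , ≈ᴹ-sym (*ₗ-identityˡ (vector u))
        ; sym   = ∼-sym
        ; trans = λ {_} {_} {w} (a , eq) (b , eq′) → a * b ,
            ≈ᴹ-trans eq (≈ᴹ-trans (*ₗ-congˡ eq′) (≈ᴹ-sym (*ₗ-assoc a b (vector w))))
        }
      ; _≟_ = λ u v → map′
          (λ (k , eq) → toScalar k , eq)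
          (λ (a , eq) → fromScalar a ,
            ≈ᴹ-trans eq (*ₗ-congʳ (sym (Inverse.strictlyInverseˡ enumeration a))))
          (Fin.any? λ k → vector u ≟ᴹ (toScalar k *ₗ vector v))
      }
    }
    where open Inverse enumeration using () renaming (to to toScalar; from to fromScalar)

  -- Index i stands for the one-dimensional subspace spanned by the i-th vector.
  points : ∃ λ N → Inverse (≡.setoid (Fin N)) (DecSetoid.setoid pointDecSetoid)
  points = List.length pts , record
    { to        = List.lookup pts
    ; from      = λ u → Any.index (u∈pts u)
    ; to-cong   = λ { ≡.refl → S.refl }
    ; from-cong = λ {u} {v} u∼v → lookup-injective pts-unique
        (S.trans (S.sym (Any.lookup-index (u∈pts u))) (S.trans u∼v (Any.lookup-index (u∈pts v))))
    ; inverse   = (λ { {u} ≡.refl → S.sym (Any.lookup-index (u∈pts u)) })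
                , (λ {i} {u} u∼i → lookup-injective pts-unique
                    (S.trans (S.sym (Any.lookup-index (u∈pts u))) u∼i))
    }
    where
    module S = DecSetoid pointDecSetoid

    nonzeros : List (Vector Carrier n) → List Point
    nonzeros []       = []
    nonzeros (v ∷ vs) with v ≟ᴹ 0ᴹ
    ... | yes _   = nonzeros vs
    ... | no  v≉0 = point v v≉0 ∷ nonzeros vs

    ∈-nonzeros : ∀ u {vs} → Any (vector u ≈ᴹ_) vs → Any (u ∼_) (nonzeros vs)
    ∈-nonzeros u {v ∷ vs} u∈ with v ≟ᴹ 0ᴹ
    ∈-nonzeros u (here u≈v)  | yes v≈0 = contradiction (≈ᴹ-trans u≈v v≈0) (nonzero u)
    ∈-nonzeros u (there u∈)  | yes v≈0 = ∈-nonzeros u u∈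
    ∈-nonzeros u (here u≈v)  | no  v≉0 = here (1# , ≈ᴹ-trans u≈v (≈ᴹ-sym (*ₗ-identityˡ _)))
    ∈-nonzeros u (there u∈)  | no  v≉0 = there (∈-nonzeros u u∈)

    candidates : List Point
    candidates = nonzeros (List.tabulate (toVector n))

    pts : List Point
    pts = List.deduplicate S._≟_ candidates

    u∈pts : ∀ u → Any (u ∼_) pts
    u∈pts u = deduplicate⁺ pointDecSetoid
      (λ v → ∈-nonzeros v (Any.tabulate⁺ (fromVector (vector v)) (≈ᴹ-sym (toVector-fromVector (vector v))))) u

    pts-unique : Unique S.setoid pts
    pts-unique = deduplicate-! pointDecSetoid candidates

    lookup-injective : ∀ {us} → Unique S.setoid us → ∀ {i j} → List.lookup us i ∼ List.lookup us j → i ≡ j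
    lookup-injective (_  ∷ _)  {zero}  {zero}  _  = ≡.refl
    lookup-injective (u∉ ∷ _)  {zero}  {suc j} eq = contradiction eq (All.lookup u∉ (∈-lookup j))
    lookup-injective (u∉ ∷ _)  {suc i} {zero}  eq = contradiction (S.sym eq) (All.lookup u∉ (∈-lookup i))
    lookup-injective (_  ∷ us) {suc i} {suc j} eq = ≡.cong suc (lookup-injective us eq)

  ∣points∣ : ℕ
  ∣points∣ = proj₁ points

  module Points = Inverse (proj₂ points)

PG[_-1,_] : ∀ n {q} (F : FiniteField c ℓ q) → Matroid (ProjectiveSpace.∣points∣ F n)
PG[ n -1, F ] = vectorMatroid F vectorSpace _≟ᴹ_ (Point.vector ∘ Points.to)
  where open ProjectiveSpace F n

module Polynomial where

  -- a ∷ p represents a + x p, so trailing zeros are irrelevant.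
  Poly : Set
  Poly = List ℤ

  coeff : Poly → ℕ → ℤ
  coeff []      k       = 0ℤ
  coeff (a ∷ p) zero    = a
  coeff (a ∷ p) (suc k) = coeff p k

  infix  4 _≈_
  infixl 6 _+_
  infixl 7 _*_ _·_
  infix  8 -_

  record _≈_ (p r : Poly) : Set where
    constructor coeffwise
    field
      coeff≡ : ∀ k → coeff p k ≡ coeff r k

  open _≈_

  _+_ : Poly → Poly → Poly
  []      + r       = r
  (a ∷ p) + []      = a ∷ p
  (a ∷ p) + (b ∷ r) = (a ℤ.+ b) ∷ (p + r)

  _·_ : ℤ → Poly → Poly
  a · p = List.map (a ℤ.*_) p

  -_ : Poly → Poly
  - p = List.map (λ a → ℤ.- a) p

  _*_ : Poly → Poly → Poly
  []      * r = []
  (a ∷ p) * r = a · r + (0ℤ ∷ p * r)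

  C : ℤ → Poly
  C a = a ∷ []

  X : Poly
  X = 0ℤ ∷ 1ℤ ∷ []

  coeff-+ : ∀ p r k → coeff (p + r) k ≡ coeff p k ℤ.+ coeff r k
  coeff-+ []      r       k       = ≡.sym (ℤ.+-identityˡ _)
  coeff-+ (a ∷ p) []      k       = ≡.sym (ℤ.+-identityʳ _)
  coeff-+ (a ∷ p) (b ∷ r) zero    = ≡.refl
  coeff-+ (a ∷ p) (b ∷ r) (suc k) = coeff-+ p r k

  coeff-· : ∀ a p k → coeff (a · p) k ≡ a ℤ.* coeff p k
  coeff-· a []      k       = ≡.sym (ℤ.*-zeroʳ a)
  coeff-· a (b ∷ p) zero    = ≡.refl
  coeff-· a (b ∷ p) (suc k) = coeff-· a p k

  coeff-neg : ∀ p k → coeff (- p) k ≡ ℤ.- coeff p k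
  coeff-neg []      k       = ≡.refl
  coeff-neg (b ∷ p) zero    = ≡.refl
  coeff-neg (b ∷ p) (suc k) = coeff-neg p k

  isEquivalence : IsEquivalence _≈_
  isEquivalence = record
    { refl  = coeffwise λ k → ≡.refl
    ; sym   = λ eq → coeffwise λ k → ≡.sym (coeff≡ eq k)
    ; trans = λ eq eq′ → coeffwise λ k → ≡.trans (coeff≡ eq k) (coeff≡ eq′ k)
    }

  open IsEquivalence isEquivalence

  ∷-cong : ∀ {a b p r} → a ≡ b → p ≈ r → a ∷ p ≈ b ∷ r
  ∷-cong a≡b p≈r = coeffwise λ { zero → a≡b ; (suc k) → coeff≡ p≈r k }

  +-cong : ∀ {p p′ r r′} → p ≈ p′ → r ≈ r′ → p + r ≈ p′ + r′
  +-cong {p} {p′} {r} {r′} p≈p′ r≈r′ = coeffwise λ k → ≡.trans (coeff-+ p r k)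
    (≡.trans (≡.cong₂ ℤ._+_ (coeff≡ p≈p′ k) (coeff≡ r≈r′ k)) (≡.sym (coeff-+ p′ r′ k)))

  +-congˡ : ∀ {p r r′} → r ≈ r′ → p + r ≈ p + r′
  +-congˡ {p} = +-cong {p} refl

  +-congʳ : ∀ {p p′ r} → p ≈ p′ → p + r ≈ p′ + r
  +-congʳ p≈p′ = +-cong p≈p′ refl

  +-comm : ∀ p r → p + r ≈ r + p
  +-comm p r = coeffwise λ k → ≡.trans (coeff-+ p r k)
    (≡.trans (ℤ.+-comm (coeff p k) (coeff r k)) (≡.sym (coeff-+ r p k)))

  +-assoc : ∀ p r s → (p + r) + s ≈ p + (r + s)
  +-assoc p r s = coeffwise λ k →
    ≡.trans (coeff-+ (p + r) s k) (≡.trans (≡.cong (ℤ._+ coeff s k) (coeff-+ p r k))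
    (≡.trans (ℤ.+-assoc (coeff p k) (coeff r k) (coeff s k))
    (≡.sym (≡.trans (coeff-+ p (r + s) k) (≡.cong (ℤ._+_ (coeff p k)) (coeff-+ r s k))))))

  +-identityʳ : ∀ p → p + [] ≈ p
  +-identityʳ p = +-comm p []

  -‿cong : ∀ {p r} → p ≈ r → - p ≈ - r
  -‿cong {p} {r} p≈r = coeffwise λ k → ≡.trans (coeff-neg p k)
    (≡.trans (≡.cong (λ a → ℤ.- a) (coeff≡ p≈r k)) (≡.sym (coeff-neg r k)))

  -‿inverseˡ : ∀ p → - p + p ≈ []
  -‿inverseˡ p = coeffwise λ k → ≡.trans (coeff-+ (- p) p k)
    (≡.trans (≡.cong (ℤ._+ coeff p k) (coeff-neg p k)) (ℤ.+-inverseˡ (coeff p k)))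

  -‿inverseʳ : ∀ p → p + - p ≈ []
  -‿inverseʳ p = trans (+-comm p (- p)) (-‿inverseˡ p)

  +-isAbelianGroup : IsAbelianGroup _≈_ _+_ [] -_
  +-isAbelianGroup = record
    { isGroup = record
      { isMonoid = record
        { isSemigroup = record
          { isMagma = record { isEquivalence = isEquivalence ; ∙-cong = +-cong }
          ; assoc   = +-assoc
          }
        ; identity = (λ p → refl) , +-identityʳ
        }
      ; inverse = -‿inverseˡ , -‿inverseʳ
      ; ⁻¹-cong = -‿cong
      }
    ; comm = +-comm
    }

  +-abelianGroup : AbelianGroup _ _
  +-abelianGroup = record { isAbelianGroup = +-isAbelianGroup }

  open CommutativeSemigroupProperties (AbelianGroup.commutativeSemigroup +-abelianGroup)
    using () renaming (interchange to +-interchange; x∙yz≈y∙xz to x+[y+z]≈y+[x+z])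

  ·-cong : ∀ a {p r} → p ≈ r → a · p ≈ a · r
  ·-cong a {p} {r} p≈r = coeffwise λ k → ≡.trans (coeff-· a p k)
    (≡.trans (≡.cong (a ℤ.*_) (coeff≡ p≈r k)) (≡.sym (coeff-· a r k)))

  ·-distribˡ : ∀ a p r → a · (p + r) ≈ a · p + a · r
  ·-distribˡ a p r = coeffwise λ k →
    ≡.trans (coeff-· a (p + r) k) (≡.trans (≡.cong (a ℤ.*_) (coeff-+ p r k))
    (≡.trans (ℤ.*-distribˡ-+ a (coeff p k) (coeff r k))
    (≡.sym (≡.trans (coeff-+ (a · p) (a · r) k) (≡.cong₂ ℤ._+_ (coeff-· a p k) (coeff-· a r k))))))

  ·-assoc : ∀ a b p → (a ℤ.* b) · p ≈ a · (b · p)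
  ·-assoc a b p = coeffwise λ k →
    ≡.trans (coeff-· (a ℤ.* b) p k) (≡.trans (ℤ.*-assoc a b (coeff p k))
    (≡.sym (≡.trans (coeff-· a (b · p) k) (≡.cong (a ℤ.*_) (coeff-· b p k)))))

  0· : ∀ p → 0ℤ · p ≈ []
  0· p = coeffwise λ k → ≡.trans (coeff-· 0ℤ p k) (ℤ.*-zeroˡ (coeff p k))

  1· : ∀ p → 1ℤ · p ≈ p
  1· p = coeffwise λ k → ≡.trans (coeff-· 1ℤ p k) (ℤ.*-identityˡ (coeff p k))

  0∷[]≈[] : 0ℤ ∷ [] ≈ []
  0∷[]≈[] = coeffwise λ { zero → ≡.refl ; (suc k) → ≡.refl }

  *-congˡ : ∀ p {r r′} → r ≈ r′ → p * r ≈ p * r′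
  *-congˡ []      r≈r′ = refl
  *-congˡ (a ∷ p) r≈r′ = +-cong (·-cong a r≈r′) (∷-cong ≡.refl (*-congˡ p r≈r′))

  *-zeroʳ : ∀ p → p * [] ≈ []
  *-zeroʳ []      = refl
  *-zeroʳ (a ∷ p) = trans (∷-cong ≡.refl (*-zeroʳ p)) 0∷[]≈[]

  *-∷ : ∀ p b r → p * (b ∷ r) ≈ b · p + (0ℤ ∷ p * r)
  *-∷ []      b r = sym 0∷[]≈[]
  *-∷ (a ∷ p) b r = ∷-cong
    (≡.cong (ℤ._+ 0ℤ) (ℤ.*-comm a b))
    (trans (+-congˡ {a · r} (*-∷ p b r)) (x+[y+z]≈y+[x+z] (a · r) (b · p) (0ℤ ∷ p * r)))

  *-comm : ∀ p r → p * r ≈ r * p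
  *-comm []      r = sym (*-zeroʳ r)
  *-comm (a ∷ p) r = trans (+-congˡ {a · r} (∷-cong ≡.refl (*-comm p r))) (sym (*-∷ r a p))

  *-cong : ∀ {p p′ r r′} → p ≈ p′ → r ≈ r′ → p * r ≈ p′ * r′
  *-cong {p} {p′} {r} {r′} p≈p′ r≈r′ =
    trans (*-congˡ p r≈r′) (trans (*-comm p r′) (trans (*-congˡ r′ p≈p′) (*-comm r′ p′)))

  *-distribˡ : ∀ p r s → p * (r + s) ≈ p * r + p * s
  *-distribˡ []      r s = refl
  *-distribˡ (a ∷ p) r s = trans
    (+-cong (·-distribˡ a r s) (∷-cong ≡.refl (*-distribˡ p r s)))
    (+-interchange (a · r) (a · s) (0ℤ ∷ p * r) (0ℤ ∷ p * s))

  *-distribʳ : ∀ p r s → (r + s) * p ≈ r * p + s * p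
  *-distribʳ p r s = trans (*-comm (r + s) p)
    (trans (*-distribˡ p r s) (+-cong (*-comm p r) (*-comm p s)))

  ·-* : ∀ a p r → (a · p) * r ≈ a · (p * r)
  ·-* a []      r = refl
  ·-* a (b ∷ p) r = trans
    (+-cong (·-assoc a b r) (∷-cong (≡.sym (ℤ.*-zeroʳ a)) (·-* a p r)))
    (sym (·-distribˡ a (b · r) (0ℤ ∷ p * r)))

  0∷-* : ∀ p r → (0ℤ ∷ p) * r ≈ 0ℤ ∷ p * r
  0∷-* p r = +-congʳ (0· r)

  *-assoc : ∀ p r s → (p * r) * s ≈ p * (r * s)
  *-assoc []      r s = refl
  *-assoc (a ∷ p) r s = trans (*-distribʳ s (a · r) (0ℤ ∷ p * r))
    (+-cong (·-* a r s) (trans (0∷-* (p * r) s) (∷-cong ≡.refl (*-assoc p r s))))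

  *-identityˡ : ∀ p → C 1ℤ * p ≈ p
  *-identityˡ p = trans (+-cong (1· p) 0∷[]≈[]) (+-identityʳ p)

  *-identityʳ : ∀ p → p * C 1ℤ ≈ p
  *-identityʳ p = trans (*-comm p (C 1ℤ)) (*-identityˡ p)

  commutativeRing : CommutativeRing _ _
  commutativeRing = record
    { Carrier           = Poly
    ; _≈_               = _≈_
    ; _+_               = _+_
    ; _*_               = _*_
    ; -_                = -_
    ; 0#                = []
    ; 1#                = C 1ℤ
    ; isCommutativeRing = record
      { isRing = record
        { +-isAbelianGroup = +-isAbelianGroup
        ; *-cong           = *-cong
        ; *-assoc          = *-assoc
        ; *-identity       = *-identityˡ , *-identityʳ
        ; distrib          = *-distribˡ , *-distribʳ
        }
      ; *-comm = *-comm
      }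
    }

ℤ[x] : CommutativeRing _ _
ℤ[x] = Polynomial.commutativeRing

open Polynomial public using (Poly; C; X)
open CommutativeRing ℤ[x] public
  using (_+_; _*_; -_; _-_; 0#; 1#)
open Exp (CommutativeRing.semiring ℤ[x]) public using (_^_)
open Sum (CommutativeRing.+-commutativeMonoid ℤ[x]) public using (sum⁺-syntax)
open Sum (CommutativeRing.*-commutativeMonoid ℤ[x]) public using ()
  renaming (sum to product)

∏-syntax : ∀ n → Vector Poly n → Poly
∏-syntax _ = product

infixl 10 ∏-syntax
syntax ∏-syntax n (λ i → p) = ∏[ i < n ] p

-- The Laurent polynomials ℤ[x, x⁻¹], as fractions p / xᵏ.  Since x is not a
-- zero divisor in ℤ[x], equality is plain cross-multiplication.

record Laurent : Set where
  constructor _/X^_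
  field
    numerator : Poly
    exponent  : ℕ

infix  4 _≈ᴸ_
infix  5 _/X^_
infixl 7 _*ᴸ_

record _≈ᴸ_ (f g : Laurent) : Set where
  constructor cross
  open Laurent
  field
    cross-≈ : CommutativeRing._≈_ ℤ[x]
      (numerator f * X ^ exponent g) (numerator g * X ^ exponent f)

_*ᴸ_ : Laurent → Laurent → Laurent
(p /X^ k) *ᴸ (r /X^ l) = p * r /X^ (k ℕ.+ l)

⟦_⟧ : Poly → Laurent
⟦ p ⟧ = p /X^ 0

subsets : ∀ n → List (Subset n)
subsets zero    = [] ∷ []
subsets (suc n) = List.map (outside ∷_) (subsets n) List.++ List.map (inside ∷_) (subsets n)

∑⊆ : ∀ {n} → (Subset n → Poly) → Poly
∑⊆ {n} f = List.foldr _+_ 0# (List.map f (subsets n))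

-- By rank-mono the subtraction never truncates.
χ : ∀ {N} → Matroid N → Poly
χ M = ∑⊆ λ A → (- 1#) ^ ∣ A ∣ * X ^ (rank ⊤ ℕ.∸ rank A)
  where open Matroid M

instance
  primePower⇒nonTrivial : ∀ {q} → {{PrimePower q}} → NonTrivial q
  primePower⇒nonTrivial {q} {{pp}} = ℕ.n>1⇒nonTrivial (≡.subst (1 ℕ.<_) (≡.sym q≡p^k)
    (ℕ.<-≤-trans (ℕ.nonTrivial⇒n>1 base {{prime⇒nonTrivial prime}})
      (≡.subst (ℕ._≤ base ℕ.^ exponent) (ℕ.*-identityʳ base)
        (ℕ.^-monoʳ-≤ base {{ℕ.nonTrivial⇒nonZero base {{prime⇒nonTrivial prime}}}} exponent>0))))
    where open PrimePower pp

module _ (q : ℕ) .{{_ : NonTrivial q}} where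

  -- (qⁿ − 1)(qⁿ⁻¹ − 1) ⋯, with k factors
  falling : ℕ → ℕ → ℕ
  falling n zero    = 1
  falling n (suc k) = (q ℕ.^ n ℕ.∸ 1) ℕ.* falling (n ℕ.∸ 1) k

  q^[1+n]∸1-nonZero : ∀ n → NonZero (q ℕ.^ suc n ℕ.∸ 1)
  q^[1+n]∸1-nonZero n = ℕ.>-nonZero (ℕ.m<n⇒0<n∸m (ℕ.<-≤-trans (ℕ.nonTrivial⇒n>1 q)
    (ℕ.m≤m*n q (q ℕ.^ n) {{ℕ.m^n≢0 q n {{ℕ.nonTrivial⇒nonZero q}}}})))

  q∸1-nonZero : NonZero (q ℕ.∸ 1)
  q∸1-nonZero = ℕ.>-nonZero (ℕ.m<n⇒0<n∸m (ℕ.nonTrivial⇒n>1 q))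

  falling-nonZero : ∀ k → NonZero (falling k k)
  falling-nonZero zero    = _
  falling-nonZero (suc k) = ℕ.m*n≢0 _ _ {{q^[1+n]∸1-nonZero k}} {{falling-nonZero k}}


  -- Both quotients are exact: see q∸1∣q^k∸1 and falling[k,k]∣falling[n,k].

  qNumber : ℕ → ℕ
  qNumber k = (q ℕ.^ k ℕ.∸ 1) / (q ℕ.∸ 1)
    where instance _ = q∸1-nonZero

  gaussian : ℕ → ℕ → ℕ
  gaussian n k = falling n k / falling k k
    where instance _ = falling-nonZero k

  q^m+n∸1 : ∀ m n → q ℕ.^ (m ℕ.+ n) ℕ.∸ 1 ≡ (q ℕ.^ m ℕ.∸ 1) ℕ.+ q ℕ.^ m ℕ.* (q ℕ.^ n ℕ.∸ 1)
  q^m+n∸1 m n = begin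
    q ℕ.^ (m ℕ.+ n) ℕ.∸ 1
      ≡⟨ ≡.cong (ℕ._∸ 1) (ℕ.^-distribˡ-+-* q m n) ⟩
    a ℕ.* b ℕ.∸ 1
      ≡⟨ ≡.cong (ℕ._∸ 1) (ℕ.m+[n∸m]≡n (ℕ.m≤m*n a b)) ⟨
    a ℕ.+ (a ℕ.* b ℕ.∸ a) ℕ.∸ 1
      ≡⟨ ℕ.+-∸-comm (a ℕ.* b ℕ.∸ a) (ℕ.m^n>0 q m) ⟩
    (a ℕ.∸ 1) ℕ.+ (a ℕ.* b ℕ.∸ a)
      ≡⟨ ≡.cong (λ z → (a ℕ.∸ 1) ℕ.+ (a ℕ.* b ℕ.∸ z)) (ℕ.*-identityʳ a) ⟨
    (a ℕ.∸ 1) ℕ.+ (a ℕ.* b ℕ.∸ a ℕ.* 1)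
      ≡⟨ ≡.cong ((a ℕ.∸ 1) ℕ.+_) (ℕ.*-distribˡ-∸ a b 1) ⟨
    (a ℕ.∸ 1) ℕ.+ a ℕ.* (b ℕ.∸ 1) ∎
    where
    open ≡.≡-Reasoning
    a = q ℕ.^ m
    b = q ℕ.^ n
    instance
      _ = ℕ.nonTrivial⇒nonZero q
      _ = ℕ.m^n≢0 q n

  q∸1∣q^k∸1 : ∀ k → q ℕ.∸ 1 ∣ q ℕ.^ k ℕ.∸ 1
  q∸1∣q^k∸1 zero    = (q ℕ.∸ 1) ∣0
  q∸1∣q^k∸1 (suc k) = ≡.subst (q ℕ.∸ 1 ∣_) (≡.sym (q^m+n∸1 1 k))
    (∣m∣n⇒∣m+n (∣-reflexive (≡.cong (ℕ._∸ 1) (≡.sym (ℕ.*-identityʳ q))))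
               (∣n⇒∣m*n (q ℕ.^ 1) (q∸1∣q^k∸1 k)))

  falling-suc : ∀ n k → falling n (suc k) ≡ falling n k ℕ.* (q ℕ.^ (n ℕ.∸ k) ℕ.∸ 1)
  falling-suc n zero    = ℕ.*-comm (q ℕ.^ n ℕ.∸ 1) 1
  falling-suc n (suc k) = begin
    a ℕ.* falling (n ℕ.∸ 1) (suc k)
      ≡⟨ ≡.cong (a ℕ.*_) (falling-suc (n ℕ.∸ 1) k) ⟩
    a ℕ.* (falling (n ℕ.∸ 1) k ℕ.* (q ℕ.^ (n ℕ.∸ 1 ℕ.∸ k) ℕ.∸ 1))
      ≡⟨ ℕ.*-assoc a _ _ ⟨
    a ℕ.* falling (n ℕ.∸ 1) k ℕ.* (q ℕ.^ (n ℕ.∸ 1 ℕ.∸ k) ℕ.∸ 1)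
      ≡⟨ ≡.cong (λ e → a ℕ.* falling (n ℕ.∸ 1) k ℕ.* (q ℕ.^ e ℕ.∸ 1)) (ℕ.∸-+-assoc n 1 k) ⟩
    a ℕ.* falling (n ℕ.∸ 1) k ℕ.* (q ℕ.^ (n ℕ.∸ suc k) ℕ.∸ 1) ∎
    where
    open ≡.≡-Reasoning
    a = q ℕ.^ n ℕ.∸ 1

  n<k⇒falling≡0 : ∀ {n k} → n ℕ.< k → falling n k ≡ 0
  n<k⇒falling≡0 {zero}  {suc k} _         = ≡.refl
  n<k⇒falling≡0 {suc n} {suc k} (s≤s n<k) =
    ≡.trans (≡.cong ((q ℕ.^ suc n ℕ.∸ 1) ℕ.*_) (n<k⇒falling≡0 n<k)) (ℕ.*-zeroʳ (q ℕ.^ suc n ℕ.∸ 1))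

  falling[k,k]∣falling[n,k] : ∀ n k → falling k k ∣ falling n k
  falling[k,k]∣falling[n,k] n       zero    = ∣-refl
  falling[k,k]∣falling[n,k] zero    (suc k) = _ ∣0
  falling[k,k]∣falling[n,k] (suc n) (suc k) with k ℕ.≤? n
  ... | no  k≰n = ≡.subst (falling (suc k) (suc k) ∣_) (≡.sym (n<k⇒falling≡0 (s≤s (ℕ.≰⇒> k≰n)))) (_ ∣0)
  ... | yes k≤n = ≡.subst (falling (suc k) (suc k) ∣_) (≡.sym split)
    (∣m∣n⇒∣m+n (*-monoʳ-∣ b (falling[k,k]∣falling[n,k] n k))
               (∣n⇒∣m*n (q ℕ.^ suc k) (falling[k,k]∣falling[n,k] n (suc k))))
    where
    open ≡.≡-Reasoning
    f = falling n k
    b = q ℕ.^ suc k ℕ.∸ 1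
    d = q ℕ.^ (n ℕ.∸ k) ℕ.∸ 1

    split : falling (suc n) (suc k) ≡ b ℕ.* f ℕ.+ q ℕ.^ suc k ℕ.* falling n (suc k)
    split = begin
      (q ℕ.^ suc n ℕ.∸ 1) ℕ.* f
        ≡⟨ ≡.cong (λ e → (q ℕ.^ suc e ℕ.∸ 1) ℕ.* f) (ℕ.m+[n∸m]≡n k≤n) ⟨
      (q ℕ.^ (suc k ℕ.+ (n ℕ.∸ k)) ℕ.∸ 1) ℕ.* f
        ≡⟨ ≡.cong (ℕ._* f) (q^m+n∸1 (suc k) (n ℕ.∸ k)) ⟩
      (b ℕ.+ q ℕ.^ suc k ℕ.* d) ℕ.* f
        ≡⟨ ℕ.*-distribʳ-+ f b (q ℕ.^ suc k ℕ.* d) ⟩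
      b ℕ.* f ℕ.+ q ℕ.^ suc k ℕ.* d ℕ.* f
        ≡⟨ ≡.cong (b ℕ.* f ℕ.+_) (ℕ.*-assoc (q ℕ.^ suc k) d f) ⟩
      b ℕ.* f ℕ.+ q ℕ.^ suc k ℕ.* (d ℕ.* f)
        ≡⟨ ≡.cong (λ z → b ℕ.* f ℕ.+ q ℕ.^ suc k ℕ.* z) (≡.trans (ℕ.*-comm d f) (≡.sym (falling-suc n k))) ⟩
      b ℕ.* f ℕ.+ q ℕ.^ suc k ℕ.* falling n (suc k) ∎

{-# OPTIONS --safe #-}
module Submission where

-- Both sides are polynomials, so after clearing xⁿ it suffices to compare them at
-- x = qᵐ for all m.  Complementing the subsets, the left side is, up to the sign,
-- the sum over sets B of points of (−x)^|B| x^(n − r(B)).  Functionals vanishing on B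
-- are orthogonal to a space of dimension r(B), so x^(n − r(B)) counts the m-tuples of
-- functionals vanishing on B.  Interchanging the sums, a tuple whose common kernel has
-- dimension k, hence [k] points, contributes (1 − x)^[k].  The number of tuples with a
-- kernel of dimension k is found by adding one functional at a time.

import Algebra.Properties.AbelianGroup as AbelianGroupProperties
import Algebra.Properties.CommutativeMonoid.Sum as MonoidSum
import Algebra.Properties.Ring as RingProperties
import Algebra.Properties.Semiring.Sum as SemiringSum
open import Algebra.Bundles using (CommutativeRing)
open import Algebra.Module.Bundles using (LeftModule)
open import Data.Bool.Base using (if_then_else_; true; false; _∧_)
import Data.Bool.Properties as Bool
open import Data.Fin.Base as Fin using (Fin; zero; suc; toℕ)
import Data.Fin.Properties as Fin
open import Data.Fin.Subset using (Subset; inside; outside; _∈_; ⊤; ∁; ∣_∣)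
import Data.Fin.Subset.Properties as Subset
open import Data.Integer.Base as ℤ using (ℤ; +_; 0ℤ; 1ℤ; -1ℤ)
import Data.Integer.Properties as ℤ
import Data.Integer.Tactic.RingSolver as ℤ-Solver
open import Data.List.Base as List using (List; []; _∷_)
import Data.List.Properties as List
open import Data.Nat.Base as ℕ using (ℕ; zero; suc; NonZero; NonTrivial; _∸_)
import Data.Nat.Divisibility as ℕ
import Data.Nat.DivMod as ℕ
import Data.Nat.Properties as ℕ
import Data.Nat.Tactic.RingSolver as ℕ-Solver
open import Data.Product.Base using (∃; _×_; _,_; proj₁; proj₂)
open import Data.Sum.Base using (inj₁; inj₂)
open import Data.Unit.Base as Unit using (tt)
open import Data.Vec.Base using (Vec; []; _∷_; here; there)
open import Data.Vec.Functional as Vector using (Vector)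
open import Data.Vec.Relation.Unary.All as VAll using ([]; _∷_) renaming (All to VAll)
open import Function.Base using (_∘_; id)
open import Function.Bundles using (Inverse)
open import Level using (Level; _⊔_)
open import Relation.Binary.PropositionalEquality as ≡ using (_≡_; module ≡-Reasoning)
open import Relation.Nullary.Decidable
  using (Dec; yes; no; does; map′; ¬?; _×-dec_; _→-dec_; decidable-stable)
open import Relation.Nullary.Negation using (¬_; contradiction)
open import Relation.Unary using (Pred; Decidable)
-- The polynomial operations, which share their names with those of the field, are opened further down.
open import Defs using
  ( FiniteField; module FiniteFieldProperties; module LinearAlgebra; module ProjectiveSpace
  ; Matroid; PG[_-1,_]; Image; dimension)

-- Read as a linear map from F^n to F^m, a tuple of functionals has the common kernel as its kernel.
-- The maps with a prescribed kernel of dimension k are the injections of an (n - k)-dimensional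
-- quotient into F^m, and there are ∏ (q^m - q^i) of them, i < n - k; the possible kernels number
-- `gaussian q n k`. This is where both factors of the summand come from. A direct proof would have
-- to enumerate subspaces and handle quotients. The recursion on m needs only the number of
-- functionals vanishing on a given kernel, and leaves an identity between Gaussian coefficients.
--
-- Dimensions are likewise replaced by cardinalities: a subspace is a decidable predicate on a
-- finite set, its size q^k determines k, and orthogonality becomes the numerical identity |S| ·
-- |S⊥| = q^n, obtained by double counting.

private
  variable
    a b p r s : Level
    A : Set a
    B : Set b
    M N m : ℕ

  module ℕ∑ = SemiringSum ℕ.+-*-semiring
  module ℤ∑ = SemiringSum (CommutativeRing.semiring ℤ.+-*-commutativeRing)
  module ℤ∏ = MonoidSum ℤ.*-1-commutativeMonoid

-- Counting

-- Depends on the decision only through `does`, so that proofs can abstract over the Boolean, as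
-- `head-factor` and `∑-if` do.
ind : Dec A → ℕ
ind d = if does d then 1 else 0

ind-yes : (d : Dec A) → A → ind d ≡ 1
ind-yes (yes _) _ = ≡.refl
ind-yes (no ¬x) x = contradiction x ¬x

ind-no : (d : Dec A) → ¬ A → ind d ≡ 0
ind-no (yes x) ¬x = contradiction x ¬x
ind-no (no _)  _  = ≡.refl

ind-cong : (A → B) → (B → A) → (d : Dec A) (e : Dec B) → ind d ≡ ind e
ind-cong f g (yes x) e = ≡.sym (ind-yes e (f x))
ind-cong f g (no ¬x) e = ≡.sym (ind-no e (¬x ∘ g))

ind-× : (d : Dec A) (e : Dec B) → ind (d ×-dec e) ≡ ind d ℕ.* ind e
ind-× (yes _) (yes _) = ≡.refl
ind-× (yes _) (no _)  = ≡.refl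
ind-× (no _)  _       = ≡.refl

ind-¬ : (d : Dec A) → ind d ℕ.+ ind (¬? d) ≡ 1
ind-¬ (yes _) = ≡.refl
ind-¬ (no _)  = ≡.refl

∑-const : ∀ N x → ℕ∑.sum {N} (λ _ → x) ≡ N ℕ.* x
∑-const zero    x = ≡.refl
∑-const (suc N) x = ≡.cong (x ℕ.+_) (∑-const N x)

count : {P : Pred (Fin N) p} → Decidable P → ℕ
count P? = ℕ∑.sum (λ i → ind (P? i))

count-cong : {P : Pred (Fin N) p} {R : Pred (Fin N) r} (P? : Decidable P) (R? : Decidable R) →
             (∀ {i} → P i → R i) → (∀ {i} → R i → P i) → count P? ≡ count R?
count-cong P? R? P⇒R R⇒P = ℕ∑.sum-cong-≗ λ i → ind-cong P⇒R R⇒P (P? i) (R? i)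

count-none : {P : Pred (Fin N) p} (P? : Decidable P) → (∀ i → ¬ P i) → count P? ≡ 0
count-none {N = N} P? none = ≡.trans (ℕ∑.sum-cong-≗ λ i → ind-no (P? i) (none i))
  (≡.trans (∑-const N 0) (ℕ.*-zeroʳ N))

count-all : {P : Pred (Fin N) p} (P? : Decidable P) → (∀ i → P i) → count P? ≡ N
count-all {N = N} P? all = ≡.trans (ℕ∑.sum-cong-≗ λ i → ind-yes (P? i) (all i))
  (≡.trans (∑-const N 1) (ℕ.*-identityʳ N))

count-¬ : {P : Pred (Fin N) p} (P? : Decidable P) → count P? ℕ.+ count (¬? ∘ P?) ≡ N
count-¬ {N = N} P? = ≡.trans (≡.sym (ℕ∑.∑-distrib-+ (λ i → ind (P? i)) (λ i → ind (¬? (P? i)))))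
  (≡.trans (ℕ∑.sum-cong-≗ λ i → ind-¬ (P? i)) (≡.trans (∑-const N 1) (ℕ.*-identityʳ N)))

count-×ˡ : {P : Pred (Fin N) p} (d : Dec A) (P? : Decidable P) →
           count (λ i → d ×-dec P? i) ≡ ind d ℕ.* count P?
count-×ˡ d P? = ≡.trans (ℕ∑.sum-cong-≗ λ i → ind-× d (P? i))
  (≡.sym (ℕ∑.*-distribˡ-sum (ind d) (λ i → ind (P? i))))

-- Eliminates a summation variable that the remaining data determine: the inner sum collapses to the
-- indicator that a value exists. The bijective counts below reduce to it.
count-unique : {P : Pred (Fin N) p} (P? : Decidable P) (d : Dec A) →
               (∀ {i j} → P i → P j → i ≡ j) → (A → ∃ P) → (∀ {i} → P i → A) →
               count P? ≡ ind d
count-unique {N = zero}  P? d unique exists sound = ≡.sym (ind-no d λ x → Fin.¬Fin0 (proj₁ (exists x)))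
count-unique {N = suc N} P? d unique exists sound with P? zero
... | yes P0 = ≡.trans (≡.cong suc (count-none (P? ∘ suc) λ i Pi → Fin.0≢1+n (unique P0 Pi)))
                       (≡.sym (ind-yes d (sound P0)))
... | no ¬P0 = count-unique (P? ∘ suc) d (λ Pi Pj → Fin.suc-injective (unique Pi Pj)) exists′ sound
  where
  exists′ : _ → ∃ _
  exists′ x with exists x
  ... | zero  , P0 = contradiction P0 ¬P0
  ... | suc i , Pi = i , Pi

-- Both sides count the pairs of `S`, by rows and by columns. The five conditions make `S` the graph
-- of a bijection between `P` and `R`.
count-↔ : {P : Pred (Fin M) p} {R : Pred (Fin N) r} {S : Fin M → Fin N → Set s}
          (P? : Decidable P) (R? : Decidable R) (S? : ∀ i j → Dec (S i j)) →
          (∀ {i} → P i → ∃ λ j → S i j) → (∀ {j} → R j → ∃ λ i → S i j) →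
          (∀ {i j} → S i j → P i × R j) →
          (∀ {i j k} → S i j → S i k → j ≡ k) → (∀ {i j k} → S i k → S j k → i ≡ j) →
          count P? ≡ count R?
count-↔ P? R? S? total surj sound functional injective = begin
  count P?                                   ≡⟨ ℕ∑.sum-cong-≗ (λ i → ≡.sym
                                                  (count-unique (S? i) (P? i) functional total (proj₁ ∘ sound))) ⟩
  ℕ∑.sum (λ i → count (λ j → S? i j))        ≡⟨ ℕ∑.∑-comm (λ i j → ind (S? i j)) ⟩
  ℕ∑.sum (λ j → count (λ i → S? i j))        ≡⟨ ℕ∑.sum-cong-≗ (λ j →
                                                  count-unique (λ i → S? i j) (R? j) injective surj (proj₂ ∘ sound)) ⟩
  count R?                                   ∎
  where open ≡-Reasoning

-- Linear algebra over a finite field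

module Orthogonality {c ℓ q} (F : FiniteField c ℓ q) (n : ℕ) where

  open FiniteField F
  open FiniteFieldProperties F
  open Inverse enumeration using () renaming (to to scalar; from to index)
  open ProjectiveSpace F n
  open LeftModule vectorSpace using
    ( _≈ᴹ_; ≈ᴹ-sym; ≈ᴹ-trans; _+ᴹ_; +ᴹ-cong; +ᴹ-congˡ; +ᴹ-congʳ; +ᴹ-assoc; +ᴹ-identityʳ; +ᴹ-abelianGroup; -ᴹ‿inverseʳ
    ; 0ᴹ; _*ₗ_; *ₗ-congˡ; *ₗ-congʳ; *ₗ-distribʳ; *ₗ-zeroˡ; *ₗ-zeroʳ; *ₗ-identityˡ; *ₗ-assoc)
  open LinearAlgebra F vectorSpace
  private
    module FG = AbelianGroupProperties +-abelianGroup
    module VG = AbelianGroupProperties +ᴹ-abelianGroup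
    module FR = RingProperties ring
    module F∑ = SemiringSum (CommutativeRing.semiring commutativeRing)

  scalar-injective : ∀ {i j} → scalar i ≈ scalar j → i ≡ j
  scalar-injective {i} {j} eq = ≡.trans (≡.sym (Inverse.strictlyInverseʳ enumeration i))
    (≡.trans (Inverse.from-cong enumeration eq) (Inverse.strictlyInverseʳ enumeration j))

  scalar-index : ∀ x → scalar (index x) ≈ x
  scalar-index = Inverse.strictlyInverseˡ enumeration

  -- This is q - 1, kept as a count so that no truncated subtraction enters the double counts.
  units : ℕ
  units = count (λ c → ¬? (scalar c ≟ 0#))

  1+units≡q : suc units ≡ q
  1+units≡q = ≡.trans (≡.cong (ℕ._+ units) (≡.sym one-zero)) (count-¬ (λ c → scalar c ≟ 0#))
    where
    one-zero : count (λ c → scalar c ≟ 0#) ≡ 1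
    one-zero = count-unique (λ c → scalar c ≟ 0#) (yes tt)
      (λ c≈0 d≈0 → scalar-injective (trans c≈0 (sym d≈0)))
      (λ _ → index 0# , scalar-index 0#) (λ _ → tt)

  instance
    units-nonZero : ℕ.NonZero units
    units-nonZero = ℕ.>-nonZero (ℕ.≤-pred (≡.subst (1 ℕ.<_) (≡.sym 1+units≡q) 1<q))

    q-nonZero : ℕ.NonZero q
    q-nonZero = ℕ.>-nonZero (ℕ.<-trans (ℕ.s≤s ℕ.z≤n) 1<q)

  V : Set c
  V = Vector Carrier n

  vec : Fin (q ℕ.^ n) → V
  vec = toVector n

  vec-injective : ∀ {i j} → vec i ≈ᴹ vec j → i ≡ j
  vec-injective = toVector-injective n

  vec⁻¹ : V → Fin (q ℕ.^ n)
  vec⁻¹ = fromVector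

  vec-vec⁻¹ : ∀ v → vec (vec⁻¹ v) ≈ᴹ v
  vec-vec⁻¹ = toVector-fromVector

  count-zero : count (λ v → vec v ≟ᴹ 0ᴹ) ≡ 1
  count-zero = count-unique (λ v → vec v ≟ᴹ 0ᴹ) (yes tt)
    (λ v≈0 w≈0 → vec-injective (≈ᴹ-trans v≈0 (≈ᴹ-sym w≈0)))
    (λ _ → vec⁻¹ 0ᴹ , vec-vec⁻¹ 0ᴹ) (λ _ → tt)

  -- Vectors double as functionals through this form: `vec` then enumerates the functionals too, and
  -- symmetry lets the two roles be exchanged.
  dot : V → V → Carrier
  dot y v = F∑.sum (λ i → y i * v i)

  dot-cong : ∀ y {v w} → v ≈ᴹ w → dot y v ≈ dot y w
  dot-cong y v≈w = F∑.sum-cong-≋ (λ i → *-congˡ (v≈w i))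

  dot-comm : ∀ y v → dot y v ≈ dot v y
  dot-comm y v = F∑.sum-cong-≋ (λ i → *-comm (y i) (v i))

  dot-+ : ∀ y v w → dot y (v +ᴹ w) ≈ dot y v + dot y w
  dot-+ y v w = trans (F∑.sum-cong-≋ (λ i → distribˡ (y i) (v i) (w i)))
                      (F∑.∑-distrib-+ (λ i → y i * v i) (λ i → y i * w i))

  dot-* : ∀ y a v → dot y (a *ₗ v) ≈ a * dot y v
  dot-* y a v = trans
    (F∑.sum-cong-≋ (λ i → trans (sym (*-assoc (y i) a (v i)))
                          (trans (*-congʳ (*-comm (y i) a)) (*-assoc a (y i) (v i)))))
    (sym (F∑.*-distribˡ-sum a (λ i → y i * v i)))

  dot-0 : ∀ y → dot y 0ᴹ ≈ 0#
  dot-0 y = trans (dot-cong y (≈ᴹ-sym (*ₗ-zeroˡ 0ᴹ))) (trans (dot-* y 0# 0ᴹ) (zeroˡ _))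

  -- The unit vector of a coordinate where v is nonzero pairs with v to that coordinate.
  nondegenerate : ∀ v → ¬ v ≈ᴹ 0ᴹ → ∃ λ y → ¬ dot v y ≈ 0#
  nondegenerate v v≉0 = unit i , λ eq → vᵢ≉0 (trans (sym (trans (dot-comm v (unit i)) (sum-unit i v))) eq)
    where
    ∃i = Fin.¬∀⟶∃¬ n (λ i → v i ≈ 0#) (λ i → v i ≟ 0#) v≉0
    i  = proj₁ ∃i
    vᵢ≉0 = proj₂ ∃i

    unit : ∀ {d} → Fin d → Vector Carrier d
    unit zero    = 1# Vector.∷ λ _ → 0#
    unit (suc i) = 0# Vector.∷ unit i

    sum-0 : ∀ {d} (w : Vector Carrier d) → F∑.sum (λ i → 0# * w i) ≈ 0#
    sum-0 w = trans (sym (F∑.*-distribˡ-sum 0# w)) (zeroˡ _)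

    sum-unit : ∀ {d} i (w : Vector Carrier d) → F∑.sum (λ j → unit i j * w j) ≈ w i
    sum-unit zero    w = trans (+-cong (*-identityˡ _) (sum-0 (w ∘ suc))) (+-identityʳ _)
    sum-unit (suc i) w = trans (+-cong (zeroˡ _) (sum-unit i (w ∘ suc))) (+-identityˡ _)

  -- Subspaces as decidable predicates, and their hyperplane sections

  record Subspace p : Set (c ⊔ ℓ ⊔ Level.suc p) where
    field
      ⟨_⟩     : Pred V p
      member? : Decidable ⟨_⟩
      0∈      : ⟨_⟩ 0ᴹ
      +∈      : ∀ {v w} → ⟨_⟩ v → ⟨_⟩ w → ⟨_⟩ (v +ᴹ w)
      *∈      : ∀ a {v} → ⟨_⟩ v → ⟨_⟩ (a *ₗ v)
      resp∈   : ∀ {v w} → v ≈ᴹ w → ⟨_⟩ v → ⟨_⟩ w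

    size : ℕ
    size = count (member? ∘ vec)

  open Subspace

  module _ (S : Subspace p) (y : V) {u₀ : V} (u₀∈ : ⟨ S ⟩ u₀) (yu₀≉0 : ¬ dot y u₀ ≈ 0#) where

    private
      -- Scaled so that y takes the value 1 at u; then a u is a vector of S at which y takes the
      -- value a.
      u : V
      u = proj₁ (inverse _ yu₀≉0) *ₗ u₀

      yu≈1 : dot y u ≈ 1#
      yu≈1 = trans (dot-* y _ u₀) (trans (*-comm _ _) (proj₂ (inverse _ yu₀≉0)))

      y[au]≈a : ∀ a → dot y (a *ₗ u) ≈ a
      y[au]≈a a = trans (dot-* y a u) (trans (*-congˡ yu≈1) (*-identityʳ a))

      au∈ : ∀ a → ⟨ S ⟩ (a *ₗ u)
      au∈ a = *∈ S a (*∈ S _ u₀∈)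

      untranslate : ∀ a v → (v +ᴹ ((- a) *ₗ u)) +ᴹ (a *ₗ u) ≈ᴹ v
      untranslate a v = ≈ᴹ-trans (+ᴹ-assoc v _ _) (≈ᴹ-trans
        (+ᴹ-congˡ (≈ᴹ-trans (≈ᴹ-sym (*ₗ-distribʳ u (- a) a)) (≈ᴹ-trans (*ₗ-congʳ (-‿inverseˡ a)) (*ₗ-zeroˡ u))))
        (+ᴹ-identityʳ v))

      fibre? : ∀ a → Decidable (λ k → ⟨ S ⟩ (vec k) × dot y (vec k) ≈ a)
      fibre? a k = member? S (vec k) ×-dec (dot y (vec k) ≟ a)

      -- Adding a u carries the zero fibre of y on S onto the fibre over a; subtracting a u is the
      -- inverse.
      translate : ∀ a → count (fibre? a) ≡ count (fibre? 0#)
      translate a = count-↔ {S = λ v w → (⟨ S ⟩ (vec v) × dot y (vec v) ≈ a) × vec v ≈ᴹ vec w +ᴹ (a *ₗ u)}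
        (fibre? a) (fibre? 0#)
        (λ v w → fibre? a v ×-dec (vec v ≟ᴹ (vec w +ᴹ (a *ₗ u))))
        (λ {v} v∈ → vec⁻¹ (vec v +ᴹ ((- a) *ₗ u)) , v∈ ,
          ≈ᴹ-sym (≈ᴹ-trans (+ᴹ-congʳ (vec-vec⁻¹ _)) (untranslate a (vec v))))
        (λ {w} (w∈ , yw≈0) → vec⁻¹ (vec w +ᴹ (a *ₗ u)) ,
          (resp∈ S (≈ᴹ-sym (vec-vec⁻¹ _)) (+∈ S w∈ (au∈ a)) ,
           trans (dot-cong y (vec-vec⁻¹ _)) (trans (dot-+ y _ _) (trans (+-cong yw≈0 (y[au]≈a a)) (+-identityˡ a)))) ,
          vec-vec⁻¹ _)
        (λ {v} {w} (v∈ , v≈) → v∈ ,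
          resp∈ S (VG.∙-cancelʳ (a *ₗ u) _ _ (≈ᴹ-trans (untranslate a (vec v)) v≈)) (+∈ S (proj₁ v∈) (au∈ (- a))) ,
          FG.∙-cancelʳ a _ _ (trans (trans (trans (+-congˡ (sym (y[au]≈a a))) (sym (dot-+ y _ _)))
            (trans (dot-cong y (≈ᴹ-sym v≈)) (proj₂ v∈))) (sym (+-identityˡ a))))
        (λ (_ , v≈) (_ , v≈′) → vec-injective (VG.∙-cancelʳ (a *ₗ u) _ _ (≈ᴹ-trans (≈ᴹ-sym v≈) v≈′)))
        (λ (_ , v≈) (_ , v≈′) → vec-injective (≈ᴹ-trans v≈ (≈ᴹ-sym v≈′)))

    -- S is the disjoint union of the q fibres of y, which all have the size of the zero fibre.
    q*hyperplane≡size : q ℕ.* count (λ k → member? S (vec k) ×-dec (dot y (vec k) ≟ 0#)) ≡ size S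
    q*hyperplane≡size = begin
      q ℕ.* count (fibre? 0#)                                      ≡⟨ ∑-const q _ ⟨
      ℕ∑.sum (λ (j : Fin q) → count (fibre? 0#))                   ≡⟨ ℕ∑.sum-cong-≗ (λ j → ≡.sym (translate (scalar j))) ⟩
      ℕ∑.sum (λ j → count (fibre? (scalar j)))                     ≡⟨ ℕ∑.∑-comm (λ j k → ind (fibre? (scalar j) k)) ⟩
      ℕ∑.sum (λ k → count (λ j → fibre? (scalar j) k))             ≡⟨ ℕ∑.sum-cong-≗ (λ k →
        count-unique (λ j → fibre? (scalar j) k) (member? S (vec k))
          (λ (_ , eq) (_ , eq′) → scalar-injective (trans (sym eq) eq′))
          (λ k∈ → index (dot y (vec k)) , k∈ , sym (scalar-index _)) proj₁) ⟩
      size S ∎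
      where open ≡-Reasoning

  whole : Subspace Level.zero
  whole = record
    { ⟨_⟩ = λ _ → Unit.⊤ ; member? = λ _ → yes tt ; 0∈ = tt ; +∈ = λ _ _ → tt ; *∈ = λ _ _ → tt ; resp∈ = λ _ _ → tt }

  Annihilates : Subspace p → V → Set _
  Annihilates S y = ∀ k → ⟨ S ⟩ (vec k) → dot y (vec k) ≈ 0#

  annihilates? : (S : Subspace p) → Decidable (Annihilates S)
  annihilates? S y = Fin.all? λ k → member? S (vec k) →-dec (dot y (vec k) ≟ 0#)

  ¬annihilates : (S : Subspace p) → ∀ {y} → ¬ Annihilates S y → ∃ λ u → ⟨ S ⟩ u × ¬ dot y u ≈ 0#
  ¬annihilates S {y} ¬ann with Fin.¬∀⟶∃¬ _ _ (λ k → member? S (vec k) →-dec (dot y (vec k) ≟ 0#)) ¬ann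
  ... | k , ¬imp = vec k , decidable-stable (member? S (vec k)) (λ k∉ → ¬imp (λ k∈ → contradiction k∈ k∉)) , λ eq → ¬imp (λ _ → eq)

  -- By symmetry of the form, the y orthogonal to v are the zero fibre of v taken as a functional on
  -- the whole space; it is not the zero functional by `nondegenerate`.
  q*orthogonal≡q^n : ∀ v → ¬ v ≈ᴹ 0ᴹ → q ℕ.* count (λ y → dot (vec y) v ≟ 0#) ≡ q ℕ.^ n
  q*orthogonal≡q^n v v≉0 = ≡.trans
    (≡.cong (q ℕ.*_) (count-cong (λ y → dot (vec y) v ≟ 0#) (λ k → member? whole (vec k) ×-dec (dot v (vec k) ≟ 0#))
      (λ {y} eq → tt , trans (dot-comm v (vec y)) eq) (λ {y} (_ , eq) → trans (dot-comm (vec y) v) eq)))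
    (≡.trans (q*hyperplane≡size whole v {proj₁ (nondegenerate v v≉0)} tt (proj₂ (nondegenerate v v≉0)))
             (count-all (λ k → member? whole (vec k)) λ _ → tt))

  annihilators : Subspace p → ℕ
  annihilators S = count (annihilates? S ∘ vec)

  -- Points as representatives of the nonzero vectors up to scalars

  pt : Fin ∣points∣ → V
  pt = Point.vector ∘ Points.to

  pt≉0 : ∀ i → ¬ pt i ≈ᴹ 0ᴹ
  pt≉0 i = Point.nonzero (Points.to i)

  *ₗ-cancelʳ : ∀ {a b v} → ¬ v ≈ᴹ 0ᴹ → a *ₗ v ≈ᴹ b *ₗ v → a ≈ b
  *ₗ-cancelʳ {a} {b} {v} v≉0 eq = trans (sym (undo a)) (trans (*-congʳ (eq i)) (undo b))
    where
    ∃i  = Fin.¬∀⟶∃¬ n (λ i → v i ≈ 0#) (λ i → v i ≟ 0#) v≉0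
    i   = proj₁ ∃i
    v⁻¹ = inverse (v i) (proj₂ ∃i)

    undo : ∀ x → x * v i * proj₁ v⁻¹ ≈ x
    undo x = trans (*-assoc x (v i) _) (trans (*-congˡ (proj₂ v⁻¹)) (*-identityʳ x))

  unscale : ∀ {a v w} → ¬ a ≈ 0# → v ≈ᴹ a *ₗ w → ∃ λ b → w ≈ᴹ b *ₗ v
  unscale {a} {v} {w} a≉0 v≈aw = let b , ab≈1 = inverse a a≉0 in
    b , ≈ᴹ-sym (≈ᴹ-trans (*ₗ-congˡ v≈aw) (≈ᴹ-trans (≈ᴹ-sym (*ₗ-assoc b a w))
      (≈ᴹ-trans (*ₗ-congʳ (trans (*-comm b a) ab≈1)) (*ₗ-identityˡ w))))

  scaled≉0 : ∀ {a v w} → ¬ a ≈ 0# → ¬ w ≈ᴹ 0ᴹ → v ≈ᴹ a *ₗ w → ¬ v ≈ᴹ 0ᴹ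
  scaled≉0 a≉0 w≉0 v≈aw v≈0 = let b , w≈bv = unscale a≉0 v≈aw in
    w≉0 (≈ᴹ-trans w≈bv (≈ᴹ-trans (*ₗ-congˡ v≈0) (*ₗ-zeroʳ b)))

  pt-injective : ∀ {i j a} → pt i ≈ᴹ a *ₗ pt j → i ≡ j
  pt-injective {i} {j} {a} eq = ≡.trans (≡.sym (Points.strictlyInverseʳ i))
    (≡.trans (Points.from-cong (a , eq)) (Points.strictlyInverseʳ j))

  representative : ∀ v → ¬ v ≈ᴹ 0ᴹ → ∃ λ i → ∃ λ a → ¬ a ≈ 0# × v ≈ᴹ a *ₗ pt i
  representative v v≉0 = Points.from (point v v≉0) , x ,
    (λ x≈0 → v≉0 (≈ᴹ-trans v≈ (≈ᴹ-trans (*ₗ-congʳ x≈0) (*ₗ-zeroˡ _)))) , v≈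
    where
    v∼ = ∼-sym (Points.strictlyInverseˡ (point v v≉0))
    x  = _∼_.scalar v∼
    v≈ = _∼_.proportional v∼

  -- Two double counts inside a subspace

  module _ (S : Subspace p) where

    private
      pair? : ∀ v y → Dec (⟨ S ⟩ (vec v) × dot (vec y) (vec v) ≈ 0#)
      pair? v y = member? S (vec v) ×-dec (dot (vec y) (vec v) ≟ 0#)

      pairs : ℕ
      pairs = ℕ∑.sum (λ v → count (pair? v))

      Q = q ℕ.^ n

      swap : ∀ a b c → a ℕ.* (b ℕ.* c) ≡ b ℕ.* (a ℕ.* c)
      swap = ℕ-Solver.solve-∀

      -- A nonzero v in S is orthogonal to Q / q vectors, whereas v = 0 is orthogonal to all Q.
      -- Multiplying by q avoids the division, and the surplus q Q - Q of the zero vector is the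
      -- second term.
      row : ∀ v → q ℕ.* count (pair? v) ≡
                  ind (member? S (vec v)) ℕ.* Q ℕ.+ ind (vec v ≟ᴹ 0ᴹ) ℕ.* (units ℕ.* Q)
      row v = go (vec v ≟ᴹ 0ᴹ)
        where
        open ≡-Reasoning
        i = ind (member? S (vec v))
        o = count (λ y → dot (vec y) (vec v) ≟ 0#)

        go : (d : Dec (vec v ≈ᴹ 0ᴹ)) → q ℕ.* count (pair? v) ≡ i ℕ.* Q ℕ.+ ind d ℕ.* (units ℕ.* Q)
        go (yes v≈0) = begin
          q ℕ.* count (pair? v)              ≡⟨ ≡.cong₂ ℕ._*_ (≡.sym 1+units≡q) (count-all (pair? v) λ y →
                                                  v∈ , trans (dot-cong (vec y) v≈0) (dot-0 (vec y))) ⟩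
          Q ℕ.+ units ℕ.* Q                  ≡⟨ ≡.cong₂ ℕ._+_ (ℕ.*-identityˡ Q) (ℕ.*-identityˡ (units ℕ.* Q)) ⟨
          1 ℕ.* Q ℕ.+ 1 ℕ.* (units ℕ.* Q)    ≡⟨ ≡.cong (λ x → x ℕ.* Q ℕ.+ 1 ℕ.* (units ℕ.* Q)) (ind-yes (member? S (vec v)) v∈) ⟨
          i ℕ.* Q ℕ.+ 1 ℕ.* (units ℕ.* Q)    ∎
          where v∈ = resp∈ S (≈ᴹ-sym v≈0) (0∈ S)
        go (no v≉0) = begin
          q ℕ.* count (pair? v)    ≡⟨ ≡.cong (q ℕ.*_) (count-×ˡ (member? S (vec v)) (λ y → dot (vec y) (vec v) ≟ 0#)) ⟩
          q ℕ.* (i ℕ.* o)          ≡⟨ swap q i o ⟩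
          i ℕ.* (q ℕ.* o)          ≡⟨ ≡.cong (i ℕ.*_) (q*orthogonal≡q^n (vec v) v≉0) ⟩
          i ℕ.* Q                  ≡⟨ ℕ.+-identityʳ _ ⟨
          i ℕ.* Q ℕ.+ 0            ∎

      -- Unless y annihilates S, it cuts out a hyperplane, of size |S| / q. For an annihilating y
      -- all of S counts, which after multiplication by q gives the surplus (q - 1) |S|.
      column : ∀ y → q ℕ.* count (λ v → pair? v y) ≡
                     size S ℕ.+ ind (annihilates? S (vec y)) ℕ.* (units ℕ.* size S)
      column y = go (annihilates? S (vec y))
        where
        open ≡-Reasoning

        go : (d : Dec (Annihilates S (vec y))) →
             q ℕ.* count (λ v → pair? v y) ≡ size S ℕ.+ ind d ℕ.* (units ℕ.* size S)
        go (yes ann) = begin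
          q ℕ.* count (λ v → pair? v y)          ≡⟨ ≡.cong₂ ℕ._*_ (≡.sym 1+units≡q)
            (count-cong (λ v → pair? v y) (λ v → member? S (vec v)) proj₁ (λ v∈ → v∈ , ann _ v∈)) ⟩
          size S ℕ.+ units ℕ.* size S            ≡⟨ ≡.cong (size S ℕ.+_) (ℕ.*-identityˡ (units ℕ.* size S)) ⟨
          size S ℕ.+ 1 ℕ.* (units ℕ.* size S)    ∎
        go (no ¬ann) = let _ , u∈ , yu≉0 = ¬annihilates S ¬ann in
          ≡.trans (q*hyperplane≡size S (vec y) u∈ yu≉0) (≡.sym (ℕ.+-identityʳ _))

    -- Count the pairs (v , y) with v ∈ S and y · v = 0 in two ways.
    annihilators*size : annihilators S ℕ.* size S ≡ Q
    -- The row and column totals share the term Q |S|; what is left on each side is a multiple of q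
    -- - 1, which is nonzero.
    annihilators*size = ℕ.*-cancelˡ-≡ (annihilators S ℕ.* size S) Q units
      (ℕ.+-cancelˡ-≡ (Q ℕ.* size S) _ _ (begin
        Q ℕ.* size S ℕ.+ units ℕ.* (annihilators S ℕ.* size S)
          ≡⟨ ≡.cong (Q ℕ.* size S ℕ.+_) (swap units (annihilators S) (size S)) ⟩
        Q ℕ.* size S ℕ.+ annihilators S ℕ.* (units ℕ.* size S)
          ≡⟨ ≡.cong₂ ℕ._+_ (≡.sym (∑-const Q (size S)))
               (ℕ∑.*-distribʳ-sum (units ℕ.* size S) (λ y → ind (annihilates? S (vec y)))) ⟩
        ℕ∑.sum {Q} (λ _ → size S) ℕ.+ ℕ∑.sum (λ y → ind (annihilates? S (vec y)) ℕ.* (units ℕ.* size S))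
          ≡⟨ ℕ∑.∑-distrib-+ {Q} (λ _ → size S) (λ y → ind (annihilates? S (vec y)) ℕ.* (units ℕ.* size S)) ⟨
        ℕ∑.sum (λ y → size S ℕ.+ ind (annihilates? S (vec y)) ℕ.* (units ℕ.* size S))
          ≡⟨ ℕ∑.sum-cong-≗ column ⟨
        ℕ∑.sum (λ y → q ℕ.* count (λ v → pair? v y))
          ≡⟨ ℕ∑.*-distribˡ-sum q (λ y → count (λ v → pair? v y)) ⟨
        q ℕ.* ℕ∑.sum (λ y → count (λ v → pair? v y))
          ≡⟨ ≡.cong (q ℕ.*_) (ℕ∑.∑-comm (λ v y → ind (pair? v y))) ⟨
        q ℕ.* pairs
          ≡⟨ ℕ∑.*-distribˡ-sum q (λ v → count (pair? v)) ⟩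
        ℕ∑.sum (λ v → q ℕ.* count (pair? v))
          ≡⟨ ℕ∑.sum-cong-≗ row ⟩
        ℕ∑.sum (λ v → ind (member? S (vec v)) ℕ.* Q ℕ.+ ind (vec v ≟ᴹ 0ᴹ) ℕ.* (units ℕ.* Q))
          ≡⟨ ℕ∑.∑-distrib-+ (λ v → ind (member? S (vec v)) ℕ.* Q) (λ v → ind (vec v ≟ᴹ 0ᴹ) ℕ.* (units ℕ.* Q)) ⟩
        ℕ∑.sum (λ v → ind (member? S (vec v)) ℕ.* Q) ℕ.+ ℕ∑.sum (λ v → ind (vec v ≟ᴹ 0ᴹ) ℕ.* (units ℕ.* Q))
          ≡⟨ ≡.cong₂ ℕ._+_ (≡.sym (ℕ∑.*-distribʳ-sum Q (λ v → ind (member? S (vec v)))))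
               (≡.sym (ℕ∑.*-distribʳ-sum (units ℕ.* Q) (λ v → ind (vec v ≟ᴹ 0ᴹ)))) ⟩
        size S ℕ.* Q ℕ.+ count (λ v → vec v ≟ᴹ 0ᴹ) ℕ.* (units ℕ.* Q)
          ≡⟨ ≡.cong₂ ℕ._+_ (ℕ.*-comm (size S) Q) (≡.trans (≡.cong (ℕ._* (units ℕ.* Q)) count-zero) (ℕ.*-identityˡ _)) ⟩
        Q ℕ.* size S ℕ.+ units ℕ.* Q ∎))
      where open ≡-Reasoning

    private
      multiple? : ∀ v i a → Dec (⟨ S ⟩ (vec v) × ¬ scalar a ≈ 0# × vec v ≈ᴹ scalar a *ₗ pt i)
      multiple? v i a = member? S (vec v) ×-dec ¬? (scalar a ≟ 0#) ×-dec (vec v ≟ᴹ (scalar a *ₗ pt i))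

    pointCount : ℕ
    pointCount = count (λ i → member? S (pt i))

    -- The nonzero vectors of S are the a · pᵢ with a ≠ 0 and pᵢ ∈ S.
    pointCount*units : suc (pointCount ℕ.* units) ≡ size S
    pointCount*units = begin
      suc (pointCount ℕ.* units)
        ≡⟨ ≡.cong suc (ℕ∑.*-distribʳ-sum units (λ i → ind (member? S (pt i)))) ⟩
      suc (ℕ∑.sum (λ i → ind (member? S (pt i)) ℕ.* units))
        ≡⟨ ≡.cong suc (ℕ∑.sum-cong-≗ λ i → ≡.sym (count-×ˡ (member? S (pt i)) (λ a → ¬? (scalar a ≟ 0#)))) ⟩
      suc (ℕ∑.sum λ i → ℕ∑.sum λ a → ind (member? S (pt i) ×-dec ¬? (scalar a ≟ 0#)))
        ≡⟨ ≡.cong suc (ℕ∑.sum-cong-≗ λ i → ℕ∑.sum-cong-≗ λ a → ≡.sym (over-vectors i a)) ⟩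
      suc (ℕ∑.sum λ i → ℕ∑.sum λ a → ℕ∑.sum λ v → ind (multiple? v i a))
        ≡⟨ ≡.cong suc (ℕ∑.sum-cong-≗ λ i → ℕ∑.∑-comm (λ a v → ind (multiple? v i a))) ⟩
      suc (ℕ∑.sum λ i → ℕ∑.sum λ v → ℕ∑.sum λ a → ind (multiple? v i a))
        ≡⟨ ≡.cong suc (ℕ∑.∑-comm (λ i v → ℕ∑.sum λ a → ind (multiple? v i a))) ⟩
      suc (ℕ∑.sum λ v → ℕ∑.sum λ i → ℕ∑.sum λ a → ind (multiple? v i a))
        ≡⟨ ≡.cong suc (ℕ∑.sum-cong-≗ over-points) ⟩
      suc (ℕ∑.sum λ v → ind (nonzero? v))
        ≡⟨ ≡.cong (ℕ._+ ℕ∑.sum λ v → ind (nonzero? v)) count-zero ⟨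
      count (λ v → vec v ≟ᴹ 0ᴹ) ℕ.+ (ℕ∑.sum λ v → ind (nonzero? v))
        ≡⟨ ℕ∑.∑-distrib-+ (λ v → ind (vec v ≟ᴹ 0ᴹ)) (λ v → ind (nonzero? v)) ⟨
      ℕ∑.sum (λ v → ind (vec v ≟ᴹ 0ᴹ) ℕ.+ ind (nonzero? v))
        ≡⟨ ℕ∑.sum-cong-≗ split ⟩
      size S ∎
      where
      open ≡-Reasoning

      nonzero? : ∀ v → Dec (⟨ S ⟩ (vec v) × ¬ vec v ≈ᴹ 0ᴹ)
      nonzero? v = member? S (vec v) ×-dec ¬? (vec v ≟ᴹ 0ᴹ)

      over-vectors : ∀ i a → count (λ v → multiple? v i a) ≡ ind (member? S (pt i) ×-dec ¬? (scalar a ≟ 0#))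
      over-vectors i a = count-unique (λ v → multiple? v i a) (member? S (pt i) ×-dec ¬? (scalar a ≟ 0#))
        (λ (_ , _ , v≈) (_ , _ , w≈) → vec-injective (≈ᴹ-trans v≈ (≈ᴹ-sym w≈)))
        (λ (i∈ , a≉0) → vec⁻¹ (scalar a *ₗ pt i) , resp∈ S (≈ᴹ-sym (vec-vec⁻¹ _)) (*∈ S _ i∈) , a≉0 , vec-vec⁻¹ _)
        (λ (v∈ , a≉0 , v≈) → let b , pt≈ = unscale a≉0 v≈ in resp∈ S (≈ᴹ-sym pt≈) (*∈ S b v∈) , a≉0)

      -- A nonzero v determines first the scalar, once its point is fixed, and then the point
      -- itself, since two points with a common nonzero multiple are proportional.
      over-points : ∀ v → (ℕ∑.sum λ i → count (λ a → multiple? v i a)) ≡ ind (nonzero? v)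
      over-points v = ≡.trans
        (ℕ∑.sum-cong-≗ λ i → count-unique (multiple? v i) (Fin.any? (multiple? v i))
          (λ (_ , _ , v≈) (_ , _ , v≈′) → scalar-injective (*ₗ-cancelʳ (pt≉0 i) (≈ᴹ-trans (≈ᴹ-sym v≈) v≈′)))
          id (λ {a} m → a , m))
        (count-unique (λ i → Fin.any? (multiple? v i)) (nonzero? v)
          (λ (a , _ , a≉0 , v≈) (b , _ , _ , v≈′) → let a⁻¹ , pt≈ = unscale a≉0 v≈ in
            pt-injective {a = a⁻¹ * scalar b} (≈ᴹ-trans pt≈ (≈ᴹ-trans (*ₗ-congˡ v≈′) (≈ᴹ-sym (*ₗ-assoc a⁻¹ (scalar b) _)))))
          (λ (v∈ , v≉0) → let i , a , a≉0 , v≈ = representative (vec v) v≉0 in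
            i , index a , v∈ , (λ a≈0 → a≉0 (trans (sym (scalar-index a)) a≈0)) ,
            ≈ᴹ-trans v≈ (*ₗ-congʳ (sym (scalar-index a))))
          (λ {i} (a , v∈ , a≉0 , v≈) → v∈ , scaled≉0 a≉0 (pt≉0 i) v≈))

      split : ∀ v → ind (vec v ≟ᴹ 0ᴹ) ℕ.+ ind (nonzero? v) ≡ ind (member? S (vec v))
      split v = go (vec v ≟ᴹ 0ᴹ)
        where
        go : (d : Dec (vec v ≈ᴹ 0ᴹ)) → ind d ℕ.+ ind (member? S (vec v) ×-dec ¬? d) ≡ ind (member? S (vec v))
        go (yes v≈0) = ≡.trans (≡.cong suc (ind-no (member? S (vec v) ×-dec ¬? (yes v≈0)) λ (_ , f) → f v≈0))
          (≡.sym (ind-yes (member? S (vec v)) (resp∈ S (≈ᴹ-sym v≈0) (0∈ S))))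
        go (no v≉0)  = ind-cong proj₁ (_, v≉0) (member? S (vec v) ×-dec ¬? (no v≉0)) (member? S (vec v))

  -- An index y : Fin (q ^ n) stands for the functional dot (vec y).
  Ker : Vec (Fin (q ℕ.^ n)) m → Subspace ℓ
  Ker f = record
    { ⟨_⟩     = λ v → VAll (λ y → dot (vec y) v ≈ 0#) f
    ; member? = λ v → VAll.all? (λ y → dot (vec y) v ≟ 0#) f
    ; 0∈      = VAll.universal (λ y → dot-0 (vec y)) f
    ; +∈      = λ v∈ w∈ → VAll.map (λ {y} (yv≈0 , yw≈0) →
        trans (dot-+ (vec y) _ _) (trans (+-cong yv≈0 yw≈0) (+-identityˡ 0#))) (VAll.zip (v∈ , w∈))
    ; *∈      = λ a → VAll.map λ {y} yv≈0 → trans (dot-* (vec y) a _) (trans (*-congˡ yv≈0) (zeroʳ a))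
    ; resp∈   = λ v≈w → VAll.map λ {y} yv≈0 → trans (dot-cong (vec y) (≈ᴹ-sym v≈w)) yv≈0
    }

  -- Defined along the tuple, without choosing bases; `size-Ker` shows that it is the dimension of
  -- the kernel. The predecessor never truncates, because a zero kernel is annihilated by every
  -- functional.
  kerDim : Vec (Fin (q ℕ.^ n)) m → ℕ
  kerDim []      = n
  kerDim (y ∷ f) = if does (annihilates? (Ker f) (vec y)) then kerDim f else ℕ.pred (kerDim f)

  kerDim≤n : (f : Vec (Fin (q ℕ.^ n)) m) → kerDim f ℕ.≤ n
  kerDim≤n []      = ℕ.≤-refl
  kerDim≤n (y ∷ f) = go (does (annihilates? (Ker f) (vec y)))
    where
    go : ∀ b → (if b then kerDim f else ℕ.pred (kerDim f)) ℕ.≤ n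
    go true  = kerDim≤n f
    go false = ℕ.≤-trans ℕ.pred[n]≤n (kerDim≤n f)

  size-Ker : (f : Vec (Fin (q ℕ.^ n)) m) → size (Ker f) ≡ q ℕ.^ kerDim f
  size-Ker []      = count-all (λ k → member? (Ker []) (vec k)) λ _ → []
  size-Ker (y ∷ f) = go (annihilates? (Ker f) (vec y))
    where
    hyperplane : count (λ k → member? (Ker f) (vec k) ×-dec (dot (vec y) (vec k) ≟ 0#)) ≡ size (Ker (y ∷ f))
    hyperplane = count-cong (λ k → member? (Ker f) (vec k) ×-dec (dot (vec y) (vec k) ≟ 0#))
      (λ k → member? (Ker (y ∷ f)) (vec k)) (λ (k∈ , yk≈0) → yk≈0 ∷ k∈) (λ { (yk≈0 ∷ k∈) → k∈ , yk≈0 })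

    divide : ∀ {s} k → q ℕ.* s ≡ q ℕ.^ k → s ≡ q ℕ.^ ℕ.pred k
    -- A kernel of size 1 has no proper hyperplane section: q would divide 1.
    divide zero    eq = contradiction (ℕ.m*n≡1⇒m≡1 q _ eq) (ℕ.>⇒≢ 1<q)
    divide (suc k) eq = ℕ.*-cancelˡ-≡ _ _ q eq

    go : (d : Dec (Annihilates (Ker f) (vec y))) →
         size (Ker (y ∷ f)) ≡ q ℕ.^ (if does d then kerDim f else ℕ.pred (kerDim f))
    go (yes ann) = ≡.trans
      (count-cong (λ k → member? (Ker (y ∷ f)) (vec k)) (λ k → member? (Ker f) (vec k)) VAll.tail (λ k∈ → ann _ k∈ ∷ k∈))
      (size-Ker f)
    go (no ¬ann) = let _ , u∈ , yu≉0 = ¬annihilates (Ker f) ¬ann in divide (kerDim f)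
      (≡.trans (≡.cong (q ℕ.*_) (≡.sym hyperplane)) (≡.trans (q*hyperplane≡size (Ker f) (vec y) u∈ yu≉0) (size-Ker f)))

  -- Spans enter through a basis because `LC` is decidable, by search over the coefficients, whereas
  -- `Span` is an inductive closure.
  LC-subspace : ∀ {d} → Vec V d → Subspace (c ⊔ ℓ)
  LC-subspace b = record
    { ⟨_⟩ = LC b ; member? = LC? _≟ᴹ_ b ; 0∈ = LC-0 b ; +∈ = LC-+ ; *∈ = λ a → LC-* a ; resp∈ = LC-resp }

  linComb-injective : ∀ {d} {b : Vec V d} → LinearlyIndependent b →
                      ∀ {a a′} → linComb a b ≈ᴹ linComb a′ b → ∀ i → a i ≈ a′ i
  linComb-injective {b = b} ind {a} {a′} eq i = FG.x∙y⁻¹≈ε⇒x≈y _ _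
    (trans (+-congˡ (sym (FR.-1*x≈-x (a′ i)))) (ind (λ i → a i + (- 1#) * a′ i)
      (≈ᴹ-trans (linComb-+ a (λ i → (- 1#) * a′ i) b)
      (≈ᴹ-trans (+ᴹ-cong eq (≈ᴹ-trans (linComb-* (- 1#) a′ b) (-1*ₗ _))) (-ᴹ‿inverseʳ _))) i))

  -- Independence makes coefficient vectors correspond one to one to combinations.
  size-LC : ∀ {d} (b : Vec V d) → LinearlyIndependent b → size (LC-subspace b) ≡ q ℕ.^ d
  size-LC {d} b ind = ≡.trans
    (≡.sym (count-↔ {S = λ a v → vec v ≈ᴹ linComb (toVector d a) b}
      (λ _ → yes tt) (λ v → LC? _≟ᴹ_ b (vec v)) (λ a v → vec v ≟ᴹ linComb (toVector d a) b)
      (λ {a} _ → vec⁻¹ (linComb (toVector d a) b) , vec-vec⁻¹ _)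
      (λ { (a , v≈) → fromVector a , ≈ᴹ-trans v≈ (linComb-cong b (λ i → sym (toVector-fromVector a i))) })
      (λ v≈ → tt , (_ , v≈))
      (λ v≈ w≈ → vec-injective (≈ᴹ-trans v≈ (≈ᴹ-sym w≈)))
      (λ v≈ v≈′ → toVector-injective d (linComb-injective {b = b} ind (≈ᴹ-trans (≈ᴹ-sym v≈) v≈′)))))
    (count-all (λ _ → yes tt) λ _ → tt)

  -- Ranks of sets of points, as exponents of cardinalities

  open Matroid PG[ n -1, F ] using (rank; rank-mono)

  VanishesOn : Subset ∣points∣ → V → Set ℓ
  VanishesOn B y = ∀ i → i ∈ B → dot y (pt i) ≈ 0#

  vanishesOn? : ∀ B → Decidable (VanishesOn B)
  vanishesOn? B y = Fin.all? λ i → (i Subset.∈? B) →-dec (dot y (pt i) ≟ 0#)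

  private
    PointsOf : Subset ∣points∣ → Pred V _
    PointsOf = Image F vectorSpace _≟ᴹ_ pt

    module Basis (B : Subset ∣points∣) where

      dim = dimension F vectorSpace _≟ᴹ_ pt B

      basis : Vec V (rank B)
      basis = proj₁ (proj₂ dim)

      open IsBasis (proj₂ (proj₂ dim)) public

  dot-Span : ∀ {B y} → VanishesOn B y → ∀ {v} → Span (PointsOf B) v → dot y v ≈ 0#
  dot-Span {y = y} y⊥B (generator (i , i∈B , ≡.refl)) = y⊥B i i∈B
  dot-Span {y = y} y⊥B zeroᴹ       = dot-0 y
  dot-Span {y = y} y⊥B (add v w)   =
    trans (dot-+ y _ _) (trans (+-cong (dot-Span y⊥B v) (dot-Span y⊥B w)) (+-identityˡ 0#))
  dot-Span {y = y} y⊥B (scale a v) = trans (dot-* y a _) (trans (*-congˡ (dot-Span y⊥B v)) (zeroʳ a))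
  dot-Span {y = y} y⊥B (resp eq v) = trans (dot-cong y (≈ᴹ-sym eq)) (dot-Span y⊥B v)

  linComb∈Span : ∀ {P : Pred V p} {d} {b : Vec V d} → VAll (Span P) b → ∀ a → Span P (linComb a b)
  linComb∈Span []        a = zeroᴹ
  linComb∈Span (v∈ ∷ b∈) a = add (scale (a zero) v∈) (linComb∈Span b∈ (a ∘ suc))

  -- Every vector is a multiple of some point, so a basis of the span of all points generates q^n
  -- vectors; comparing exponents gives the rank.
  rank-⊤ : rank ⊤ ≡ n
  rank-⊤ = ^-injectiveʳ (≡.trans (≡.sym (size-LC basis independent))
    (count-all (λ k → LC? _≟ᴹ_ basis (vec k)) λ k → generates (everything (vec k))))
    where
    open Basis ⊤

    everything : ∀ v → Span (PointsOf ⊤) v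
    everything v with v ≟ᴹ 0ᴹ
    ... | yes v≈0 = resp (≈ᴹ-sym v≈0) zeroᴹ
    ... | no  v≉0 = let i , a , _ , v≈ = representative v v≉0 in
      resp (≈ᴹ-sym v≈) (scale a (generator (i , Subset.∈⊤ , ≡.refl)))

    ^-injectiveʳ : ∀ {k l} → q ℕ.^ k ≡ q ℕ.^ l → k ≡ l
    ^-injectiveʳ {k} {l} eq = ℕ.≤-antisym
      (ℕ.≮⇒≥ λ l<k → ℕ.<⇒≢ (ℕ.^-monoʳ-< q 1<q l<k) (≡.sym eq))
      (ℕ.≮⇒≥ λ k<l → ℕ.<⇒≢ (ℕ.^-monoʳ-< q 1<q k<l) eq)

  rank≤n : ∀ B → rank B ℕ.≤ n
  rank≤n B = ≡.subst (rank B ℕ.≤_) rank-⊤ (rank-mono (Subset.⊆-max B))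

  -- Vanishing on B is the same as annihilating its span, which has q^r(B) elements;
  -- `annihilators*size` then gives the number of such functionals.
  count-vanishesOn : ∀ B → count (vanishesOn? B ∘ vec) ≡ q ℕ.^ (n ℕ.∸ rank B)
  count-vanishesOn B = ℕ.*-cancelʳ-≡ _ _ (q ℕ.^ rank B) {{ℕ.m^n≢0 q (rank B)}} (begin
    count (vanishesOn? B ∘ vec) ℕ.* q ℕ.^ rank B
      ≡⟨ ≡.cong₂ ℕ._*_
           (count-cong (vanishesOn? B ∘ vec) (annihilates? (LC-subspace basis) ∘ vec) vanishes⇒annihilates annihilates⇒vanishes)
           (≡.sym (size-LC basis independent)) ⟩
    annihilators (LC-subspace basis) ℕ.* size (LC-subspace basis)
      ≡⟨ annihilators*size (LC-subspace basis) ⟩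
    q ℕ.^ n
      ≡⟨ ≡.cong (q ℕ.^_) (ℕ.m∸n+n≡m (rank≤n B)) ⟨
    q ℕ.^ (n ℕ.∸ rank B ℕ.+ rank B)
      ≡⟨ ℕ.^-distribˡ-+-* q (n ℕ.∸ rank B) (rank B) ⟩
    q ℕ.^ (n ℕ.∸ rank B) ℕ.* q ℕ.^ rank B ∎)
    where
    open ≡-Reasoning
    open Basis B

    vanishes⇒annihilates : ∀ {y} → VanishesOn B (vec y) → Annihilates (LC-subspace basis) (vec y)
    vanishes⇒annihilates {y} y⊥B k (a , k≈) = dot-Span y⊥B (resp (≈ᴹ-sym k≈) (linComb∈Span ⊆S a))

    annihilates⇒vanishes : ∀ {y} → Annihilates (LC-subspace basis) (vec y) → VanishesOn B (vec y)
    annihilates⇒vanishes {y} ann i i∈B = trans (dot-cong (vec y) (≈ᴹ-sym (vec-vec⁻¹ (pt i))))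
      (ann (vec⁻¹ (pt i)) (LC-resp (≈ᴹ-sym (vec-vec⁻¹ (pt i))) (generates (generator (i , i∈B , ≡.refl)))))

open import Defs

-- Polynomials and their values

eval : ℤ → Poly → ℤ
eval t []      = 0ℤ
eval t (a ∷ p) = a ℤ.+ t ℤ.* eval t p

module _ (t : ℤ) where

  eval-+ : ∀ p r → eval t (p + r) ≡ eval t p ℤ.+ eval t r
  eval-+ []      r       = ≡.sym (ℤ.+-identityˡ _)
  eval-+ (a ∷ p) []      = ≡.sym (ℤ.+-identityʳ _)
  eval-+ (a ∷ p) (b ∷ r) = ≡.trans (≡.cong (λ z → a ℤ.+ b ℤ.+ t ℤ.* z) (eval-+ p r))
    (lemma a b t (eval t p) (eval t r))
    where
    lemma : ∀ a b t x y → a ℤ.+ b ℤ.+ t ℤ.* (x ℤ.+ y) ≡ a ℤ.+ t ℤ.* x ℤ.+ (b ℤ.+ t ℤ.* y)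
    lemma = ℤ-Solver.solve-∀

  eval-neg : ∀ p → eval t (- p) ≡ ℤ.- eval t p
  eval-neg []      = ≡.refl
  eval-neg (a ∷ p) = ≡.trans (≡.cong (λ z → ℤ.- a ℤ.+ t ℤ.* z) (eval-neg p)) (lemma a t (eval t p))
    where
    lemma : ∀ a t x → ℤ.- a ℤ.+ t ℤ.* ℤ.- x ≡ ℤ.- (a ℤ.+ t ℤ.* x)
    lemma = ℤ-Solver.solve-∀

  eval-· : ∀ a p → eval t (a Polynomial.· p) ≡ a ℤ.* eval t p
  eval-· a []      = ≡.sym (ℤ.*-zeroʳ a)
  eval-· a (b ∷ p) = ≡.trans (≡.cong (λ z → a ℤ.* b ℤ.+ t ℤ.* z) (eval-· a p)) (lemma a b t (eval t p))
    where
    lemma : ∀ a b t x → a ℤ.* b ℤ.+ t ℤ.* (a ℤ.* x) ≡ a ℤ.* (b ℤ.+ t ℤ.* x)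
    lemma = ℤ-Solver.solve-∀

  eval-* : ∀ p r → eval t (p * r) ≡ eval t p ℤ.* eval t r
  eval-* []      r = ≡.refl
  eval-* (a ∷ p) r = ≡.trans (eval-+ (a Polynomial.· r) (0ℤ ∷ p * r))
    (≡.trans (≡.cong₂ (λ y z → y ℤ.+ (0ℤ ℤ.+ t ℤ.* z)) (eval-· a r) (eval-* p r))
             (lemma a t (eval t p) (eval t r)))
    where
    lemma : ∀ a t x y → a ℤ.* y ℤ.+ (0ℤ ℤ.+ t ℤ.* (x ℤ.* y)) ≡ (a ℤ.+ t ℤ.* x) ℤ.* y
    lemma = ℤ-Solver.solve-∀

  eval-C : ∀ a → eval t (C a) ≡ a
  eval-C a = ≡.trans (≡.cong (ℤ._+_ a) (ℤ.*-zeroʳ t)) (ℤ.+-identityʳ a)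

  eval-X : eval t X ≡ t
  eval-X = lemma t
    where
    lemma : ∀ t → 0ℤ ℤ.+ t ℤ.* (1ℤ ℤ.+ t ℤ.* 0ℤ) ≡ t
    lemma = ℤ-Solver.solve-∀

  eval-sub : ∀ p r → eval t (p - r) ≡ eval t p ℤ.- eval t r
  eval-sub p r = ≡.trans (eval-+ p (- r)) (≡.cong (ℤ._+_ (eval t p)) (eval-neg r))

  eval-^ : ∀ p k → eval t (p ^ k) ≡ eval t p ℤ.^ k
  eval-^ p zero    = eval-C 1ℤ
  eval-^ p (suc k) = ≡.trans (eval-* p (p ^ k)) (≡.cong (eval t p ℤ.*_) (eval-^ p k))

  eval-sum : ∀ {n} (f : Vector Poly (suc n)) → eval t (∑[ k ≤ n ] f k) ≡ ℤ∑.sum (eval t ∘ f)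
  eval-sum {n} f = go f
    where
    go : ∀ {k} (f : Vector Poly k) → eval t (Vector.foldr _+_ 0# f) ≡ ℤ∑.sum (eval t ∘ f)
    go {zero}  f = ≡.refl
    go {suc k} f = ≡.trans (eval-+ (f zero) (Vector.foldr _+_ 0# (f ∘ suc))) (≡.cong (ℤ._+_ (eval t (f zero))) (go (f ∘ suc)))

-- A polynomial vanishing at all powers of q has a constant term divisible
-- by all powers of q, hence zero; then divide by x.
module _ (q : ℕ) (1<q : 1 ℕ.< q) where

  n<q^n : ∀ n → n ℕ.< q ℕ.^ n
  n<q^n zero    = ℕ.s≤s ℕ.z≤n
  n<q^n (suc n) = begin-strict
    suc n                ≤⟨ n<q^n n ⟩
    q ℕ.^ n              ≡⟨ ℕ.*-identityˡ _ ⟨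
    1 ℕ.* q ℕ.^ n        <⟨ ℕ.*-monoˡ-< (q ℕ.^ n) {{ℕ.>-nonZero (ℕ.≤-trans (ℕ.s≤s ℕ.z≤n) (n<q^n n))}} 1<q ⟩
    q ℕ.* q ℕ.^ n        ∎
    where open ℕ.≤-Reasoning

  vanishing⇒coeff≡0 : ∀ p → (∀ m → eval (+ (q ℕ.^ m)) p ≡ 0ℤ) → ∀ k → Polynomial.coeff p k ≡ 0ℤ
  vanishing⇒coeff≡0 []      van k = ≡.refl
  vanishing⇒coeff≡0 (a ∷ p) van = λ { zero → a≡0 ; (suc k) → vanishing⇒coeff≡0 p van′ k }
    where
    at : ℕ → ℤ
    at m = + (q ℕ.^ m)

    a≡-t*p : ∀ m → a ≡ ℤ.- eval (at m) p ℤ.* at m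
    a≡-t*p m = ≡.trans (lemma a (at m) (eval (at m) p))
      (≡.trans (≡.cong (ℤ._+ ℤ.- eval (at m) p ℤ.* at m) (van m)) (ℤ.+-identityˡ _))
      where
      lemma : ∀ a t x → a ≡ (a ℤ.+ t ℤ.* x) ℤ.+ ℤ.- x ℤ.* t
      lemma = ℤ-Solver.solve-∀

    -- A single well-chosen power suffices: q^|a| divides |a| but exceeds it, so a = 0.
    divisible : q ℕ.^ ℤ.∣ a ∣ ℕ.∣ ℤ.∣ a ∣
    divisible = ℕ.divides ℤ.∣ ℤ.- eval (at ℤ.∣ a ∣) p ∣
      (≡.trans (≡.cong ℤ.∣_∣ (a≡-t*p ℤ.∣ a ∣)) (ℤ.abs-* (ℤ.- eval (at ℤ.∣ a ∣) p) (at ℤ.∣ a ∣)))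

    a≡0 : a ≡ 0ℤ
    a≡0 with ℤ.∣ a ∣ in eq | divisible
    ... | zero  | _ = ℤ.∣i∣≡0⇒i≡0 eq
    ... | suc k | d = contradiction (ℕ.∣⇒≤ d) (ℕ.<⇒≱ (n<q^n (suc k)))

    -- With a = 0 the value is q^m times the value of the tail, and q^m is nonzero.
    van′ : ∀ m → eval (at m) p ≡ 0ℤ
    van′ m with ℤ.i*j≡0⇒i≡0∨j≡0 (at m) (≡.trans (≡.sym (ℤ.+-identityˡ _))
      (≡.trans (≡.cong (ℤ._+ at m ℤ.* eval (at m) p) (≡.sym a≡0)) (van m)))
    ... | inj₁ q^m≡0 = contradiction (ℤ.+-injective q^m≡0) (ℕ.>⇒≢ (ℕ.≤-trans (ℕ.s≤s ℕ.z≤n) (n<q^n m)))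
    ... | inj₂ p≡0   = p≡0

  eval-injective : ∀ p r → (∀ m → eval (+ (q ℕ.^ m)) p ≡ eval (+ (q ℕ.^ m)) r) → p Polynomial.≈ r
  eval-injective p r eq = Polynomial.coeffwise λ k → ℤ.i-j≡0⇒i≡j _ _ (begin
    Polynomial.coeff p k ℤ.- Polynomial.coeff r k        ≡⟨ ≡.cong (ℤ._+_ (Polynomial.coeff p k)) (Polynomial.coeff-neg r k) ⟨
    Polynomial.coeff p k ℤ.+ Polynomial.coeff (- r) k    ≡⟨ Polynomial.coeff-+ p (- r) k ⟨
    Polynomial.coeff (p - r) k                           ≡⟨ vanishing⇒coeff≡0 (p - r) (λ m →
      ≡.trans (eval-sub _ p r) (ℤ.i≡j⇒i-j≡0 (eq m))) k ⟩
    0ℤ                                                   ∎)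
    where open ≡-Reasoning

-- Integer sums over subsets and over tuples, by recursion

∑ˢ : (Subset N → ℤ) → ℤ
∑ˢ {zero}  f = f []
∑ˢ {suc N} f = ∑ˢ (f ∘ (outside ∷_)) ℤ.+ ∑ˢ (f ∘ (inside ∷_))

∑ˢ-cong : {f g : Subset N → ℤ} → (∀ B → f B ≡ g B) → ∑ˢ f ≡ ∑ˢ g
∑ˢ-cong {zero}  eq = eq []
∑ˢ-cong {suc N} eq = ≡.cong₂ ℤ._+_ (∑ˢ-cong (eq ∘ (outside ∷_))) (∑ˢ-cong (eq ∘ (inside ∷_)))

*-distribˡ-∑ˢ : ∀ x (f : Subset N → ℤ) → x ℤ.* ∑ˢ f ≡ ∑ˢ (λ B → x ℤ.* f B)
*-distribˡ-∑ˢ {zero}  x f = ≡.refl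
*-distribˡ-∑ˢ {suc N} x f = ≡.trans (ℤ.*-distribˡ-+ x _ _)
  (≡.cong₂ ℤ._+_ (*-distribˡ-∑ˢ x (f ∘ (outside ∷_))) (*-distribˡ-∑ˢ x (f ∘ (inside ∷_))))

∑ˢ-∁ : (f : Subset N → ℤ) → ∑ˢ f ≡ ∑ˢ (f ∘ ∁)
∑ˢ-∁ {zero}  f = ≡.refl
∑ˢ-∁ {suc N} f = ≡.trans (≡.cong₂ ℤ._+_ (∑ˢ-∁ (f ∘ (outside ∷_))) (∑ˢ-∁ (f ∘ (inside ∷_)))) (ℤ.+-comm (∑ˢ (f ∘ ∁ ∘ (inside ∷_))) (∑ˢ (f ∘ ∁ ∘ (outside ∷_))))

eval-∑⊆ : ∀ t (f : Subset N → Poly) → eval t (∑⊆ f) ≡ ∑ˢ (eval t ∘ f)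
eval-∑⊆ {zero}  t f = ≡.trans (eval-+ t (f []) []) (ℤ.+-identityʳ _)
eval-∑⊆ {suc N} t f = begin
  eval t (total (List.map f (List.map (outside ∷_) (subsets N) List.++ List.map (inside ∷_) (subsets N))))
    ≡⟨ ≡.cong (eval t ∘ total) (List.map-++ f (List.map (outside ∷_) (subsets N)) _) ⟩
  eval t (total (List.map f (List.map (outside ∷_) (subsets N)) List.++ List.map f (List.map (inside ∷_) (subsets N))))
    ≡⟨ eval-++ (List.map f (List.map (outside ∷_) (subsets N))) _ ⟩
  eval t (total (List.map f (List.map (outside ∷_) (subsets N)))) ℤ.+ eval t (total (List.map f (List.map (inside ∷_) (subsets N))))
    ≡⟨ ≡.cong₂ (λ u v → eval t (total u) ℤ.+ eval t (total v)) (List.map-∘ (subsets N)) (List.map-∘ (subsets N)) ⟨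
  eval t (∑⊆ (f ∘ (outside ∷_))) ℤ.+ eval t (∑⊆ (f ∘ (inside ∷_)))
    ≡⟨ ≡.cong₂ ℤ._+_ (eval-∑⊆ t (f ∘ (outside ∷_))) (eval-∑⊆ t (f ∘ (inside ∷_))) ⟩
  ∑ˢ (eval t ∘ f) ∎
  where
  open ≡-Reasoning
  total : List Poly → Poly
  total = List.foldr _+_ 0#

  eval-++ : ∀ ps rs → eval t (total (ps List.++ rs)) ≡ eval t (total ps) ℤ.+ eval t (total rs)
  eval-++ []       rs = ≡.sym (ℤ.+-identityˡ _)
  eval-++ (p ∷ ps) rs = ≡.trans (eval-+ t p _) (≡.trans (≡.cong (ℤ._+_ (eval t p)) (eval-++ ps rs))
    (≡.trans (≡.sym (ℤ.+-assoc (eval t p) _ _)) (≡.cong (ℤ._+ eval t (total rs)) (≡.sym (eval-+ t p (total ps))))))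

-- The binomial theorem for the subsets of P: an element of P may be left out or taken, giving a
-- factor 1 + s, and any other element must be left out, giving a factor 1.
∑ˢ-⊆ : ∀ s {P : Pred (Fin N) p} (P? : Decidable P) (⊆P? : ∀ B → Dec (∀ i → i ∈ B → P i)) →
       ∑ˢ (λ B → s ℤ.^ ∣ B ∣ ℤ.* + ind (⊆P? B)) ≡ (1ℤ ℤ.+ s) ℤ.^ count P?
∑ˢ-⊆ {zero}  s P? ⊆P? = ≡.cong (λ z → 1ℤ ℤ.* + z) (ind-yes (⊆P? []) λ _ ())
∑ˢ-⊆ {suc N} s {P} P? ⊆P? = begin
  ∑ˢ (λ B → s ℤ.^ ∣ B ∣ ℤ.* + ind (⊆P? (outside ∷ B))) ℤ.+
  ∑ˢ (λ B → s ℤ.* s ℤ.^ ∣ B ∣ ℤ.* + ind (⊆P? (inside ∷ B)))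
    ≡⟨ ≡.cong₂ ℤ._+_
         (∑ˢ-cong λ B → ≡.cong (λ z → s ℤ.^ ∣ B ∣ ℤ.* + z) (ind-cong weaken extend-outside (⊆P? (outside ∷ B)) (tail? B)))
         (≡.trans (∑ˢ-cong λ B → ≡.trans (≡.cong (λ z → s ℤ.* s ℤ.^ ∣ B ∣ ℤ.* z) (ind-inside B))
                    (rearrange s (s ℤ.^ ∣ B ∣) (+ ind (P? zero)) (+ ind (tail? B))))
           (≡.sym (*-distribˡ-∑ˢ (s ℤ.* + ind (P? zero)) (λ B → s ℤ.^ ∣ B ∣ ℤ.* + ind (tail? B))))) ⟩
  T ℤ.+ s ℤ.* + ind (P? zero) ℤ.* T
    ≡⟨ ≡.cong (λ z → z ℤ.+ s ℤ.* + ind (P? zero) ℤ.* z) (∑ˢ-⊆ s (P? ∘ suc) tail?) ⟩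
  U ℤ.+ s ℤ.* + ind (P? zero) ℤ.* U
    ≡⟨ head-factor (does (P? zero)) ⟩
  (1ℤ ℤ.+ s) ℤ.^ count P? ∎
  where
  open ≡-Reasoning

  weaken : ∀ {b B} → (∀ i → i ∈ b ∷ B → P i) → ∀ i → i ∈ B → P (suc i)
  weaken ⊆P i i∈B = ⊆P (suc i) (there i∈B)

  extend-outside : ∀ {B} → (∀ i → i ∈ B → P (suc i)) → ∀ i → i ∈ outside ∷ B → P i
  extend-outside ⊆P (suc i) (there i∈B) = ⊆P i i∈B

  tail? : ∀ B → Dec (∀ i → i ∈ B → P (suc i))
  tail? B = map′ weaken extend-outside (⊆P? (outside ∷ B))

  T = ∑ˢ (λ B → s ℤ.^ ∣ B ∣ ℤ.* + ind (tail? B))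
  U = (1ℤ ℤ.+ s) ℤ.^ count (P? ∘ suc)

  ind-inside : ∀ B → + ind (⊆P? (inside ∷ B)) ≡ + ind (P? zero) ℤ.* + ind (tail? B)
  ind-inside B = ≡.trans (≡.cong +_ (≡.trans
    (ind-cong (λ ⊆P → ⊆P zero here , weaken ⊆P)
              (λ { (P0 , ⊆P) zero here → P0 ; (P0 , ⊆P) (suc i) (there i∈B) → ⊆P i i∈B })
              (⊆P? (inside ∷ B)) (P? zero ×-dec tail? B))
    (ind-× (P? zero) (tail? B)))) (ℤ.pos-* (ind (P? zero)) (ind (tail? B)))

  rearrange : ∀ s t x y → s ℤ.* t ℤ.* (x ℤ.* y) ≡ s ℤ.* x ℤ.* (t ℤ.* y)
  rearrange = ℤ-Solver.solve-∀

  head-factor : ∀ b → U ℤ.+ s ℤ.* + (if b then 1 else 0) ℤ.* U ≡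
                      (1ℤ ℤ.+ s) ℤ.^ ((if b then 1 else 0) ℕ.+ count (P? ∘ suc))
  head-factor true  = lemma s U
    where
    lemma : ∀ s u → u ℤ.+ s ℤ.* 1ℤ ℤ.* u ≡ (1ℤ ℤ.+ s) ℤ.* u
    lemma = ℤ-Solver.solve-∀
  head-factor false = lemma s U
    where
    lemma : ∀ s u → u ℤ.+ s ℤ.* 0ℤ ℤ.* u ≡ u
    lemma = ℤ-Solver.solve-∀

-- The head is summed innermost, with the tail fixed, to match the recursion of `kerDim`, in which
-- the head is the functional added last.
∑ᵗ : ∀ m → (Vec (Fin N) m → ℤ) → ℤ
∑ᵗ zero    h = h []
∑ᵗ (suc m) h = ∑ᵗ m λ f → ℤ∑.sum λ y → h (y ∷ f)

∑ᵗ-cong : ∀ m {g h : Vec (Fin N) m → ℤ} → (∀ f → g f ≡ h f) → ∑ᵗ m g ≡ ∑ᵗ m h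
∑ᵗ-cong zero    eq = eq []
∑ᵗ-cong (suc m) eq = ∑ᵗ-cong m λ f → ℤ∑.sum-cong-≗ λ y → eq (y ∷ f)

∑ᵗ-distrib-+ : ∀ m (g h : Vec (Fin N) m → ℤ) → ∑ᵗ m (λ f → g f ℤ.+ h f) ≡ ∑ᵗ m g ℤ.+ ∑ᵗ m h
∑ᵗ-distrib-+ zero    g h = ≡.refl
∑ᵗ-distrib-+ (suc m) g h = ≡.trans
  (∑ᵗ-cong m λ f → ℤ∑.∑-distrib-+ (λ y → g (y ∷ f)) (λ y → h (y ∷ f)))
  (∑ᵗ-distrib-+ m (λ f → ℤ∑.sum λ y → g (y ∷ f)) (λ f → ℤ∑.sum λ y → h (y ∷ f)))

*-distribˡ-∑ᵗ : ∀ m x (h : Vec (Fin N) m → ℤ) → x ℤ.* ∑ᵗ m h ≡ ∑ᵗ m (λ f → x ℤ.* h f)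
*-distribˡ-∑ᵗ zero    x h = ≡.refl
*-distribˡ-∑ᵗ (suc m) x h = ≡.trans (*-distribˡ-∑ᵗ m x (λ f → ℤ∑.sum λ y → h (y ∷ f)))
  (∑ᵗ-cong m λ f → ℤ∑.*-distribˡ-sum x (λ y → h (y ∷ f)))

∑ˢ-∑ᵗ-comm : ∀ {M} m (h : Subset M → Vec (Fin N) m → ℤ) →
             ∑ˢ (λ B → ∑ᵗ m (h B)) ≡ ∑ᵗ m (λ f → ∑ˢ λ B → h B f)
∑ˢ-∑ᵗ-comm {M = zero}  m h = ≡.refl
∑ˢ-∑ᵗ-comm {M = suc M} m h = ≡.trans
  (≡.cong₂ ℤ._+_ (∑ˢ-∑ᵗ-comm m (h ∘ (outside ∷_))) (∑ˢ-∑ᵗ-comm m (h ∘ (inside ∷_))))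
  (≡.sym (∑ᵗ-distrib-+ m _ _))

∑-if : {P : Pred (Fin N) p} (P? : Decidable P) (x y : ℤ) →
       ℤ∑.sum (λ i → if does (P? i) then x else y) ≡ + count P? ℤ.* x ℤ.+ (+ N ℤ.- + count P?) ℤ.* y
∑-if {zero}  P? x y = lemma x y
  where
  lemma : ∀ x y → 0ℤ ≡ 0ℤ ℤ.* x ℤ.+ (0ℤ ℤ.- 0ℤ) ℤ.* y
  lemma = ℤ-Solver.solve-∀
∑-if {suc N} P? x y = ≡.trans (≡.cong (ℤ._+_ (if does (P? zero) then x else y)) (∑-if (P? ∘ suc) x y))
  (go (does (P? zero)))
  where
  c = count (P? ∘ suc)
  go : ∀ b → (if b then x else y) ℤ.+ (+ c ℤ.* x ℤ.+ (+ N ℤ.- + c) ℤ.* y) ≡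
       + ((if b then 1 else 0) ℕ.+ c) ℤ.* x ℤ.+ (+ suc N ℤ.- + ((if b then 1 else 0) ℕ.+ c)) ℤ.* y
  go true  = lemma (+ c) (+ N) x y
    where
    lemma : ∀ c n x y → x ℤ.+ (c ℤ.* x ℤ.+ (n ℤ.- c) ℤ.* y) ≡
            (1ℤ ℤ.+ c) ℤ.* x ℤ.+ (1ℤ ℤ.+ n ℤ.- (1ℤ ℤ.+ c)) ℤ.* y
    lemma = ℤ-Solver.solve-∀
  go false = lemma (+ c) (+ N) x y
    where
    lemma : ∀ c n x y → y ℤ.+ (c ℤ.* x ℤ.+ (n ℤ.- c) ℤ.* y) ≡
            c ℤ.* x ℤ.+ (1ℤ ℤ.+ n ℤ.- c) ℤ.* y
    lemma = ℤ-Solver.solve-∀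

-- The entries are chosen independently, each among the elements of P.
∑ᵗ-all : ∀ m {P : Pred (Fin N) p} (P? : Decidable P) →
         ∑ᵗ m (λ f → + ind (VAll.all? P? f)) ≡ (+ count P?) ℤ.^ m
∑ᵗ-all zero    P? = ≡.refl
∑ᵗ-all (suc m) P? = ≡.trans
  (∑ᵗ-cong m λ f → ≡.trans (ℤ∑.sum-cong-≗ λ y → one (does (P? y)) (does (VAll.all? P? f)))
                    (≡.trans (∑-if P? (+ ind (VAll.all? P? f)) 0ℤ) (drop (+ count P?) (+ _) (+ ind (VAll.all? P? f)))))
  (≡.trans (≡.sym (*-distribˡ-∑ᵗ m (+ count P?) (λ f → + ind (VAll.all? P? f))))
           (≡.cong (+ count P? ℤ.*_) (∑ᵗ-all m P?)))
  where
  one : ∀ b c → + (if b ∧ c then 1 else 0) ≡ (if b then + (if c then 1 else 0) else 0ℤ)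
  one true  c = ≡.refl
  one false c = ≡.refl

  drop : ∀ c n x → c ℤ.* x ℤ.+ (n ℤ.- c) ℤ.* 0ℤ ≡ c ℤ.* x
  drop = ℤ-Solver.solve-∀

pos-^ : ∀ b k → + (b ℕ.^ k) ≡ (+ b) ℤ.^ k
pos-^ b zero    = ≡.refl
pos-^ b (suc k) = ≡.trans (ℤ.pos-* b (b ℕ.^ k)) (≡.cong (+ b ℤ.*_) (pos-^ b k))

*-distrib-^ : ∀ x y k → (x ℤ.* y) ℤ.^ k ≡ x ℤ.^ k ℤ.* y ℤ.^ k
*-distrib-^ x y zero    = ≡.refl
*-distrib-^ x y (suc k) = ≡.trans (≡.cong (x ℤ.* y ℤ.*_) (*-distrib-^ x y k)) (lemma x y (x ℤ.^ k) (y ℤ.^ k))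
  where
  lemma : ∀ x y z w → x ℤ.* y ℤ.* (z ℤ.* w) ≡ x ℤ.* z ℤ.* (y ℤ.* w)
  lemma = ℤ-Solver.solve-∀

-- The characteristic polynomial of a dual matroid

module _ (M : Matroid N) where

  open Matroid M
  open MatroidProperties M
  private module M* = Matroid (dual M)

  -- In integers, r*(E) - r*(E - B) = |B| - r(B). Adding r(E) turns the right side into a sum of two
  -- natural exponents; this is the power of x that the theorem has in its denominator.
  corank-∁ : ∀ B → (M*.rank ⊤ ℕ.∸ M*.rank (∁ B)) ℕ.+ rank ⊤ ≡ ∣ B ∣ ℕ.+ (rank ⊤ ℕ.∸ rank B)
  corank-∁ B = begin
    (rank (∁ ⊤) ℕ.+ ∣ ⊤ {N} ∣ ℕ.∸ ρ) ℕ.∸ (y ℕ.∸ ρ) ℕ.+ ρ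
      ≡⟨ ≡.cong (λ x → (x ℕ.∸ ρ) ℕ.∸ (y ℕ.∸ ρ) ℕ.+ ρ) (≡.cong₂ ℕ._+_ rank-∁⊤ (Subset.∣⊤∣≡n N)) ⟩
    (N ℕ.∸ ρ) ℕ.∸ (y ℕ.∸ ρ) ℕ.+ ρ
      ≡⟨ ≡.cong (ℕ._+ ρ) (ℕ.∸-+-assoc N ρ (y ℕ.∸ ρ)) ⟩
    N ℕ.∸ (ρ ℕ.+ (y ℕ.∸ ρ)) ℕ.+ ρ
      ≡⟨ ≡.cong (λ z → N ℕ.∸ z ℕ.+ ρ) (≡.trans (ℕ.m+[n∸m]≡n (rank⊤≤ (∁ B))) y≡) ⟩
    N ℕ.∸ (N ℕ.∸ ∣ B ∣ ℕ.+ rank B) ℕ.+ ρ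
      ≡⟨ ≡.cong (ℕ._+ ρ) (ℕ.∸-+-assoc N (N ℕ.∸ ∣ B ∣) (rank B)) ⟨
    N ℕ.∸ (N ℕ.∸ ∣ B ∣) ℕ.∸ rank B ℕ.+ ρ
      ≡⟨ ≡.cong (λ z → z ℕ.∸ rank B ℕ.+ ρ) (ℕ.m∸[m∸n]≡n (Subset.∣p∣≤n B)) ⟩
    ∣ B ∣ ℕ.∸ rank B ℕ.+ ρ
      ≡⟨ ≡.cong (∣ B ∣ ℕ.∸ rank B ℕ.+_) (ℕ.m+[n∸m]≡n (rank-mono (Subset.⊆-max B))) ⟨
    ∣ B ∣ ℕ.∸ rank B ℕ.+ (rank B ℕ.+ (ρ ℕ.∸ rank B))
      ≡⟨ ℕ.+-assoc (∣ B ∣ ℕ.∸ rank B) _ _ ⟨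
    ∣ B ∣ ℕ.∸ rank B ℕ.+ rank B ℕ.+ (ρ ℕ.∸ rank B)
      ≡⟨ ≡.cong (ℕ._+ (ρ ℕ.∸ rank B)) (ℕ.m∸n+n≡m (rank≤size B)) ⟩
    ∣ B ∣ ℕ.+ (ρ ℕ.∸ rank B) ∎
    where
    open ≡-Reasoning
    ρ = rank ⊤
    y = rank (∁ (∁ B)) ℕ.+ ∣ ∁ B ∣

    ∁-involutive : ∀ {n} (p : Subset n) → ∁ (∁ p) ≡ p
    ∁-involutive []            = ≡.refl
    ∁-involutive (outside ∷ p) = ≡.cong (outside ∷_) (∁-involutive p)
    ∁-involutive (inside  ∷ p) = ≡.cong (inside ∷_) (∁-involutive p)

    y≡ : y ≡ N ℕ.∸ ∣ B ∣ ℕ.+ rank B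
    y≡ = ≡.trans (≡.cong₂ ℕ._+_ (≡.cong rank (∁-involutive B)) (Subset.∣∁p∣≡n∸∣p∣ B)) (ℕ.+-comm (rank B) _)

    rank-∁⊤ : rank (∁ ⊤) ≡ 0
    rank-∁⊤ = ℕ.n≤0⇒n≡0 (ℕ.≤-trans (rank≤size (∁ ⊤)) (ℕ.≤-reflexive
      (≡.trans (Subset.∣∁p∣≡n∸∣p∣ (⊤ {N})) (≡.trans (≡.cong (N ℕ.∸_) (Subset.∣⊤∣≡n N)) (ℕ.n∸n≡0 N)))))

  eval-χ-dual : ∀ t → eval t (χ (dual M)) ℤ.* t ℤ.^ rank ⊤ ≡
                      -1ℤ ℤ.^ N ℤ.* ∑ˢ (λ B → (ℤ.- t) ℤ.^ ∣ B ∣ ℤ.* t ℤ.^ (rank ⊤ ℕ.∸ rank B))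
  eval-χ-dual t = begin
    eval t (χ (dual M)) ℤ.* t ℤ.^ rank ⊤
      ≡⟨ ≡.cong (ℤ._* t ℤ.^ rank ⊤) (≡.trans (eval-∑⊆ t term) (∑ˢ-∁ (eval t ∘ term))) ⟩
    ∑ˢ (eval t ∘ term ∘ ∁) ℤ.* t ℤ.^ rank ⊤
      ≡⟨ ℤ.*-comm (∑ˢ (eval t ∘ term ∘ ∁)) _ ⟩
    t ℤ.^ rank ⊤ ℤ.* ∑ˢ (eval t ∘ term ∘ ∁)
      ≡⟨ *-distribˡ-∑ˢ (t ℤ.^ rank ⊤) (eval t ∘ term ∘ ∁) ⟩
    ∑ˢ (λ B → t ℤ.^ rank ⊤ ℤ.* eval t (term (∁ B)))
      ≡⟨ ∑ˢ-cong summand ⟩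
    ∑ˢ (λ B → -1ℤ ℤ.^ N ℤ.* ((ℤ.- t) ℤ.^ ∣ B ∣ ℤ.* t ℤ.^ (rank ⊤ ℕ.∸ rank B)))
      ≡⟨ *-distribˡ-∑ˢ (-1ℤ ℤ.^ N) (λ B → (ℤ.- t) ℤ.^ ∣ B ∣ ℤ.* t ℤ.^ (rank ⊤ ℕ.∸ rank B)) ⟨
    -1ℤ ℤ.^ N ℤ.* ∑ˢ (λ B → (ℤ.- t) ℤ.^ ∣ B ∣ ℤ.* t ℤ.^ (rank ⊤ ℕ.∸ rank B)) ∎
    where
    open ≡-Reasoning

    term : Subset N → Poly
    term A = (- 1#) ^ ∣ A ∣ * X ^ (M*.rank ⊤ ℕ.∸ M*.rank A)

    sign-square : ∀ k → -1ℤ ℤ.^ k ℤ.* -1ℤ ℤ.^ k ≡ 1ℤ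
    sign-square k = ≡.trans (≡.sym (*-distrib-^ -1ℤ -1ℤ k)) (ℤ.^-zeroˡ k)

    summand : ∀ B → t ℤ.^ rank ⊤ ℤ.* eval t (term (∁ B)) ≡
                    -1ℤ ℤ.^ N ℤ.* ((ℤ.- t) ℤ.^ ∣ B ∣ ℤ.* t ℤ.^ (rank ⊤ ℕ.∸ rank B))
    summand B = begin
      t ℤ.^ rank ⊤ ℤ.* eval t (term (∁ B))
        ≡⟨ ≡.cong (t ℤ.^ rank ⊤ ℤ.*_) (≡.trans (eval-* t ((- 1#) ^ ∣ ∁ B ∣) (X ^ e)) (≡.cong₂ ℤ._*_
             (≡.trans (eval-^ t (- 1#) ∣ ∁ B ∣) (≡.cong (ℤ._^ ∣ ∁ B ∣) (≡.trans (eval-neg t 1#) (≡.cong ℤ.-_ (eval-C t 1ℤ)))))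
             (≡.trans (eval-^ t X e) (≡.cong (ℤ._^ e) (eval-X t))))) ⟩
      t ℤ.^ rank ⊤ ℤ.* (σ ℤ.* t ℤ.^ e)
        ≡⟨ shuffle (t ℤ.^ rank ⊤) σ (t ℤ.^ e) ⟩
      σ ℤ.* 1ℤ ℤ.* (t ℤ.^ e ℤ.* t ℤ.^ rank ⊤)
        -- The factor 1 is written as the square of (-1)^|B|: one copy completes the sign to (-1)^N,
        -- the other turns t^|B| into (-t)^|B|.
        ≡⟨ ≡.cong₂ (λ x y → σ ℤ.* x ℤ.* y) (≡.sym (sign-square ∣ B ∣))
             (≡.trans (≡.sym (ℤ.^-distribˡ-+-* t e (rank ⊤)))
             (≡.trans (≡.cong (t ℤ.^_) (corank-∁ B)) (ℤ.^-distribˡ-+-* t ∣ B ∣ (rank ⊤ ℕ.∸ rank B)))) ⟩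
      σ ℤ.* (τ ℤ.* τ) ℤ.* (t ℤ.^ ∣ B ∣ ℤ.* t ℤ.^ (rank ⊤ ℕ.∸ rank B))
        ≡⟨ regroup σ τ (t ℤ.^ ∣ B ∣) (t ℤ.^ (rank ⊤ ℕ.∸ rank B)) ⟩
      σ ℤ.* τ ℤ.* (τ ℤ.* t ℤ.^ ∣ B ∣ ℤ.* t ℤ.^ (rank ⊤ ℕ.∸ rank B))
        ≡⟨ ≡.cong₂ (λ x y → x ℤ.* (y ℤ.* t ℤ.^ (rank ⊤ ℕ.∸ rank B)))
             (≡.trans (≡.sym (ℤ.^-distribˡ-+-* -1ℤ ∣ ∁ B ∣ ∣ B ∣)) (≡.cong (-1ℤ ℤ.^_) ∣∁B∣+∣B∣))
             (≡.trans (≡.sym (*-distrib-^ -1ℤ t ∣ B ∣)) (≡.cong (ℤ._^ ∣ B ∣) (ℤ.-1*i≡-i t))) ⟩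
      -1ℤ ℤ.^ N ℤ.* ((ℤ.- t) ℤ.^ ∣ B ∣ ℤ.* t ℤ.^ (rank ⊤ ℕ.∸ rank B)) ∎
      where
      e = M*.rank ⊤ ℕ.∸ M*.rank (∁ B)
      σ = -1ℤ ℤ.^ ∣ ∁ B ∣
      τ = -1ℤ ℤ.^ ∣ B ∣

      ∣∁B∣+∣B∣ : ∣ ∁ B ∣ ℕ.+ ∣ B ∣ ≡ N
      ∣∁B∣+∣B∣ = ≡.trans (≡.cong (ℕ._+ ∣ B ∣) (Subset.∣∁p∣≡n∸∣p∣ B)) (ℕ.m∸n+n≡m (Subset.∣p∣≤n B))

      shuffle : ∀ x s y → x ℤ.* (s ℤ.* y) ≡ s ℤ.* 1ℤ ℤ.* (y ℤ.* x)
      shuffle = ℤ-Solver.solve-∀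

      regroup : ∀ s t x y → s ℤ.* (t ℤ.* t) ℤ.* (x ℤ.* y) ≡ s ℤ.* t ℤ.* (t ℤ.* x ℤ.* y)
      regroup = ℤ-Solver.solve-∀

-- Gaussian coefficients

module _ (q : ℕ) .{{_ : NonTrivial q}} where

  gaussian*falling : ∀ n k → gaussian q n k ℕ.* falling q k k ≡ falling q n k
  gaussian*falling n k = ℕ.m/n*n≡m {{falling-nonZero q k}} (falling[k,k]∣falling[n,k] q n k)

  gaussian[n,n]≡1 : ∀ n → gaussian q n n ≡ 1
  gaussian[n,n]≡1 n = ℕ.n/n≡1 (falling q n n) {{falling-nonZero q n}}

  gaussian[n,1+n]≡0 : ∀ n → gaussian q n (suc n) ≡ 0
  gaussian[n,1+n]≡0 n = ≡.trans
    (≡.cong (λ x → ℕ._/_ x (falling q (suc n) (suc n)) {{falling-nonZero q (suc n)}}) (n<k⇒falling≡0 q {n} ℕ.≤-refl))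
    (ℕ.0/n≡0 (falling q (suc n) (suc n)) {{falling-nonZero q (suc n)}})

  -- The ratio of neighbouring coefficients, cross-multiplied; it is the relation between
  -- coefficients on which `combine-<` rests, in place of a Pascal rule.
  gaussian-suc : ∀ n k → gaussian q n (suc k) ℕ.* (q ℕ.^ suc k ∸ 1) ≡ gaussian q n k ℕ.* (q ℕ.^ (n ∸ k) ∸ 1)
  gaussian-suc n k = ℕ.*-cancelʳ-≡ _ _ (falling q k k) {{falling-nonZero q k}} (begin
    gaussian q n (suc k) ℕ.* (q ℕ.^ suc k ∸ 1) ℕ.* falling q k k
      ≡⟨ ℕ.*-assoc (gaussian q n (suc k)) _ _ ⟩
    gaussian q n (suc k) ℕ.* falling q (suc k) (suc k)
      ≡⟨ gaussian*falling n (suc k) ⟩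
    falling q n (suc k)
      ≡⟨ falling-suc q n k ⟩
    falling q n k ℕ.* d
      ≡⟨ ≡.cong (ℕ._* d) (gaussian*falling n k) ⟨
    gaussian q n k ℕ.* falling q k k ℕ.* d
      ≡⟨ ℕ.*-assoc (gaussian q n k) _ _ ⟩
    gaussian q n k ℕ.* (falling q k k ℕ.* d)
      ≡⟨ ≡.cong (gaussian q n k ℕ.*_) (ℕ.*-comm (falling q k k) d) ⟩
    gaussian q n k ℕ.* (d ℕ.* falling q k k)
      ≡⟨ ℕ.*-assoc (gaussian q n k) _ _ ⟨
    gaussian q n k ℕ.* d ℕ.* falling q k k ∎)
    where
    open ≡-Reasoning
    d = q ℕ.^ (n ∸ k) ∸ 1

  q^k≢0 : ∀ k → NonZero (q ℕ.^ k)
  q^k≢0 k = ℕ.m^n≢0 q k {{ℕ.nonTrivial⇒nonZero q}}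

  qPow : ℕ → ℤ
  qPow k = + (q ℕ.^ k)

  qPow-+ : ∀ j k → qPow (j ℕ.+ k) ≡ qPow j ℤ.* qPow k
  qPow-+ j k = ≡.trans (≡.cong +_ (ℕ.^-distribˡ-+-* q j k)) (ℤ.pos-* (q ℕ.^ j) (q ℕ.^ k))

  pos-q^k∸1 : ∀ k → + (q ℕ.^ k ∸ 1) ≡ qPow k ℤ.- 1ℤ
  pos-q^k∸1 k = ≡.trans (≡.sym (ℤ.⊖-≥ (ℕ.>-nonZero⁻¹ _ {{q^k≢0 k}}))) (≡.sym (ℤ.m-n≡m⊖n (q ℕ.^ k) 1))

  gaussian-sucℤ : ∀ n k → + gaussian q n (suc k) ℤ.* (qPow (suc k) ℤ.- 1ℤ) ≡
                          + gaussian q n k ℤ.* (qPow (n ∸ k) ℤ.- 1ℤ)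
  gaussian-sucℤ n k = begin
    + gaussian q n (suc k) ℤ.* (qPow (suc k) ℤ.- 1ℤ)    ≡⟨ ≡.cong (+ gaussian q n (suc k) ℤ.*_) (pos-q^k∸1 (suc k)) ⟨
    + gaussian q n (suc k) ℤ.* + (q ℕ.^ suc k ∸ 1)      ≡⟨ ℤ.pos-* (gaussian q n (suc k)) _ ⟨
    + (gaussian q n (suc k) ℕ.* (q ℕ.^ suc k ∸ 1))      ≡⟨ ≡.cong +_ (gaussian-suc n k) ⟩
    + (gaussian q n k ℕ.* (q ℕ.^ (n ∸ k) ∸ 1))          ≡⟨ ℤ.pos-* (gaussian q n k) _ ⟩
    + gaussian q n k ℤ.* + (q ℕ.^ (n ∸ k) ∸ 1)          ≡⟨ ≡.cong (+ gaussian q n k ℤ.*_) (pos-q^k∸1 (n ∸ k)) ⟩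
    + gaussian q n k ℤ.* (qPow (n ∸ k) ℤ.- 1ℤ)          ∎
    where open ≡-Reasoning

  -- At x = q^m this is the number of linearly independent j-tuples in F^m, each new vector avoiding
  -- the span of the earlier ones.
  qFactorial : ℤ → ℕ → ℤ
  qFactorial x zero    = 1ℤ
  qFactorial x (suc j) = qFactorial x j ℤ.* (x ℤ.- qPow j)

  -- For i ≥ 1 the factor q x - q^i is q (x - q^(i-1)); the factor for i = 0 stays in front.
  qFactorial-dilate : ∀ x j → qFactorial (+ q ℤ.* x) (suc j) ≡ (+ q ℤ.* x ℤ.- 1ℤ) ℤ.* qPow j ℤ.* qFactorial x j
  qFactorial-dilate x zero    = lemma (+ q ℤ.* x)
    where
    lemma : ∀ y → 1ℤ ℤ.* (y ℤ.- 1ℤ) ≡ (y ℤ.- 1ℤ) ℤ.* 1ℤ ℤ.* 1ℤ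
    lemma = ℤ-Solver.solve-∀
  qFactorial-dilate x (suc j) = begin
    qFactorial (+ q ℤ.* x) (suc j) ℤ.* (+ q ℤ.* x ℤ.- qPow (suc j))
      ≡⟨ ≡.cong₂ (λ a b → a ℤ.* (+ q ℤ.* x ℤ.- b)) (qFactorial-dilate x j) qPow-suc ⟩
    (+ q ℤ.* x ℤ.- 1ℤ) ℤ.* qPow j ℤ.* qFactorial x j ℤ.* (+ q ℤ.* x ℤ.- + q ℤ.* qPow j)
      ≡⟨ lemma (+ q) x (qPow j) (qFactorial x j) ⟩
    (+ q ℤ.* x ℤ.- 1ℤ) ℤ.* (+ q ℤ.* qPow j) ℤ.* (qFactorial x j ℤ.* (x ℤ.- qPow j))
      ≡⟨ ≡.cong (λ b → (+ q ℤ.* x ℤ.- 1ℤ) ℤ.* b ℤ.* (qFactorial x j ℤ.* (x ℤ.- qPow j))) qPow-suc ⟨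
    (+ q ℤ.* x ℤ.- 1ℤ) ℤ.* qPow (suc j) ℤ.* qFactorial x (suc j) ∎
    where
    open ≡-Reasoning
    qPow-suc : qPow (suc j) ≡ + q ℤ.* qPow j
    qPow-suc = ℤ.pos-* q (q ℕ.^ j)
    lemma : ∀ q x c f → (q ℤ.* x ℤ.- 1ℤ) ℤ.* c ℤ.* f ℤ.* (q ℤ.* x ℤ.- q ℤ.* c) ≡
                        (q ℤ.* x ℤ.- 1ℤ) ℤ.* (q ℤ.* c) ℤ.* (f ℤ.* (x ℤ.- c))
    lemma = ℤ-Solver.solve-∀

  -- For x = qᵐ this is the sum of h (dim ⋂ᵢ ker fᵢ) over all m-tuples f of functionals.
  kernelSum : ℕ → ℤ → (ℕ → ℤ) → ℤ
  kernelSum n x h = ℤ∑.sum {suc n} λ k → + gaussian q n (toℕ k) ℤ.* h (toℕ k) ℤ.* qFactorial x (n ∸ toℕ k)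

  ∑-telescope : ∀ N (b : ℕ → ℤ) → ℤ∑.sum {N} (b ∘ toℕ) ℤ.+ b N ≡ b 0 ℤ.+ ℤ∑.sum {N} (b ∘ suc ∘ toℕ)
  ∑-telescope zero    b = ℤ.+-comm 0ℤ (b 0)
  ∑-telescope (suc N) b = ≡.trans (ℤ.+-assoc (b 0) _ _) (≡.cong (ℤ._+_ (b 0)) (∑-telescope N (b ∘ suc)))

  ∑-cong-toℕ : ∀ N {a b : ℕ → ℤ} → (∀ k → k ℕ.< N → a k ≡ b k) → ℤ∑.sum {N} (a ∘ toℕ) ≡ ℤ∑.sum {N} (b ∘ toℕ)
  ∑-cong-toℕ N eq = ℤ∑.sum-cong-≗ λ k → eq (toℕ k) (Fin.toℕ<n k)

  -- At x = 1 every nonempty product contains the factor 1 - q^0 = 0, so only k = n survives. This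
  -- is the case of the empty tuple, whose kernel is the whole space.
  kernelSum-1 : ∀ n h → kernelSum n 1ℤ h ≡ h n
  kernelSum-1 n h = begin
    kernelSum n 1ℤ h
      ≡⟨ ℤ∑.sum-init-last {n} (term ∘ toℕ) ⟩
    ℤ∑.sum {n} (term ∘ toℕ ∘ Fin.inject₁) ℤ.+ term (toℕ (Fin.fromℕ n))
      ≡⟨ ≡.cong₂ ℤ._+_
           (≡.trans (ℤ∑.sum-cong-≗ λ k → ≡.trans (≡.cong term (Fin.toℕ-inject₁ k)) (term-< (Fin.toℕ<n k)))
                    (ℤ∑.sum-replicate-zero n))
           (≡.cong term (Fin.toℕ-fromℕ n)) ⟩
    0ℤ ℤ.+ term n
      ≡⟨ ℤ.+-identityˡ (term n) ⟩
    term n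
      ≡⟨ ≡.cong₂ (λ g j → + g ℤ.* h n ℤ.* qFactorial 1ℤ j) (gaussian[n,n]≡1 n) (ℕ.n∸n≡0 n) ⟩
    1ℤ ℤ.* h n ℤ.* 1ℤ
      ≡⟨ ≡.trans (ℤ.*-identityʳ _) (ℤ.*-identityˡ (h n)) ⟩
    h n ∎
    where
    open ≡-Reasoning

    term : ℕ → ℤ
    term k = + gaussian q n k ℤ.* h k ℤ.* qFactorial 1ℤ (n ∸ k)

    qFactorial-1 : ∀ j → qFactorial 1ℤ (suc j) ≡ 0ℤ
    qFactorial-1 zero    = ≡.refl
    qFactorial-1 (suc j) = ≡.cong (ℤ._* (1ℤ ℤ.- qPow (suc j))) (qFactorial-1 j)

    term-< : ∀ {k} → k ℕ.< n → term k ≡ 0ℤ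
    term-< {k} k<n = ≡.trans
      (≡.cong (+ gaussian q n k ℤ.* h k ℤ.*_)
        (≡.trans (≡.cong (qFactorial 1ℤ) (ℕ.+-∸-assoc 1 k<n)) (qFactorial-1 (n ∸ suc k))))
      (ℤ.*-zeroʳ (+ gaussian q n k ℤ.* h k))

  -- Of the qⁿ functionals, qⁿ⁻ᵏ contain a given k-dimensional kernel; each of the others
  -- cuts it down to dimension k − 1.
  refine : ℕ → (ℕ → ℤ) → ℕ → ℤ
  refine n h k = qPow (n ∸ k) ℤ.* h k ℤ.+ (qPow n ℤ.- qPow (n ∸ k)) ℤ.* h (ℕ.pred k)

  -- Compare the coefficients of h k: on the left it arises from kernels of dimension k that are
  -- kept and from kernels of dimension k + 1 that are cut. Shifting the index of the second kind
  -- aligns the two.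
  kernelSum-refine : ∀ n x h → kernelSum n x (refine n h) ≡ kernelSum n (+ q ℤ.* x) h
  kernelSum-refine n x h = begin
    kernelSum n x (refine n h)
      ≡⟨ ∑-cong-toℕ (suc n) (λ k _ → expand (+ gaussian q n k) (qPow (n ∸ k)) (h k) (qPow n) (h (ℕ.pred k)) (qFactorial x (n ∸ k))) ⟩
    ℤ∑.sum {suc n} (λ k → same (toℕ k) ℤ.+ drop (toℕ k))
      ≡⟨ ℤ∑.∑-distrib-+ {suc n} (same ∘ toℕ) (drop ∘ toℕ) ⟩
    ℤ∑.sum {suc n} (same ∘ toℕ) ℤ.+ ℤ∑.sum {suc n} (drop ∘ toℕ)
      ≡⟨ ≡.cong (ℤ._+_ (ℤ∑.sum {suc n} (same ∘ toℕ))) shift ⟩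
    ℤ∑.sum {suc n} (same ∘ toℕ) ℤ.+ ℤ∑.sum {suc n} (drop ∘ suc ∘ toℕ)
      ≡⟨ ℤ∑.∑-distrib-+ {suc n} (same ∘ toℕ) (drop ∘ suc ∘ toℕ) ⟨
    ℤ∑.sum {suc n} (λ k → same (toℕ k) ℤ.+ drop (suc (toℕ k)))
      ≡⟨ ∑-cong-toℕ (suc n) (λ k k≤n → combine k (ℕ.≤-pred k≤n)) ⟩
    kernelSum n (+ q ℤ.* x) h ∎
    where
    open ≡-Reasoning

    same drop : ℕ → ℤ
    same k = + gaussian q n k ℤ.* qPow (n ∸ k) ℤ.* h k ℤ.* qFactorial x (n ∸ k)
    drop k = + gaussian q n k ℤ.* (qPow n ℤ.- qPow (n ∸ k)) ℤ.* h (ℕ.pred k) ℤ.* qFactorial x (n ∸ k)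

    expand : ∀ g c h d h′ f → g ℤ.* (c ℤ.* h ℤ.+ (d ℤ.- c) ℤ.* h′) ℤ.* f ≡
                              g ℤ.* c ℤ.* h ℤ.* f ℤ.+ g ℤ.* (d ℤ.- c) ℤ.* h′ ℤ.* f
    expand = ℤ-Solver.solve-∀

    -- The default `pred 0` is harmless, since its coefficient q^n - q^(n-0) vanishes.
    drop-0 : drop 0 ≡ 0ℤ
    drop-0 = lemma (+ gaussian q n 0) (qPow n) (h 0) (qFactorial x n)
      where
      lemma : ∀ g c h f → g ℤ.* (c ℤ.- c) ℤ.* h ℤ.* f ≡ 0ℤ
      lemma = ℤ-Solver.solve-∀

    drop-1+n : drop (suc n) ≡ 0ℤ
    drop-1+n = ≡.cong (λ g → + g ℤ.* (qPow n ℤ.- qPow (n ∸ suc n)) ℤ.* h n ℤ.* qFactorial x (n ∸ suc n)) (gaussian[n,1+n]≡0 n)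

    shift : ℤ∑.sum {suc n} (drop ∘ toℕ) ≡ ℤ∑.sum {suc n} (drop ∘ suc ∘ toℕ)
    shift = ≡.trans (≡.sym (ℤ.+-identityʳ _)) (≡.trans (≡.cong (ℤ._+_ (ℤ∑.sum {suc n} (drop ∘ toℕ))) (≡.sym drop-1+n))
      (≡.trans (∑-telescope (suc n) drop) (≡.trans (≡.cong (ℤ._+ ℤ∑.sum {suc n} (drop ∘ suc ∘ toℕ)) drop-0) (ℤ.+-identityˡ _))))

    -- After `gaussian-sucℤ` both terms carry the same Gaussian coefficient, and with c = q^j the
    -- rest is q c (x - c) + (q c - 1) c = (q x - 1) c. Passing j with equations keeps truncated
    -- subtraction out of the algebra.
    combine-< : ∀ j k → n ≡ suc k ℕ.+ j → n ∸ k ≡ suc j → n ∸ suc k ≡ j →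
                same k ℤ.+ drop (suc k) ≡ + gaussian q n k ℤ.* h k ℤ.* qFactorial (+ q ℤ.* x) (n ∸ k)
    combine-< j k n≡ n∸k≡ n∸1+k≡ = begin
      same k ℤ.+ drop (suc k)
        ≡⟨ ≡.cong₂ (λ u v → g ℤ.* qPow u ℤ.* h k ℤ.* qFactorial x u ℤ.+
                            g′ ℤ.* (qPow n ℤ.- qPow v) ℤ.* h k ℤ.* qFactorial x v) n∸k≡ n∸1+k≡ ⟩
      g ℤ.* qPow (suc j) ℤ.* h k ℤ.* (f ℤ.* (x ℤ.- c)) ℤ.+ g′ ℤ.* (qPow n ℤ.- c) ℤ.* h k ℤ.* f
        ≡⟨ ≡.cong (λ u → g ℤ.* qPow (suc j) ℤ.* h k ℤ.* (f ℤ.* (x ℤ.- c)) ℤ.+ g′ ℤ.* (u ℤ.- c) ℤ.* h k ℤ.* f)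
             (≡.trans (≡.cong qPow n≡) (qPow-+ (suc k) j)) ⟩
      g ℤ.* qPow (suc j) ℤ.* h k ℤ.* (f ℤ.* (x ℤ.- c)) ℤ.+ g′ ℤ.* (qPow (suc k) ℤ.* c ℤ.- c) ℤ.* h k ℤ.* f
        ≡⟨ regroup g g′ (qPow (suc j)) (qPow (suc k)) c (h k) f x ⟩
      g ℤ.* qPow (suc j) ℤ.* h k ℤ.* (f ℤ.* (x ℤ.- c)) ℤ.+ g′ ℤ.* (qPow (suc k) ℤ.- 1ℤ) ℤ.* (c ℤ.* h k ℤ.* f)
        ≡⟨ ≡.cong₂ (λ u v → g ℤ.* u ℤ.* h k ℤ.* (f ℤ.* (x ℤ.- c)) ℤ.+ v ℤ.* (c ℤ.* h k ℤ.* f)) (ℤ.pos-* q (q ℕ.^ j))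
             (≡.trans (gaussian-sucℤ n k) (≡.cong (λ u → g ℤ.* (u ℤ.- 1ℤ)) (≡.trans (≡.cong qPow n∸k≡) (ℤ.pos-* q (q ℕ.^ j))))) ⟩
      g ℤ.* (+ q ℤ.* c) ℤ.* h k ℤ.* (f ℤ.* (x ℤ.- c)) ℤ.+ g ℤ.* (+ q ℤ.* c ℤ.- 1ℤ) ℤ.* (c ℤ.* h k ℤ.* f)
        ≡⟨ collect g (+ q) c (h k) f x ⟩
      g ℤ.* h k ℤ.* ((+ q ℤ.* x ℤ.- 1ℤ) ℤ.* c ℤ.* f)
        ≡⟨ ≡.cong (g ℤ.* h k ℤ.*_) (qFactorial-dilate x j) ⟨
      g ℤ.* h k ℤ.* qFactorial (+ q ℤ.* x) (suc j)
        ≡⟨ ≡.cong (λ u → g ℤ.* h k ℤ.* qFactorial (+ q ℤ.* x) u) n∸k≡ ⟨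
      g ℤ.* h k ℤ.* qFactorial (+ q ℤ.* x) (n ∸ k) ∎
      where
      g  = + gaussian q n k
      g′ = + gaussian q n (suc k)
      c  = qPow j
      f  = qFactorial x j

      regroup : ∀ g g′ a b c h f x →
        g ℤ.* a ℤ.* h ℤ.* (f ℤ.* (x ℤ.- c)) ℤ.+ g′ ℤ.* (b ℤ.* c ℤ.- c) ℤ.* h ℤ.* f ≡
        g ℤ.* a ℤ.* h ℤ.* (f ℤ.* (x ℤ.- c)) ℤ.+ g′ ℤ.* (b ℤ.- 1ℤ) ℤ.* (c ℤ.* h ℤ.* f)
      regroup = ℤ-Solver.solve-∀

      collect : ∀ g q c h f x →
        g ℤ.* (q ℤ.* c) ℤ.* h ℤ.* (f ℤ.* (x ℤ.- c)) ℤ.+ g ℤ.* (q ℤ.* c ℤ.- 1ℤ) ℤ.* (c ℤ.* h ℤ.* f) ≡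
        g ℤ.* h ℤ.* ((q ℤ.* x ℤ.- 1ℤ) ℤ.* c ℤ.* f)
      collect = ℤ-Solver.solve-∀

    combine : ∀ k → k ℕ.≤ n → same k ℤ.+ drop (suc k) ≡ + gaussian q n k ℤ.* h k ℤ.* qFactorial (+ q ℤ.* x) (n ∸ k)
    combine k k≤n with ℕ.m≤n⇒m<n∨m≡n k≤n
    ... | inj₁ k<n    = combine-< (n ∸ suc k) k (≡.sym (ℕ.m+[n∸m]≡n k<n)) (ℕ.+-∸-assoc 1 k<n) ≡.refl
    -- At k = n nothing can be cut from dimension n + 1, and all products are empty.
    ... | inj₂ ≡.refl = begin
      same n ℤ.+ drop (suc n)
        ≡⟨ ≡.cong₂ ℤ._+_ (≡.cong (λ u → + gaussian q n n ℤ.* qPow u ℤ.* h n ℤ.* qFactorial x u) (ℕ.n∸n≡0 n)) drop-1+n ⟩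
      + gaussian q n n ℤ.* 1ℤ ℤ.* h n ℤ.* 1ℤ ℤ.+ 0ℤ
        ≡⟨ lemma (+ gaussian q n n) (h n) ⟩
      + gaussian q n n ℤ.* h n ℤ.* 1ℤ
        ≡⟨ ≡.cong (λ u → + gaussian q n n ℤ.* h n ℤ.* qFactorial (+ q ℤ.* x) u) (ℕ.n∸n≡0 n) ⟨
      + gaussian q n n ℤ.* h n ℤ.* qFactorial (+ q ℤ.* x) (n ∸ n) ∎
      where
      lemma : ∀ g h → g ℤ.* 1ℤ ℤ.* h ℤ.* 1ℤ ℤ.+ 0ℤ ≡ g ℤ.* h ℤ.* 1ℤ
      lemma = ℤ-Solver.solve-∀

-- Kernels of tuples of functionals

module _ {c ℓ} {q : ℕ} {{_ : NonTrivial q}} (F : FiniteField c ℓ q) (n : ℕ) where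

  open Orthogonality F n
  open Matroid PG[ n -1, F ] using (rank)
  open ProjectiveSpace F n using (∣points∣)

  annihilators-Ker : (f : Vec (Fin (q ℕ.^ n)) m) → annihilators (Ker f) ≡ q ℕ.^ (n ∸ kerDim f)
  annihilators-Ker f = ℕ.*-cancelʳ-≡ _ _ (q ℕ.^ k) {{q^k≢0 q k}} (begin
    annihilators (Ker f) ℕ.* q ℕ.^ k              ≡⟨ ≡.cong (annihilators (Ker f) ℕ.*_) (size-Ker f) ⟨
    annihilators (Ker f) ℕ.* Subspace.size (Ker f) ≡⟨ annihilators*size (Ker f) ⟩
    q ℕ.^ n                                        ≡⟨ ≡.cong (q ℕ.^_) (ℕ.m∸n+n≡m (kerDim≤n f)) ⟨
    q ℕ.^ (n ∸ k ℕ.+ k)                            ≡⟨ ℕ.^-distribˡ-+-* q (n ∸ k) k ⟩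
    q ℕ.^ (n ∸ k) ℕ.* q ℕ.^ k                      ∎)
    where
    open ≡-Reasoning
    k = kerDim f

  pointCount-Ker : (f : Vec (Fin (q ℕ.^ n)) m) → pointCount (Ker f) ≡ qNumber q (kerDim f)
  pointCount-Ker f = begin
    pointCount (Ker f)                                      ≡⟨ ℕ.m*n/n≡m (pointCount (Ker f)) (q ∸ 1) ⟨
    pointCount (Ker f) ℕ.* (q ∸ 1) ℕ./ (q ∸ 1)              ≡⟨ ≡.cong (λ z → pointCount (Ker f) ℕ.* (z ∸ 1) ℕ./ (q ∸ 1)) 1+units≡q ⟨
    pointCount (Ker f) ℕ.* units ℕ./ (q ∸ 1)                ≡⟨ ≡.cong (λ z → (z ∸ 1) ℕ./ (q ∸ 1)) (pointCount*units (Ker f)) ⟩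
    (Subspace.size (Ker f) ∸ 1) ℕ./ (q ∸ 1)                 ≡⟨ ≡.cong (λ z → (z ∸ 1) ℕ./ (q ∸ 1)) (size-Ker f) ⟩
    qNumber q (kerDim f)                                    ∎
    where
    open ≡-Reasoning
    instance _ = q∸1-nonZero q

  -- The empty tuple has the whole space as kernel, so all points are counted.
  ∣points∣≡qNumber : ∣points∣ ≡ qNumber q n
  ∣points∣≡qNumber = ≡.trans (≡.sym (count-all (λ i → Subspace.member? (Ker []) (pt i)) λ _ → []))
                             (pointCount-Ker [])

  -- The induction needs all h at once: summing over the head functional replaces h by
  -- `refine q n h`, and `kernelSum-refine` trades that for the passage from q^m to q^(m+1).
  ∑ᵗ-kerDim : ∀ m h → ∑ᵗ m (h ∘ kerDim) ≡ kernelSum q n (qPow q m) h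
  ∑ᵗ-kerDim zero    h = ≡.sym (kernelSum-1 q n h)
  ∑ᵗ-kerDim (suc m) h = begin
    ∑ᵗ m (λ f → ℤ∑.sum λ y → h (kerDim (y ∷ f)))    ≡⟨ ∑ᵗ-cong m fibre ⟩
    ∑ᵗ m (refine q n h ∘ kerDim)                    ≡⟨ ∑ᵗ-kerDim m (refine q n h) ⟩
    kernelSum q n (qPow q m) (refine q n h)         ≡⟨ kernelSum-refine q n (qPow q m) h ⟩
    kernelSum q n (+ q ℤ.* qPow q m) h              ≡⟨ ≡.cong (λ x → kernelSum q n x h) (ℤ.pos-* q (q ℕ.^ m)) ⟨
    kernelSum q n (qPow q (suc m)) h                ∎
    where
    open ≡-Reasoning

    fibre : ∀ f → ℤ∑.sum (λ y → h (kerDim (y ∷ f))) ≡ refine q n h (kerDim f)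
    fibre f = begin
      ℤ∑.sum (λ y → h (kerDim (y ∷ f)))
        ≡⟨ ℤ∑.sum-cong-≗ (λ y → Bool.if-float h (does (ann? y))) ⟩
      ℤ∑.sum (λ y → if does (ann? y) then h k else h (ℕ.pred k))
        ≡⟨ ∑-if ann? (h k) (h (ℕ.pred k)) ⟩
      + annihilators (Ker f) ℤ.* h k ℤ.+ (qPow q n ℤ.- + annihilators (Ker f)) ℤ.* h (ℕ.pred k)
        ≡⟨ ≡.cong (λ a → + a ℤ.* h k ℤ.+ (qPow q n ℤ.- + a) ℤ.* h (ℕ.pred k)) (annihilators-Ker f) ⟩
      refine q n h k ∎
      where
      k    = kerDim f
      ann? = annihilates? (Ker f) ∘ vec

  -- (qᵐ)ⁿ⁻ʳ⁽ᴮ⁾ is the number of m-tuples of functionals vanishing on B; interchange the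
  -- sum over B with the sum over these tuples.
  ∑ˢ-rank : ∀ s m → ∑ˢ (λ B → s ℤ.^ ∣ B ∣ ℤ.* qPow q m ℤ.^ (n ∸ rank B)) ≡
                    kernelSum q n (qPow q m) (λ k → (1ℤ ℤ.+ s) ℤ.^ qNumber q k)
  ∑ˢ-rank s m = begin
    ∑ˢ (λ B → s ℤ.^ ∣ B ∣ ℤ.* qPow q m ℤ.^ (n ∸ rank B))
      ≡⟨ ∑ˢ-cong (λ B → ≡.trans (≡.cong (s ℤ.^ ∣ B ∣ ℤ.*_) (tuples B)) (*-distribˡ-∑ᵗ m (s ℤ.^ ∣ B ∣) (vanish B))) ⟩
    ∑ˢ (λ B → ∑ᵗ m λ f → s ℤ.^ ∣ B ∣ ℤ.* vanish B f)
      ≡⟨ ∑ˢ-∑ᵗ-comm m (λ B f → s ℤ.^ ∣ B ∣ ℤ.* vanish B f) ⟩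
    ∑ᵗ m (λ f → ∑ˢ λ B → s ℤ.^ ∣ B ∣ ℤ.* vanish B f)
      ≡⟨ ∑ᵗ-cong m (λ f → ≡.trans (∑ˢ-cong λ B → ≡.cong (λ z → s ℤ.^ ∣ B ∣ ℤ.* + z) (in-kernel f B))
           (∑ˢ-⊆ s (λ i → Subspace.member? (Ker f) (pt i)) (⊆Ker? f))) ⟩
    ∑ᵗ m (λ f → (1ℤ ℤ.+ s) ℤ.^ pointCount (Ker f))
      ≡⟨ ∑ᵗ-cong m (λ f → ≡.cong ((1ℤ ℤ.+ s) ℤ.^_) (pointCount-Ker f)) ⟩
    ∑ᵗ m (λ f → (1ℤ ℤ.+ s) ℤ.^ qNumber q (kerDim f))
      ≡⟨ ∑ᵗ-kerDim m (λ k → (1ℤ ℤ.+ s) ℤ.^ qNumber q k) ⟩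
    kernelSum q n (qPow q m) (λ k → (1ℤ ℤ.+ s) ℤ.^ qNumber q k) ∎
    where
    open ≡-Reasoning

    vanish : Subset ∣points∣ → Vec (Fin (q ℕ.^ n)) m → ℤ
    vanish B f = + ind (VAll.all? (vanishesOn? B ∘ vec) f)

    ⊆Ker? : (f : Vec (Fin (q ℕ.^ n)) m) → ∀ B → Dec (∀ i → i ∈ B → Subspace.⟨_⟩ (Ker f) (pt i))
    ⊆Ker? f B = Fin.all? λ i → (i Subset.∈? B) →-dec Subspace.member? (Ker f) (pt i)

    -- Two universal quantifiers are exchanged: every functional vanishes on all of B exactly when
    -- every point of B lies in the common kernel.
    in-kernel : ∀ f B → ind (VAll.all? (vanishesOn? B ∘ vec) f) ≡ ind (⊆Ker? f B)
    in-kernel f B = ind-cong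
      (λ all i i∈B → VAll.map (λ y⊥B → y⊥B i i∈B) all)
      (λ ⊆Ker → transpose f ⊆Ker)
      (VAll.all? (vanishesOn? B ∘ vec) f) (⊆Ker? f B)
      where
      transpose : ∀ {m} (f : Vec (Fin (q ℕ.^ n)) m) → (∀ i → i ∈ B → Subspace.⟨_⟩ (Ker f) (pt i)) →
                  VAll (VanishesOn B ∘ vec) f
      transpose []      ⊆Ker = []
      transpose (y ∷ f) ⊆Ker = (λ i i∈B → VAll.head (⊆Ker i i∈B)) ∷ transpose f (λ i i∈B → VAll.tail (⊆Ker i i∈B))

    tuples : ∀ B → qPow q m ℤ.^ (n ∸ rank B) ≡ ∑ᵗ m (vanish B)
    tuples B = begin
      qPow q m ℤ.^ e                                ≡⟨ pos-^ (q ℕ.^ m) e ⟨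
      -- Exchanging the exponents turns a power of x = q^m into the m-th power of the number of
      -- functionals vanishing on B.
      + ((q ℕ.^ m) ℕ.^ e)                           ≡⟨ ≡.cong +_ (≡.trans (ℕ.^-*-assoc q m e)
                                                         (≡.trans (≡.cong (q ℕ.^_) (ℕ.*-comm m e)) (≡.sym (ℕ.^-*-assoc q e m)))) ⟩
      + ((q ℕ.^ e) ℕ.^ m)                           ≡⟨ ≡.cong (λ z → + (z ℕ.^ m)) (count-vanishesOn B) ⟨
      + (count (vanishesOn? B ∘ vec) ℕ.^ m)         ≡⟨ pos-^ (count (vanishesOn? B ∘ vec)) m ⟩
      (+ count (vanishesOn? B ∘ vec)) ℤ.^ m         ≡⟨ ∑ᵗ-all m (vanishesOn? B ∘ vec) ⟨
      ∑ᵗ m (vanish B)                               ∎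
      where e = n ∸ rank B

-- Evaluation of the formula and conclusion

eval-product : ∀ t {k} (f : Vector Poly k) → eval t (∏[ i < k ] f i) ≡ ℤ∏.sum (eval t ∘ f)
eval-product t {zero}  f = eval-C t 1ℤ
eval-product t {suc k} f = ≡.trans (eval-* t (f zero) _) (≡.cong (eval t (f zero) ℤ.*_) (eval-product t (f ∘ suc)))

-- The product unfolds at its first factor and `qFactorial` at its last, hence the splitting off of
-- the final index.
eval-qFactorial : ∀ q {{_ : NonTrivial q}} t j → eval t (∏[ i < j ] (X - C (+ (q ℕ.^ toℕ i)))) ≡ qFactorial q t j
eval-qFactorial q t j = ≡.trans (eval-product t {j} (λ i → X - C (+ (q ℕ.^ toℕ i))))
  (≡.trans (ℤ∏.sum-cong-≗ {j} λ i → ≡.trans (eval-sub t X (C (+ (q ℕ.^ toℕ i))))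
    (≡.cong₂ ℤ._-_ (eval-X t) (eval-C t (+ (q ℕ.^ toℕ i))))) (go j))
  where
  go : ∀ j → ℤ∏.sum {j} (λ i → t ℤ.- qPow q (toℕ i)) ≡ qFactorial q t j
  go zero    = ≡.refl
  go (suc j) = ≡.trans (ℤ∏.sum-init-last {j} (λ i → t ℤ.- qPow q (toℕ i))) (≡.cong₂ ℤ._*_
    (≡.trans (ℤ∏.sum-cong-≗ {j} λ i → ≡.cong (λ k → t ℤ.- qPow q k) (Fin.toℕ-inject₁ i)) (go j))
    (≡.cong (λ k → t ℤ.- qPow q k) (Fin.toℕ-fromℕ j)))

theorem4 : ∀ {c ℓ : Level} (q : ℕ) {{_ : PrimePower q}} (F : FiniteField c ℓ q)
    (n : ℕ) {{_ : NonZero n}} →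
    ⟦ χ (dual PG[ n -1, F ]) ⟧ ≈ᴸ
    ((- 1#) ^ qNumber q n /X^ n) *ᴸ
    ⟦ ∑[ k ≤ n ] (C (+ gaussian q n (toℕ k)) * (1# - X) ^ qNumber q (toℕ k) *
    ∏[ i < n ∸ toℕ k ] (X - C (+ (q ℕ.^ toℕ i)))) ⟧
theorem4 q F n = cross (eval-injective q (ℕ.nonTrivial⇒n>1 q) _ _ λ m → at (qPow q m) m ≡.refl)
  where
  open ≡-Reasoning
  open Matroid PG[ n -1, F ] using (rank)
  open Orthogonality F n using (rank-⊤)

  sign = (- 1#) ^ qNumber q n

  summand : Fin (suc n) → Poly
  summand k = C (+ gaussian q n (toℕ k)) * (1# - X) ^ qNumber q (toℕ k) * ∏[ i < n ∸ toℕ k ] (X - C (+ (q ℕ.^ toℕ i)))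

  eval-summand : ∀ t k → + gaussian q n (toℕ k) ℤ.* (1ℤ ℤ.- t) ℤ.^ qNumber q (toℕ k) ℤ.* qFactorial q t (n ∸ toℕ k) ≡
                         eval t (summand k)
  eval-summand t k = ≡.sym (≡.trans
    (eval-* t (C (+ gaussian q n (toℕ k)) * (1# - X) ^ qNumber q (toℕ k)) (∏[ i < n ∸ toℕ k ] (X - C (+ (q ℕ.^ toℕ i)))))
    (≡.cong₂ ℤ._*_ (≡.trans (eval-* t (C (+ gaussian q n (toℕ k))) ((1# - X) ^ qNumber q (toℕ k))) (≡.cong₂ ℤ._*_ (eval-C t (+ gaussian q n (toℕ k)))
        (≡.trans (eval-^ t (1# - X) (qNumber q (toℕ k)))
          (≡.cong (ℤ._^ qNumber q (toℕ k)) (≡.trans (eval-sub t 1# X) (≡.cong₂ ℤ._-_ (eval-C t 1ℤ) (eval-X t)))))))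
      (eval-qFactorial q t (n ∸ toℕ k))))

  eval-X^ : ∀ t k → eval t (X ^ k) ≡ t ℤ.^ k
  eval-X^ t k = ≡.trans (eval-^ t X k) (≡.cong (ℤ._^ k) (eval-X t))

  eval-sign : ∀ t → -1ℤ ℤ.^ ProjectiveSpace.∣points∣ F n ≡ eval t sign
  eval-sign t = ≡.trans (≡.cong (-1ℤ ℤ.^_) (∣points∣≡qNumber F n)) (≡.sym (≡.trans (eval-^ t (- 1#) (qNumber q n))
    (≡.cong (ℤ._^ qNumber q n) (≡.trans (eval-neg t 1#) (≡.cong ℤ.-_ (eval-C t 1ℤ))))))

  -- The exponent n + 0 and the factor `X ^ 0` come from cross-multiplying the fractions. The point
  -- t stays a variable; its equation with q^m is used only around the count of tuples in `∑ˢ-rank`.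
  at : ∀ t m → t ≡ qPow q m →
       eval t (χ (dual PG[ n -1, F ]) * X ^ (n ℕ.+ 0)) ≡ eval t (sign * (∑[ k ≤ n ] summand k) * X ^ 0)
  at t m t≡q^m = begin
    eval t (χ (dual PG[ n -1, F ]) * X ^ (n ℕ.+ 0))
      ≡⟨ eval-* t (χ (dual PG[ n -1, F ])) (X ^ (n ℕ.+ 0)) ⟩
    eval t (χ (dual PG[ n -1, F ])) ℤ.* eval t (X ^ (n ℕ.+ 0))
      ≡⟨ ≡.cong (eval t (χ (dual PG[ n -1, F ])) ℤ.*_)
           (≡.trans (eval-X^ t (n ℕ.+ 0)) (≡.cong (t ℤ.^_) (≡.trans (ℕ.+-identityʳ n) (≡.sym rank-⊤)))) ⟩
    eval t (χ (dual PG[ n -1, F ])) ℤ.* t ℤ.^ rank ⊤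
      ≡⟨ eval-χ-dual PG[ n -1, F ] t ⟩
    -1ℤ ℤ.^ ProjectiveSpace.∣points∣ F n ℤ.* ∑ˢ (λ B → (ℤ.- t) ℤ.^ ∣ B ∣ ℤ.* t ℤ.^ (rank ⊤ ∸ rank B))
      ≡⟨ ≡.cong₂ ℤ._*_ (eval-sign t) (≡.trans
           (∑ˢ-cong λ B → ≡.cong₂ (λ x r → (ℤ.- t) ℤ.^ ∣ B ∣ ℤ.* x ℤ.^ (r ∸ rank B)) t≡q^m rank-⊤)
           (∑ˢ-rank F n (ℤ.- t) m)) ⟩
    eval t sign ℤ.* kernelSum q n (qPow q m) (λ k → (1ℤ ℤ.- t) ℤ.^ qNumber q k)
      ≡⟨ ≡.cong (λ x → eval t sign ℤ.* kernelSum q n x (λ k → (1ℤ ℤ.- t) ℤ.^ qNumber q k)) t≡q^m ⟨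
    eval t sign ℤ.* kernelSum q n t (λ k → (1ℤ ℤ.- t) ℤ.^ qNumber q k)
      ≡⟨ ≡.cong (eval t sign ℤ.*_) (≡.trans (ℤ∑.sum-cong-≗ (eval-summand t)) (≡.sym (eval-sum t summand))) ⟩
    eval t sign ℤ.* eval t (∑[ k ≤ n ] summand k)
      ≡⟨ eval-* t sign (∑[ k ≤ n ] summand k) ⟨
    eval t (sign * (∑[ k ≤ n ] summand k))
      ≡⟨ ℤ.*-identityʳ _ ⟨
    eval t (sign * (∑[ k ≤ n ] summand k)) ℤ.* 1ℤ
      ≡⟨ ≡.cong (eval t (sign * (∑[ k ≤ n ] summand k)) ℤ.*_) (eval-C t 1ℤ) ⟨
    eval t (sign * (∑[ k ≤ n ] summand k)) ℤ.* eval t (X ^ 0)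
      ≡⟨ eval-* t (sign * (∑[ k ≤ n ] summand k)) (X ^ 0) ⟨
    eval t (sign * (∑[ k ≤ n ] summand k) * X ^ 0) ∎
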